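{- Let $X = \{x_1,\dots,x_{10}\}$ be points in $\mathbb{R}^2$ and let $C_1,\dots,C_m$ be a partition of $X$ such that $|C_j| \leq 3$ for every $j = 1,\dots,m$. Then there is a partition $X_1,\dots,X_4$ of $X$ such that $|X_i \cap C_j| \leq 1$ for every $i = 1,\dots,4$ and $j = 1,\dots,m$ (each $X_i$ is rainbow), and such that \[ \operatorname{conv}(X_1) \cap \operatorname{conv}(X_2) \cap \operatorname{conv}(X_3) \cap \operatorname{conv}(X_4) \neq \emptyset. \]
   Context: The sets $C_1,\dots,C_m$ are called color classes; a part $X_i$ is rainbow if its points have pairwise distinct colors, i.e. it meets each color class in at most one point. -}

module Defs where

open import Level using (Level; _⊔_) renaming (suc to lsuc)
import Data.Nat as ℕ
import Data.Fin as Fin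
open import Data.Nat using (ℕ; zero; suc; _≤_)
open import Data.Fin using (Fin; zero; suc; _≟_)
open import Data.List using (length; filter)
open import Data.List.Base using (allFin)
open import Data.Product using (Σ; _×_; ∃; ∃-syntax)
open import Relation.Nullary using (¬_)
open import Relation.Binary.PropositionalEquality using (_≡_)
open import Relation.Binary.Core using (Rel)
open import Relation.Binary.Structures using (IsTotalOrder)
open import Algebra.Bundles using (CommutativeRing)

-- The real numbers, axiomatised as a Dedekind-complete ordered field
-- (these axioms characterise ℝ up to isomorphism).
record RealField (c ℓ ℓ₂ : Level) : Set (lsuc (c ⊔ ℓ ⊔ ℓ₂)) where
  field
    commRing : CommutativeRing c ℓ
  open CommutativeRing commRing public
  field
    _≤ᵣ_        : Rel Carrier ℓ₂
    isTotalOrder : IsTotalOrder _≈_ _≤ᵣ_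
    +-mono-≤    : ∀ {x y} z → x ≤ᵣ y → (x + z) ≤ᵣ (y + z)
    *-nonneg    : ∀ {x y} → 0# ≤ᵣ x → 0# ≤ᵣ y → 0# ≤ᵣ (x * y)
    0≉1         : ¬ (0# ≈ 1#)
    inverse     : ∀ x → ¬ (x ≈ 0#) → ∃[ y ] (x * y ≈ 1#)
    sup : (P : Carrier → Set c) → (∃[ x ] P x) → (∃[ b ] (∀ x → P x → x ≤ᵣ b)) →
          ∃[ s ] ((∀ x → P x → x ≤ᵣ s) × (∀ b → (∀ x → P x → x ≤ᵣ b) → s ≤ᵣ b))

module Geometry {c ℓ ℓ₂} (ℝ : RealField c ℓ ℓ₂) where
  open RealField ℝ hiding (zero)

  Point : Set c
  Point = Carrier × Carrier

  open import Data.Product using (_,_; proj₁; proj₂)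

  _≈ₚ_ : Point → Point → Set ℓ
  p ≈ₚ q = (proj₁ p ≈ proj₁ q) × (proj₂ p ≈ proj₂ q)

  Σᶠ : ∀ {n} → (Fin n → Carrier) → Carrier
  Σᶠ {ℕ.zero}  f = 0#
  Σᶠ {ℕ.suc n} f = f Fin.zero + Σᶠ (λ i → f (suc i))

  InConv : ∀ {n} {s} → (Fin n → Point) → (Fin n → Set s) → Point → Set (c ⊔ ℓ ⊔ ℓ₂ ⊔ s)
  InConv {n} x S p = ∃[ λ′ ] (
      (∀ i → 0# ≤ᵣ λ′ i)
    × (∀ i → ¬ S i → λ′ i ≈ 0#)
    × (Σᶠ λ′ ≈ 1#)
    × (Σᶠ (λ i → λ′ i * proj₁ (x i)) ≈ proj₁ p)
    × (Σᶠ (λ i → λ′ i * proj₂ (x i)) ≈ proj₂ p))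

classSize : ∀ {n m} → (Fin n → Fin m) → Fin m → ℕ
classSize {n} col j = length (filter (λ i → col i ≟ j) (allFin n))

{-# OPTIONS --safe #-}
-- For a fixed partition, failure of the four hulls to meet is an open condition on the points (Gordan's
-- theorem applied to Sarkaria's lifting), so the points may be moved into general position.
--
-- Let p slide along a segment spanned by two of the points. The other eight points, ordered by their direction
-- from p modulo π and marked as above or below the segment, form a word; it changes only when p crosses another
-- segment, exchanging neighbours of opposite sign, or when p arrives at a point. Where p lies on two segments
-- it is contained in both and in every triangle whose three letters alternate in sign, and similarly at a point;
-- so a rainbow partition can be read off the word. At each crossing one may switch to the other segment.
-- This is a finite game against the unknown order of the crossings. From the leftmost point, whose word
-- is known, one always reaches one of eight words; and from each of these, for each colouring with classes of at
-- most three points, one always reaches a rainbow partition. Both facts are established by exhaustive search.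
module Submission where

open import Defs
open import Level using (Level)
open import Data.Nat using (ℕ; _≤_)
open import Data.Fin using (Fin)
open import Data.Product using (_×_; Σ-syntax)
open import Relation.Binary.PropositionalEquality using (_≡_)

-- While `p` moves towards its target, upper rays turn one way and reflected lower rays the other.
-- So only a `u` standing before an `l` can meet it, and every crossing removes one such pair; a
-- segment carries at most sixteen crossings. Two rays of equal sign may change places without `p`
-- meeting any segment. Alternation compares opposite signs only and does not notice this. Words
-- therefore matter only up to order within runs of equal sign, and any choice inside a run has to
-- be left to the opponent. Angular orders are kept weak: a crossing then satisfies the words on
-- both of its sides, and no step past it has to be taken. Strictness is recovered from general
-- position where it is needed. The field comes with a total order but without decidable equality;
-- the signs on which all case distinctions rest are decided by means of suprema.

module OrderedField where
  open import Level using (Level; Lift; lift; lower)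
  open import Data.Nat.Base as ℕ using (ℕ; zero; suc)
  open import Data.Integer.Base as ℤ using (ℤ; +_; -[1+_])
  import Data.Integer.Properties as ℤ
  open import Data.Bool.Base using (Bool; true; false)
  open import Data.Maybe.Base using (Maybe; just; nothing)
  open import Data.Product.Base using (_×_; _,_; proj₁; proj₂; ∃-syntax)
  open import Data.Sum.Base using (_⊎_; inj₁; inj₂)
  open import Data.Empty using (⊥-elim)
  open import Relation.Nullary using (¬_; Dec; yes; no)
  open import Relation.Binary.PropositionalEquality as ≡ using (_≡_)
  open import Relation.Binary.Structures using (IsTotalOrder)
  open import Algebra.Bundles using (CommutativeRing)
  import Algebra.Properties.Ring as RingProperties
  import Algebra.Properties.AbelianGroup as AbelianGroupProperties
  import Algebra.Properties.Semiring.Mult as SemiringMult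
  import Algebra.Solver.Ring as RingSolver
  open import Algebra.Solver.Ring.AlmostCommutativeRing using (fromCommutativeRing; _-Raw-AlmostCommutative⟶_)

  -- The ring solver with integer coefficients, so that terms may cancel over an abstract ring.
  module IntegerSolver {c ℓ} (R : CommutativeRing c ℓ) where
    open CommutativeRing R
    open RingProperties ring using (-‿distribˡ-*; -‿distribʳ-*; -0#≈0#; -‿involutive)
    open AbelianGroupProperties +-abelianGroup using (⁻¹-∙-comm)
    open SemiringMult semiring renaming (_×_ to _·_)
    open import Relation.Binary.Reasoning.Setoid setoid

    ⟦_⟧ : ℤ → Carrier
    ⟦ + n ⟧      = n · 1#
    ⟦ -[1+ n ] ⟧ = - (suc n · 1#)

    -homo : ∀ i → ⟦ ℤ.- i ⟧ ≈ - ⟦ i ⟧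
    -homo (+ zero)   = sym -0#≈0#
    -homo (+ suc n)  = refl
    -homo -[1+ n ]   = sym (-‿involutive _)

    ⊖-homo : ∀ m n → ⟦ m ℤ.⊖ n ⟧ ≈ m · 1# + - (n · 1#)
    ⊖-homo zero zero = trans (sym (+-identityʳ _)) (+-congˡ (sym -0#≈0#))
    ⊖-homo zero (suc n) = sym (+-identityˡ _)
    ⊖-homo (suc m) zero = trans (sym (+-identityʳ _)) (+-congˡ (sym -0#≈0#))
    ⊖-homo (suc m) (suc n) = begin
      ⟦ suc m ℤ.⊖ suc n ⟧                      ≡⟨ ≡.cong ⟦_⟧ (ℤ.[1+m]⊖[1+n]≡m⊖n m n) ⟩
      ⟦ m ℤ.⊖ n ⟧                              ≈⟨ ⊖-homo m n ⟩
      m · 1# + - (n · 1#)                      ≈⟨ +-identityˡ _ ⟨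
      0# + (m · 1# + - (n · 1#))               ≈⟨ +-congʳ (-‿inverseʳ 1#) ⟨
      (1# + - 1#) + (m · 1# + - (n · 1#))      ≈⟨ +-assoc _ _ _ ⟩
      1# + (- 1# + (m · 1# + - (n · 1#)))      ≈⟨ +-congˡ (+-assoc _ _ _) ⟨
      1# + ((- 1# + m · 1#) + - (n · 1#))      ≈⟨ +-congˡ (+-congʳ (+-comm _ _)) ⟩
      1# + ((m · 1# + - 1#) + - (n · 1#))      ≈⟨ +-congˡ (+-assoc _ _ _) ⟩
      1# + (m · 1# + (- 1# + - (n · 1#)))      ≈⟨ +-assoc _ _ _ ⟨
      (1# + m · 1#) + (- 1# + - (n · 1#))      ≈⟨ +-congˡ (⁻¹-∙-comm _ _) ⟩
      (1# + m · 1#) + - (1# + n · 1#)          ∎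

    +-homo : ∀ i j → ⟦ i ℤ.+ j ⟧ ≈ ⟦ i ⟧ + ⟦ j ⟧
    +-homo (+ m) (+ n) = ×-homo-+ 1# m n
    +-homo (+ m) -[1+ n ] = ⊖-homo m (suc n)
    +-homo -[1+ m ] (+ n) = trans (⊖-homo n (suc m)) (+-comm _ _)
    +-homo -[1+ m ] -[1+ n ] = begin
      - (suc (suc (m ℕ.+ n)) · 1#)         ≈⟨ -‿cong (+-congˡ (×-homo-+ 1# (suc m) n)) ⟩
      - (1# + (suc m · 1# + n · 1#))       ≈⟨ -‿cong (+-congˡ (+-comm _ _)) ⟩
      - (1# + (n · 1# + suc m · 1#))       ≈⟨ -‿cong (+-assoc _ _ _) ⟨
      - (suc n · 1# + suc m · 1#)          ≈⟨ -‿cong (+-comm _ _) ⟩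
      - (suc m · 1# + suc n · 1#)          ≈⟨ ⁻¹-∙-comm _ _ ⟨
      - (suc m · 1#) + - (suc n · 1#)      ∎

    *-homo : ∀ i j → ⟦ i ℤ.* j ⟧ ≈ ⟦ i ⟧ * ⟦ j ⟧
    *-homo (+ m) (+ n) = trans (reflexive (≡.cong ⟦_⟧ (≡.sym (ℤ.pos-* m n)))) (×1-homo-* m n)
    *-homo (+ m) -[1+ n ] = begin
      ⟦ + m ℤ.* -[1+ n ] ⟧             ≡⟨ ≡.cong ⟦_⟧ (ℤ.neg-distribʳ-* (+ m) (+ suc n)) ⟨
      ⟦ ℤ.- (+ m ℤ.* + suc n) ⟧        ≈⟨ -homo (+ m ℤ.* + suc n) ⟩
      - ⟦ + m ℤ.* + suc n ⟧            ≈⟨ -‿cong (*-homo (+ m) (+ suc n)) ⟩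
      - (⟦ + m ⟧ * ⟦ + suc n ⟧)        ≈⟨ -‿distribʳ-* _ _ ⟩
      ⟦ + m ⟧ * - ⟦ + suc n ⟧          ∎
    *-homo -[1+ m ] (+ n) = begin
      ⟦ -[1+ m ] ℤ.* + n ⟧             ≡⟨ ≡.cong ⟦_⟧ (ℤ.neg-distribˡ-* (+ suc m) (+ n)) ⟨
      ⟦ ℤ.- (+ suc m ℤ.* + n) ⟧        ≈⟨ -homo (+ suc m ℤ.* + n) ⟩
      - ⟦ + suc m ℤ.* + n ⟧            ≈⟨ -‿cong (*-homo (+ suc m) (+ n)) ⟩
      - (⟦ + suc m ⟧ * ⟦ + n ⟧)        ≈⟨ -‿distribˡ-* _ _ ⟩
      - ⟦ + suc m ⟧ * ⟦ + n ⟧          ∎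
    *-homo -[1+ m ] -[1+ n ] = begin
      ⟦ + suc m ℤ.* + suc n ⟧                ≈⟨ *-homo (+ suc m) (+ suc n) ⟩
      ⟦ + suc m ⟧ * ⟦ + suc n ⟧              ≈⟨ -‿involutive _ ⟨
      - - (⟦ + suc m ⟧ * ⟦ + suc n ⟧)        ≈⟨ -‿cong (-‿distribˡ-* _ _) ⟩
      - (- ⟦ + suc m ⟧ * ⟦ + suc n ⟧)        ≈⟨ -‿distribʳ-* _ _ ⟩
      - ⟦ + suc m ⟧ * - ⟦ + suc n ⟧          ∎

    morphism : ℤ.+-*-rawRing -Raw-AlmostCommutative⟶ fromCommutativeRing R
    morphism = record
      { ⟦_⟧ = ⟦_⟧ ; +-homo = +-homo ; *-homo = *-homo ; -‿homo = -homo
      ; 0-homo = refl ; 1-homo = +-identityʳ 1# }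

    _coeff≟_ : ∀ i j → Maybe (⟦ i ⟧ ≈ ⟦ j ⟧)
    i coeff≟ j with i ℤ.≟ j
    ... | yes i≡j = just (reflexive (≡.cong ⟦_⟧ i≡j))
    ... | no _    = nothing

    open RingSolver ℤ.+-*-rawRing (fromCommutativeRing R) morphism _coeff≟_ public
      using (solve; _:=_; _:+_; _:*_; _:-_; :-_; con)

  -- Signs in a complete ordered field.

  module Ordered {c ℓ ℓ₂} (ℝ : RealField c ℓ ℓ₂) where
    open RealField ℝ hiding (zero) public
    open IntegerSolver commRing public
    open IsTotalOrder isTotalOrder public using (total; antisym; ≤-respˡ-≈; ≤-respʳ-≈)
      renaming (trans to ≤-trans; reflexive to ≤-reflexive)
    open RingProperties ring public using (-0#≈0#)

    NN : Carrier → Set _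
    NN x = 0# ≤ᵣ x

    opaque
      NN-resp : ∀ {x y} → x ≈ y → NN x → NN y
      NN-resp = ≤-respʳ-≈

      ≤⇒NN : ∀ {x y} → x ≤ᵣ y → NN (y + - x)
      ≤⇒NN {x} p = ≤-respˡ-≈ (-‿inverseʳ x) (+-mono-≤ (- x) p)

      NN⇒≤ : ∀ {x y} → NN (y + - x) → x ≤ᵣ y
      NN⇒≤ {x} {y} p = ≤-respˡ-≈ (+-identityˡ x)
        (≤-respʳ-≈ (solve 2 (λ x y → (y :+ :- x) :+ x := y) refl x y) (+-mono-≤ x p))

      NN-0 : NN 0#
      NN-0 = ≤-reflexive refl

      NN-≈0 : ∀ {x} → x ≈ 0# → NN x
      NN-≈0 p = NN-resp (sym p) NN-0

      NN-+ : ∀ {x y} → NN x → NN y → NN (x + y)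
      NN-+ {x} {y} p q = ≤-trans q (≤-respˡ-≈ (+-identityˡ y) (+-mono-≤ y p))

      NN-* : ∀ {x y} → NN x → NN y → NN (x * y)
      NN-* = *-nonneg

      NN-antisym : ∀ {x} → NN x → NN (- x) → x ≈ 0#
      NN-antisym {x} p q = antisym (NN⇒≤ (NN-resp (sym (+-identityˡ _)) q)) p

      NN-total : ∀ x → NN x ⊎ NN (- x)
      NN-total x with total 0# x
      ... | inj₁ p = inj₁ p
      ... | inj₂ p = inj₂ (NN-resp (+-identityˡ _) (≤⇒NN p))

      NN-1 : NN 1#
      NN-1 with NN-total 1#
      ... | inj₁ p = p
      ... | inj₂ p = NN-resp (trans (solve 1 (λ o → (:- o) :* (:- o) := o :* o) refl 1#) (*-identityˡ 1#)) (NN-* p p)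

    private
      opaque
        infixr 8 _·_
        _·_ : ℕ → Carrier → Carrier
        zero  · x = 0#
        suc n · x = x + n · x

        0≰-1 : ¬ NN (- 1#)
        0≰-1 p = 0≉1 (sym (NN-antisym NN-1 p))

        -- If `s` is the supremum of the multiples of `x`, then `s - x` bounds them too, because
        -- adding `x` to a multiple gives a multiple; hence `s ≤ s - x`.
        archimedean : ∀ x → (∀ n → (n · x) ≤ᵣ 1#) → x ≤ᵣ 0#
        archimedean x bounded with sup (λ y → ∃[ n ] y ≡ n · x) (0# , 0 , ≡.refl) (1# , λ { _ (n , ≡.refl) → bounded n })
        ... | s , upper , least = NN⇒≤ (NN-resp (solve 2 (λ s x → (s :+ :- x) :+ :- s := con (+ 0) :+ :- x) refl s x) (≤⇒NN s≤s-x))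
          where
          s≤s-x : s ≤ᵣ (s + - x)
          s≤s-x = least (s + - x) λ { _ (n , ≡.refl) → NN⇒≤ (NN-resp
            (solve 3 (λ s x y → s :+ :- (x :+ y) := (s :+ :- x) :+ :- y) refl s x (n · x))
            (≤⇒NN (upper _ (suc n , ≡.refl)))) }

        -- Suprema decide weak excluded middle: look at the least upper bound of {0} ∪ {2 ∣ Q}.
        weakExcludedMiddle : (Q : Set c) → ¬ Q ⊎ ¬ ¬ Q
        weakExcludedMiddle Q with sup (λ y → (y ≡ 0#) ⊎ ((y ≡ 1# + 1#) × Q)) (0# , inj₁ ≡.refl)
          (1# + 1# , λ { _ (inj₁ ≡.refl) → NN-+ NN-1 NN-1 ; _ (inj₂ (≡.refl , _)) → ≤-reflexive refl })
        ... | s , upper , least with total s 1#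
        ...   | inj₁ s≤1 = inj₁ λ q → 0≰-1 (NN-resp (solve 1 (λ o → o :+ :- (o :+ o) := :- o) refl 1#)
                  (≤⇒NN (≤-trans (upper _ (inj₂ (≡.refl , q))) s≤1)))
        ...   | inj₂ 1≤s = inj₂ λ ¬q → 0≰-1 (NN-resp (+-identityˡ _) (≤⇒NN
                  (≤-trans 1≤s (least 0# λ { _ (inj₁ ≡.refl) → ≤-reflexive refl ; _ (inj₂ (_ , q)) → ⊥-elim (¬q q) }))))

        -- A Boolean trace of totality. Statements about it live at level zero, so they can be
        -- lifted into the predicates that `sup` accepts, and equations between Booleans are stable
        -- under double negation. For `x ≈ y` either answer may occur.
        leq : Carrier → Carrier → Bool
        leq x y with total x y
        ... | inj₁ _ = true
        ... | inj₂ _ = false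

        leq-sound : ∀ x y → leq x y ≡ true → x ≤ᵣ y
        leq-sound x y eq with total x y
        ... | inj₁ p = p

        ·-zero : ∀ {x} n → x ≈ 0# → n · x ≈ 0#
        ·-zero zero    p = refl
        ·-zero (suc n) p = trans (+-cong p (·-zero n p)) (+-identityˡ _)

        leq-complete : ∀ {x} n → x ≈ 0# → leq (n · x) 1# ≡ true
        leq-complete {x} n p with total (n · x) 1#
        ... | inj₁ _ = ≡.refl
        ... | inj₂ q = ⊥-elim (0≰-1 (NN-resp (+-identityˡ _) (≤⇒NN (≤-respʳ-≈ (·-zero n p) q))))

        -- Vanishing is encoded by the Boolean tests of `n · x` against `1#`, to which weak excluded
        -- middle applies. If the tests cannot all succeed, `x` is not zero; if it is impossible
        -- that they do not all succeed, each one does, its outcome being a Boolean, and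
        -- `archimedean` gives `x ≤ 0`.
        decNN : ∀ x → NN x → Dec (x ≈ 0#)
        decNN x 0≤x with weakExcludedMiddle (Lift c (∀ n → leq (n · x) 1# ≡ true))
        ... | inj₁ ¬q  = no λ p → ¬q (lift λ n → leq-complete n p)
        ... | inj₂ ¬¬q = yes (antisym (archimedean x bounded) 0≤x)
          where
          bounded : ∀ n → (n · x) ≤ᵣ 1#
          bounded n with leq (n · x) 1# in eq
          ... | true  = leq-sound _ _ eq
          ... | false = ⊥-elim (¬¬q λ q → case (≡.trans (≡.sym eq) (lower q n)))
            where
            case : ¬ (false ≡ true)
            case ()

    opaque
      _≈0? : ∀ x → Dec (x ≈ 0#)
      x ≈0? with NN-total x
      ... | inj₁ p = decNN x p
      ... | inj₂ p with decNN (- x) p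
      ...   | yes q = yes (trans (solve 1 (λ x → x := :- (:- x)) refl x) (trans (-‿cong q) -0#≈0#))
      ...   | no ¬q = no λ q → ¬q (trans (-‿cong q) -0#≈0#)

    Pos : Carrier → Set _
    Pos x = NN x × ¬ (x ≈ 0#)

    opaque
      Pos-resp : ∀ {x y} → x ≈ y → Pos x → Pos y
      Pos-resp e (p , q) = NN-resp e p , λ z → q (trans e z)

    data Sign (x : Carrier) : Set (c Level.⊔ ℓ Level.⊔ ℓ₂) where
      negative : Pos (- x) → Sign x
      vanishes : x ≈ 0# → Sign x
      positive : Pos x → Sign x

    opaque
      sign : ∀ x → Sign x
      sign x with x ≈0?
      ... | yes p = vanishes p
      ... | no ¬p with NN-total x
      ...   | inj₁ q = positive (q , ¬p)
      ...   | inj₂ q = negative (q , λ r → ¬p (trans (solve 1 (λ x → x := :- (:- x)) refl x) (trans (-‿cong r) -0#≈0#)))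

      Pos-contra : ∀ {x} → Pos x → ¬ NN (- x)
      Pos-contra (p , q) r = q (NN-antisym p r)

      Pos-+ : ∀ {x y} → Pos x → NN y → Pos (x + y)
      Pos-+ {x} {y} (p , q) r = NN-+ p r , λ e →
        q (NN-antisym p (NN-resp (trans (solve 2 (λ x y → y := (x :+ y) :+ :- x) refl x y) (trans (+-congʳ e) (+-identityˡ _))) r))

      NN-+-Pos : ∀ {x y} → NN x → Pos y → Pos (x + y)
      NN-+-Pos p q = Pos-resp (+-comm _ _) (Pos-+ q p)

      noZeroDivisors : ∀ {x y} → ¬ (x ≈ 0#) → x * y ≈ 0# → y ≈ 0#
      noZeroDivisors {x} {y} p e with inverse x p
      ... | z , xz≈1 = begin
          y             ≈⟨ *-identityˡ y ⟨
          1# * y        ≈⟨ *-congʳ xz≈1 ⟨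
          (x * z) * y   ≈⟨ solve 3 (λ x y z → (x :* z) :* y := z :* (x :* y)) refl x y z ⟩
          z * (x * y)   ≈⟨ *-congˡ e ⟩
          z * 0#        ≈⟨ zeroʳ z ⟩
          0#            ∎
        where open import Relation.Binary.Reasoning.Setoid setoid

      Pos-* : ∀ {x y} → Pos x → Pos y → Pos (x * y)
      Pos-* (p , q) (p′ , q′) = NN-* p p′ , λ e → q′ (noZeroDivisors q e)

      Pos-1 : Pos 1#
      Pos-1 = NN-1 , λ e → 0≉1 (sym e)

      NN-cancel : ∀ {x y} → Pos x → NN (x * y) → NN y
      NN-cancel {x} {y} p q with sign y
      ... | positive r = proj₁ r
      ... | vanishes r = NN-≈0 r
      ... | negative r = ⊥-elim (Pos-contra (Pos-* p r) (NN-resp (solve 2 (λ x y → x :* y := :- (x :* :- y)) refl x y) q))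

      Pos-cancel : ∀ {x y} → Pos x → Pos (x * y) → Pos y
      Pos-cancel p (q , r) = NN-cancel p q , λ e → r (trans (*-congˡ e) (zeroʳ _))

      Pos-inverse : ∀ {x} → Pos x → ∃[ y ] (Pos y × (x * y ≈ 1#))
      Pos-inverse {x} p with inverse x (proj₂ p)
      ... | y , e = y , Pos-cancel p (Pos-resp (sym e) Pos-1) , e

-- Theorems of the alternative: Gordan's theorem and Sarkaria's lifting.

module Separation where
  open OrderedField
  open import Data.Nat.Base using (zero; suc)
  open import Data.Fin.Base as Fin using (Fin; zero; suc; remQuot; combine; inject₁)
  open import Data.Fin.Properties using (_≟_; remQuot-combine)
  open import Data.Integer.Base using (+_)
  open import Data.Product.Base using (_×_; _,_; proj₁; proj₂; ∃-syntax)
  open import Data.Sum.Base using (_⊎_; inj₁; inj₂)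
  open import Data.Empty using (⊥-elim)
  open import Function.Base using (_∘_)
  open import Relation.Nullary using (¬_; yes; no; contradiction)
  open import Relation.Binary.PropositionalEquality as ≡ using (_≡_; _≢_)

  module Sums {c ℓ ℓ₂} (ℝ : RealField c ℓ ℓ₂) where
    open Ordered ℝ public
    open Geometry ℝ public using (Point; Σᶠ; InConv)

    Σ-cong : ∀ {n} {f g : Fin n → Carrier} → (∀ i → f i ≈ g i) → Σᶠ f ≈ Σᶠ g
    Σ-cong {zero}  e = refl
    Σ-cong {suc n} e = +-cong (e zero) (Σ-cong (e ∘ suc))

    Σ-+ : ∀ {n} (f g : Fin n → Carrier) → Σᶠ (λ i → f i + g i) ≈ Σᶠ f + Σᶠ g
    Σ-+ {zero}  f g = sym (+-identityʳ 0#)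
    Σ-+ {suc n} f g = trans (+-congˡ (Σ-+ {n} (f ∘ suc) (g ∘ suc)))
      (solve 4 (λ a b x y → (a :+ b) :+ (x :+ y) := (a :+ x) :+ (b :+ y)) refl (f zero) (g zero) (Σᶠ (f ∘ suc)) (Σᶠ (g ∘ suc)))

    Σ-* : ∀ {n} a (f : Fin n → Carrier) → Σᶠ (λ i → a * f i) ≈ a * Σᶠ f
    Σ-* {zero}  a f = sym (zeroʳ a)
    Σ-* {suc n} a f = trans (+-congˡ (Σ-* {n} a (f ∘ suc))) (sym (distribˡ a _ _))

    Σ-neg : ∀ {n} (f : Fin n → Carrier) → Σᶠ (λ i → - f i) ≈ - Σᶠ f
    Σ-neg {zero}  f = sym -0#≈0#
    Σ-neg {suc n} f = trans (+-congˡ (Σ-neg {n} (f ∘ suc))) (solve 2 (λ a b → :- a :+ :- b := :- (a :+ b)) refl (f zero) (Σᶠ (f ∘ suc)))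

    Σ-0 : ∀ n → Σᶠ {n} (λ _ → 0#) ≈ 0#
    Σ-0 zero    = refl
    Σ-0 (suc n) = trans (+-identityˡ _) (Σ-0 n)

    Σ-NN : ∀ {n} (f : Fin n → Carrier) → (∀ i → NN (f i)) → NN (Σᶠ f)
    Σ-NN {zero}  f p = NN-0
    Σ-NN {suc n} f p = NN-+ (p zero) (Σ-NN {n} (f ∘ suc) (p ∘ suc))

    weighted-NN : ∀ {n} (w a : Fin n → Carrier) → (∀ i → NN (w i)) → (∀ i → w i ≈ 0# ⊎ Pos (a i)) → NN (Σᶠ (λ i → w i * a i))
    weighted-NN {n} w a p q = Σ-NN {n} (λ i → w i * a i) λ i → case i (q i)
      where
      case : ∀ i → w i ≈ 0# ⊎ Pos (a i) → NN (w i * a i)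
      case i (inj₁ e) = NN-≈0 (trans (*-congʳ e) (zeroˡ _))
      case i (inj₂ r) = NN-* (p i) (proj₁ r)

    weighted-Pos : ∀ {n} (w a : Fin n → Carrier) → (∀ i → NN (w i)) → Pos (Σᶠ w) →
                   (∀ i → w i ≈ 0# ⊎ Pos (a i)) → Pos (Σᶠ (λ i → w i * a i))
    weighted-Pos {zero}  w a p s q = contradiction refl (proj₂ s)
    weighted-Pos {suc n} w a p s q with sign (w zero) | q zero
    ... | negative r | _      = ⊥-elim (Pos-contra r (NN-resp (solve 1 (λ x → x := :- (:- x)) refl (w zero)) (p zero)))
    ... | positive r | inj₁ e = contradiction e (proj₂ r)
    ... | positive r | inj₂ t = Pos-+ (Pos-* r t) (weighted-NN (w ∘ suc) (a ∘ suc) (p ∘ suc) (q ∘ suc))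
    ... | vanishes e | _      = Pos-resp (sym (trans (+-congʳ (trans (*-congʳ e) (zeroˡ _))) (+-identityˡ _)))
      (weighted-Pos (w ∘ suc) (a ∘ suc) (p ∘ suc) (Pos-resp (trans (+-congʳ e) (+-identityˡ _)) s) (q ∘ suc))

    Eventually : ∀ {a} → (Carrier → Set a) → Set _
    Eventually P = ∃[ δ ] (Pos δ × (∀ ε → Pos ε → NN (δ + - ε) → P ε))

    eventually-× : ∀ {a b} {P : Carrier → Set a} {Q : Carrier → Set b} →
                   Eventually P → Eventually Q → Eventually (λ ε → P ε × Q ε)
    eventually-× (δ , p , f) (δ′ , p′ , f′) with NN-total (δ′ + - δ)
    ... | inj₁ q = δ  , p  , λ ε r s → f ε r s , f′ ε r (NN-resp (solve 3 (λ d e x → (e :+ :- d) :+ (d :+ :- x) := e :+ :- x) refl δ δ′ ε) (NN-+ q s))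
    ... | inj₂ q = δ′ , p′ , λ ε r s → f ε r (NN-resp (solve 3 (λ d e x → :- (e :+ :- d) :+ (e :+ :- x) := d :+ :- x) refl δ δ′ ε) (NN-+ q s)) , f′ ε r s

    eventually-map : ∀ {a b} {P : Carrier → Set a} {Q : Carrier → Set b} →
                     (∀ ε → Pos ε → P ε → Q ε) → Eventually P → Eventually Q
    eventually-map g (δ , p , f) = δ , p , λ ε r s → g ε r (f ε r s)

    eventually-always : ∀ {a} {P : Carrier → Set a} → (∀ ε → P ε) → Eventually P
    eventually-always f = 1# , Pos-1 , λ ε _ _ → f ε

    eventually-∀ : ∀ {n a} {P : Fin n → Carrier → Set a} → (∀ i → Eventually (P i)) → Eventually (λ ε → ∀ i → P i ε)
    eventually-∀ {zero}  f = eventually-always λ ε ()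
    eventually-∀ {suc n} {P = P} f = eventually-map join (eventually-× (f zero) (eventually-∀ (f ∘ suc)))
      where
      join : ∀ ε → Pos ε → P zero ε × (∀ i → P (suc i) ε) → ∀ i → P i ε
      join ε _ (p , q) zero    = p
      join ε _ (p , q) (suc i) = q i

    eventually-pos : ∀ {a} b → Pos a → Eventually (λ ε → Pos (a + ε * b))
    eventually-pos {a} b p = by-sign (sign b)
      where
      -- The bound `a * z` is `a / (2 |b|)`; below it `ε * b` uses up at most half of `a`.
      shrink : Pos (- b) → ∃[ z ] (Pos z × ((- b + - b) * z ≈ 1#)) → Eventually (λ ε → Pos (a + ε * b))
      shrink q (z , z>0 , e) = a * z , Pos-* p z>0 , λ ε r s → Pos-resp (+-congʳ (trans (*-congˡ e) (*-identityʳ _)))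
        (Pos-resp (solve 4 (λ a b z x → (a :* z) :* :- b :+ (a :* z :+ :- x) :* :- b
            := a :* ((:- b :+ :- b) :* z) :+ x :* b) refl a b z ε)
          (Pos-+ (Pos-* (Pos-* p z>0) q) (NN-* s (proj₁ q))))
      by-sign : Sign b → Eventually (λ ε → Pos (a + ε * b))
      by-sign (positive q) = 1# , Pos-1 , λ ε r _ → Pos-+ p (NN-* (proj₁ r) (proj₁ q))
      by-sign (vanishes q) = 1# , Pos-1 , λ ε r _ → Pos-+ p (NN-≈0 (trans (*-congˡ q) (zeroʳ _)))
      by-sign (negative q) = shrink q (Pos-inverse (Pos-+ q (proj₁ q)))

    eventually-≤1 : Eventually (λ ε → NN (1# + - ε))
    eventually-≤1 = 1# , Pos-1 , λ ε _ s → s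

    -- The constant term is halved: one half absorbs `ε * b`, and the other, written as
    -- `(1 - ε)(a/2) + ε(a/2)` with `ε ≤ 1`, absorbs the quadratic term.
    eventually-pos² : ∀ {a} b d → Pos a → Eventually (λ ε → Pos (a + (ε * b + (ε * ε) * d)))
    eventually-pos² {a} b d p = split (Pos-inverse (Pos-+ Pos-1 NN-1))
      where
      split : ∃[ h ] (Pos h × ((1# + 1#) * h ≈ 1#)) → Eventually (λ ε → Pos (a + (ε * b + (ε * ε) * d)))
      split (h , h>0 , e) = eventually-map join (eventually-× eventually-≤1 (eventually-× (eventually-pos b ah) (eventually-pos d ah)))
        where
        ah : Pos (a * h)
        ah = Pos-* p h>0
        half : a * h + 1# * (a * h) ≈ a
        half = trans (+-congʳ (sym (*-identityˡ _)))
          (trans (solve 3 (λ a h o → o :* (a :* h) :+ o :* (a :* h) := a :* ((o :+ o) :* h)) refl a h 1#) (trans (*-congˡ e) (*-identityʳ a)))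
        join : ∀ ε → Pos ε → NN (1# + - ε) × Pos (a * h + ε * b) × Pos (a * h + ε * d) → Pos (a + (ε * b + (ε * ε) * d))
        join ε r (s , t , v) = Pos-resp
          (trans (solve 6 (λ a h b d x o → (a :* h :+ x :* b) :+ ((o :+ :- x) :* (a :* h) :+ x :* (a :* h :+ x :* d))
                      := (a :* h :+ o :* (a :* h)) :+ (x :* b :+ (x :* x) :* d)) refl a h b d ε 1#) (+-congʳ half))
          (Pos-+ t (NN-+ (NN-* s (proj₁ ah)) (NN-* (proj₁ r) (proj₁ v))))

    -- The first nonzero one among `a`, `b`, `d` dominates for small `ε`; a vanishing `a` allows a
    -- factor `ε` to be cancelled.
    eventually-≉0 : ∀ a b d → ¬ (d ≈ 0#) → Eventually (λ ε → ¬ (a + (ε * b + (ε * ε) * d) ≈ 0#))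
    eventually-≉0 a b d d≉0 with sign a
    ... | positive p = eventually-map (λ ε _ → proj₂) (eventually-pos² b d p)
    ... | negative p = eventually-map (λ ε _ q z → proj₂ q
            (trans (solve 4 (λ a b d x → :- a :+ (x :* :- b :+ (x :* x) :* :- d) := :- (a :+ (x :* b :+ (x :* x) :* d))) refl a b d ε)
              (trans (-‿cong z) -0#≈0#))) (eventually-pos² (- b) (- d) p)
    ... | vanishes p = linear (sign b)
      where
      factor : ∀ ε → a + (ε * b + (ε * ε) * d) ≈ ε * (b + ε * d)
      factor ε = trans (+-congʳ p) (solve 4 (λ z b d x → con (+ 0) :+ (x :* b :+ (x :* x) :* d) := x :* (b :+ x :* d)) refl a b d ε)
      linear : Sign b → Eventually (λ ε → ¬ (a + (ε * b + (ε * ε) * d) ≈ 0#))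
      linear (positive q) = eventually-map (λ ε r t z → proj₂ t (noZeroDivisors (proj₂ r) (trans (sym (factor ε)) z))) (eventually-pos d q)
      linear (negative q) = eventually-map (λ ε r t z → proj₂ t
          (trans (solve 3 (λ b d x → :- b :+ x :* :- d := :- (b :+ x :* d)) refl b d ε)
            (trans (-‿cong (noZeroDivisors (proj₂ r) (trans (sym (factor ε)) z))) -0#≈0#))) (eventually-pos (- d) q)
      linear (vanishes q) = 1# , Pos-1 , λ ε r _ z → d≉0 (noZeroDivisors (proj₂ r) (trans (sym (+-identityˡ _))
          (trans (+-congʳ (sym q)) (noZeroDivisors (proj₂ r) (trans (sym (factor ε)) z)))))

    dot : ∀ {m} → (Fin m → Carrier) → (Fin m → Carrier) → Carrier
    dot f v = Σᶠ (λ k → f k * v k)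

    dot-comb : ∀ {m} a b (f g v : Fin m → Carrier) → dot (λ k → a * f k + b * g k) v ≈ a * dot f v + b * dot g v
    dot-comb {m} a b f g v = trans (Σ-cong {m} λ k → solve 5 (λ a b f g v → (a :* f :+ b :* g) :* v := a :* (f :* v) :+ b :* (g :* v)) refl a b (f k) (g k) (v k))
      (trans (Σ-+ {m} (λ k → a * (f k * v k)) (λ k → b * (g k * v k))) (+-cong (Σ-* {m} a (λ k → f k * v k)) (Σ-* {m} b (λ k → g k * v k))))

    dot-comm : ∀ {m} (f v : Fin m → Carrier) → dot f v ≈ dot v f
    dot-comm {m} f v = Σ-cong {m} λ k → *-comm (f k) (v k)

    detect : ∀ {m} (v : Fin m → Carrier) → (∀ k → v k ≈ 0#) ⊎ ∃[ f ] Pos (dot f v)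
    detect {zero}  v = inj₁ λ ()
    detect {suc m} v with sign (v zero)
    ... | positive p = inj₂ ((λ { zero → 1# ; (suc _) → 0# }) , Pos-resp
            (sym (trans (+-cong (*-identityˡ _) (trans (Σ-cong {m} (λ k → zeroˡ (v (suc k)))) (Σ-0 m))) (+-identityʳ _))) p)
    ... | negative p = inj₂ ((λ { zero → - 1# ; (suc _) → 0# }) , Pos-resp
            (sym (trans (+-cong (trans (solve 2 (λ o x → (:- o) :* x := :- (o :* x)) refl 1# (v zero)) (-‿cong (*-identityˡ _)))
              (trans (Σ-cong {m} (λ k → zeroˡ (v (suc k)))) (Σ-0 m))) (+-identityʳ _))) p)
    ... | vanishes p with detect (v ∘ suc)
    ...   | inj₁ q       = inj₁ λ { zero → p ; (suc k) → q k }
    ...   | inj₂ (f , q) = inj₂ ((λ { zero → 0# ; (suc k) → f k }) , Pos-resp (sym (trans (+-congʳ (zeroˡ _)) (+-identityˡ _))) q)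

    -- Gordan's theorem of the alternative, by induction on the number of vectors: if f is positive on all
    -- but the new vector v, tilt it within the plane spanned by f and a solution g of the projected system.
    gordan : ∀ {m} n (vs : Fin n → Fin m → Carrier) →
      (∃[ w ] ((∀ i → NN (w i)) × Pos (Σᶠ w) × (∀ k → Σᶠ (λ i → w i * vs i k) ≈ 0#))) ⊎
      (∃[ f ] (∀ i → Pos (dot f (vs i))))
    gordan zero vs = inj₂ ((λ _ → 0#) , λ ())
    gordan {m} (suc n) vs with detect (vs zero)
    ... | inj₁ q = inj₁ ((λ { zero → 1# ; (suc _) → 0# }) , (λ { zero → NN-1 ; (suc _) → NN-0 }) ,
            Pos-resp (sym (trans (+-congˡ (Σ-0 n)) (+-identityʳ _))) Pos-1 ,
            λ k → trans (+-cong (trans (*-identityˡ _) (q k)) (trans (Σ-cong {n} (λ i → zeroˡ (vs (suc i) k))) (Σ-0 n))) (+-identityʳ _))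
    ... | inj₂ (f₀ , f₀v) with gordan n (vs ∘ suc)
    ...   | inj₁ (w , w≥0 , w>0 , e) = inj₁ ((λ { zero → 0# ; (suc i) → w i }) , (λ { zero → NN-0 ; (suc i) → w≥0 i }) ,
              Pos-resp (sym (+-identityˡ _)) w>0 , λ k → trans (+-cong (zeroˡ _) (e k)) (+-identityʳ _))
    ...   | inj₂ (f , fv) = tilt (sign (dot f v))
      where
      v = vs zero
      Result = (∃[ w ] ((∀ i → NN (w i)) × Pos (Σᶠ w) × (∀ k → Σᶠ (λ i → w i * vs i k) ≈ 0#))) ⊎ (∃[ f ] (∀ i → Pos (dot f (vs i))))
      tilt : Sign (dot f v) → Result
      tilt (positive p) = inj₂ (f , λ { zero → p ; (suc i) → fv i })
      -- Here `f` is merely zero on `v`, so a little of `f₀`, which is positive on `v`, repairs it.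
      tilt (vanishes p) = nudge (eventually-∀ (λ i → eventually-pos (dot f₀ (vs (suc i))) (fv i)))
        where
        nudge : Eventually (λ ε → ∀ i → Pos (dot f (vs (suc i)) + ε * dot f₀ (vs (suc i)))) → Result
        nudge (η , η>0 , small) = inj₂ ((λ k → 1# * f k + η * f₀ k) , λ
            { zero    → Pos-resp (sym (trans (dot-comb 1# η f f₀ v) (trans (+-congʳ (trans (*-identityˡ _) p)) (+-identityˡ _)))) (Pos-* η>0 f₀v)
            ; (suc i) → Pos-resp (sym (trans (dot-comb 1# η f f₀ (vs (suc i))) (+-congʳ (*-identityˡ _))))
                          (small η η>0 (NN-≈0 (-‿inverseʳ η)) i) })
      -- Each old vector is moved along `v` into the kernel of `f`. Since `f` is positive on it and
      -- negative on `v`, both coefficients are positive, so a nonnegative relation among the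
      -- projections lifts to one among the original vectors.
      tilt (negative a>0) with gordan n (λ i k → dot f (vs (suc i)) * v k + (- dot f v) * vs (suc i) k)
      ... | inj₁ (w , w≥0 , w>0 , e) = inj₁ (λ′ , λ′≥0 , Pos-+ head>0 (Σ-NN {n} (λ i → λ′ (suc i)) (λ i → λ′≥0 (suc i))) , vanish)
        where
        λ′ : Fin (suc n) → Carrier
        λ′ zero    = Σᶠ (λ i → w i * dot f (vs (suc i)))
        λ′ (suc i) = w i * (- dot f v)
        head>0 : Pos (λ′ zero)
        head>0 = weighted-Pos {n} w (λ i → dot f (vs (suc i))) w≥0 w>0 (λ i → inj₂ (fv i))
        λ′≥0 : ∀ i → NN (λ′ i)
        λ′≥0 zero    = proj₁ head>0
        λ′≥0 (suc i) = NN-* (w≥0 i) (proj₁ a>0)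
        vanish : ∀ k → Σᶠ (λ i → λ′ i * vs i k) ≈ 0#
        vanish k = trans (+-congʳ (trans (*-comm _ _) (sym (Σ-* {n} (v k) (λ i → w i * dot f (vs (suc i)))))))
          (trans (sym (Σ-+ {n} (λ i → v k * (w i * dot f (vs (suc i)))) (λ i → λ′ (suc i) * vs (suc i) k))) (trans (Σ-cong {n} λ i →
            solve 5 (λ v w d a x → v :* (w :* d) :+ (w :* a) :* x := w :* (d :* v :+ a :* x)) refl (v k) (w i) (dot f (vs (suc i))) (- dot f v) (vs (suc i) k)) (e k)))
      ... | inj₂ (g , gw) = nudge (eventually-∀ (λ i → eventually-pos (- dot f (vs (suc i))) (mixed i)))
        where
        mixed : ∀ i → Pos ((- dot f v) * dot g (vs (suc i)) + dot g v * dot f (vs (suc i)))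
        mixed i = Pos-resp (trans (dot-comm g _) (trans (dot-comb _ _ v (vs (suc i)) g)
          (trans (+-cong (*-congˡ (dot-comm v g)) (*-congˡ (dot-comm (vs (suc i)) g)))
            (solve 4 (λ d gv a gx → d :* gv :+ a :* gx := a :* gx :+ gv :* d) refl (dot f (vs (suc i))) (dot g v) (- dot f v) (dot g (vs (suc i))))))) (gw i)
        nudge : Eventually (λ ε → ∀ i → Pos (((- dot f v) * dot g (vs (suc i)) + dot g v * dot f (vs (suc i))) + ε * (- dot f (vs (suc i))))) → Result
        nudge (η , η>0 , small) = inj₂ (h , λ
              { zero    → Pos-resp (sym (trans (h-dot v) (solve 3 (λ d e x → :- d :* e :+ e :* d :+ x :* :- d := x :* :- d) refl (dot f v) (dot g v) η))) (Pos-* η>0 a>0)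
              ; (suc i) → Pos-resp (sym (h-dot (vs (suc i)))) (small η η>0 (NN-≈0 (-‿inverseʳ η)) i) })
          where
          h : Fin m → Carrier
          -- Without the last term this functional vanishes on `v` and is positive on the other
          -- vectors; subtracting a little of `f` makes it positive on `v` as well.
          h k = 1# * ((- dot f v) * g k + dot g v * f k) + (- η) * f k
          h-dot : ∀ x → dot h x ≈ ((- dot f v) * dot g x + dot g v * dot f x) + η * (- dot f x)
          h-dot x = trans (dot-comb 1# (- η) (λ k → (- dot f v) * g k + dot g v * f k) f x)
            (+-cong (trans (*-identityˡ _) (dot-comb _ _ g f x)) (solve 2 (λ e d → :- e :* d := e :* :- d) refl η (dot f x)))

    Σ-swap : ∀ {m n} (f : Fin m → Fin n → Carrier) → Σᶠ (λ i → Σᶠ (f i)) ≈ Σᶠ (λ j → Σᶠ (λ i → f i j))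
    Σ-swap {zero}  {n} f = sym (Σ-0 n)
    Σ-swap {suc m} {n} f = trans (+-congˡ (Σ-swap (f ∘ suc))) (sym (Σ-+ (f zero) (λ j → Σᶠ (λ i → f (suc i) j))))

    Works : (Fin 10 → Point) → (Fin 10 → Fin 4) → Set _
    Works x π = ∃[ p ] (∀ t → InConv x (λ i → π i ≡ t) p)

    orientation : Point → Point → Point → Carrier
    orientation (p₁ , p₂) (q₁ , q₂) (r₁ , r₂) = (q₁ + - p₁) * (r₂ + - p₂) + - ((q₂ + - p₂) * (r₁ + - p₁))

    General : (Fin 10 → Point) → Set _
    General x = ∀ i j k → i ≢ j → i ≢ k → j ≢ k → ¬ (orientation (x i) (x j) (x k) ≈ 0#)

    -- Homogeneous coordinates: the entry `1#` lets one linear relation control the total weight of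
    -- a part along with its weighted sum of points.
    coord : Fin 3 → Point → Carrier
    coord zero             q = 1#
    coord (suc zero)       q = proj₁ q
    coord (suc (suc zero)) q = proj₂ q

    δ : Fin 4 → Fin 4 → Carrier
    δ s t with s ≟ t
    ... | yes _ = 1#
    ... | no  _ = 0#

    last : Fin 4
    last = suc (suc (suc zero))

    -- Sarkaria's lifting: a point of part s becomes a vector of three blocks, and the four possible
    -- liftings of a point add up to zero.
    block : Fin 4 → Point → Fin 3 × Fin 3 → Carrier
    block s q (t , r) = (δ s (inject₁ t) + - δ s last) * coord r q

    lifted : Fin 4 → Point → Fin 9 → Carrier
    lifted s q k = block s q (remQuot 3 k)

    value : (Fin 9 → Carrier) → Fin 4 → Point → Carrier
    value f s q = dot f (lifted s q)

    value-sum : ∀ f q → value f zero q + (value f (suc zero) q + (value f (suc (suc zero)) q + value f last q)) ≈ 0#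
    value-sum f q = trans (+-congˡ (trans (+-congˡ (sym (Σ-+ {9} (g (suc (suc zero))) (g last)))) (sym (Σ-+ {9} (g (suc zero)) (λ k → g (suc (suc zero)) k + g last k)))))
        (trans (sym (Σ-+ {9} (g zero) (λ k → g (suc zero) k + (g (suc (suc zero)) k + g last k)))) (trans (Σ-cong {9} (λ k → cancel (f k) (remQuot 3 k))) (Σ-0 9)))
      where
      g : Fin 4 → Fin 9 → Carrier
      g t k = f k * lifted t q k
      cancel : ∀ a k → a * block zero q k + (a * block (suc zero) q k + (a * block (suc (suc zero)) q k + a * block last q k)) ≈ 0#
      cancel a (zero , r) = solve 3 (λ f c o → f :* ((o :+ :- con (+ 0)) :* c) :+ (f :* ((con (+ 0) :+ :- con (+ 0)) :* c) :+ (f :* ((con (+ 0) :+ :- con (+ 0)) :* c) :+ f :* ((con (+ 0) :+ :- o) :* c))) := con (+ 0)) refl a (coord r q) 1#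
      cancel a (suc zero , r) = solve 3 (λ f c o → f :* ((con (+ 0) :+ :- con (+ 0)) :* c) :+ (f :* ((o :+ :- con (+ 0)) :* c) :+ (f :* ((con (+ 0) :+ :- con (+ 0)) :* c) :+ f :* ((con (+ 0) :+ :- o) :* c))) := con (+ 0)) refl a (coord r q) 1#
      cancel a (suc (suc zero) , r) = solve 3 (λ f c o → f :* ((con (+ 0) :+ :- con (+ 0)) :* c) :+ (f :* ((con (+ 0) :+ :- con (+ 0)) :* c) :+ (f :* ((o :+ :- con (+ 0)) :* c) :+ f :* ((con (+ 0) :+ :- o) :* c))) := con (+ 0)) refl a (coord r q) 1#

    Separated : (Fin 10 → Point) → (Fin 10 → Fin 4) → Set _
    Separated x π = ∃[ f ] (∀ i → Pos (value f (π i) (x i)))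

    -- For a point common to all four hulls, each of its four liftings would have a positive value
    -- under `f`, as an average of positive values; but the four liftings add up to zero.
    separated⇒¬works : ∀ x π → Separated x π → ¬ Works x π
    separated⇒¬works x π (f , sep) (p , inside) = proj₂ (Pos-+ (pos zero) (NN-+ (proj₁ (pos (suc zero))) (NN-+ (proj₁ (pos (suc (suc zero)))) (proj₁ (pos last))))) (value-sum f p)
      where
      pos : ∀ t → Pos (value f t p)
      pos t with inside t
      ... | w , w≥0 , outside , w=1 , w₁ , w₂ = Pos-resp (sym average) (weighted-Pos w (λ i → value f t (x i)) w≥0 (Pos-resp (sym w=1) Pos-1) relevant)
        where
        relevant : ∀ i → w i ≈ 0# ⊎ Pos (value f t (x i))
        relevant i with π i ≟ t
        ... | yes ≡.refl = inj₂ (sep i)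
        ... | no  πi≢t   = inj₁ (outside i πi≢t)
        coords : ∀ r → coord r p ≈ Σᶠ (λ i → w i * coord r (x i))
        coords zero             = trans (sym w=1) (Σ-cong {10} λ i → sym (*-identityʳ (w i)))
        coords (suc zero)       = sym w₁
        coords (suc (suc zero)) = sym w₂
        expand : ∀ a k → a * block t p k ≈ Σᶠ (λ i → w i * (a * block t (x i) k))
        expand a (s , r) = trans (*-congˡ (*-congˡ (coords r))) (trans (sym (*-assoc _ _ _))
                (trans (sym (Σ-* {10} (a * (δ t (inject₁ s) + - δ t last)) (λ i → w i * coord r (x i)))) (Σ-cong {10} λ i →
                  solve 4 (λ f d w c → (f :* d) :* (w :* c) := w :* (f :* (d :* c))) refl a (δ t (inject₁ s) + - δ t last) (w i) (coord r (x i)))))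
        average : value f t p ≈ Σᶠ (λ i → w i * value f t (x i))
        average = trans (Σ-cong {9} (λ k → expand (f k) (remQuot 3 k))) (trans (Σ-swap {9} {10} (λ k i → w i * (f k * lifted t (x i) k))) (Σ-cong {10} λ i → Σ-* {9} (w i) (λ k → f k * lifted t (x i) k)))

    δ-NN : ∀ s t → NN (δ s t)
    δ-NN s t with s ≟ t
    ... | yes _ = NN-1
    ... | no _  = NN-0

    δ-≢ : ∀ s t → s ≢ t → δ s t ≈ 0#
    δ-≢ s t ¬p with s ≟ t
    ... | yes p = contradiction p ¬p
    ... | no _  = refl

    δ-sum : ∀ s → δ s zero + (δ s (suc zero) + (δ s (suc (suc zero)) + δ s last)) ≈ 1#
    δ-sum zero = solve 1 (λ o → o :+ (con (+ 0) :+ (con (+ 0) :+ con (+ 0))) := o) refl 1#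
    δ-sum (suc zero) = solve 1 (λ o → con (+ 0) :+ (o :+ (con (+ 0) :+ con (+ 0))) := o) refl 1#
    δ-sum (suc (suc zero)) = solve 1 (λ o → con (+ 0) :+ (con (+ 0) :+ (o :+ con (+ 0))) := o) refl 1#
    δ-sum (suc (suc (suc zero))) = solve 1 (λ o → con (+ 0) :+ (con (+ 0) :+ (con (+ 0) :+ o)) := o) refl 1#

    -- In a nonnegative relation among the lifted points each block says that one of the first three
    -- parts has the same weighted sum, in homogeneous coordinates, as the last part. So all parts
    -- have equal weight `W` and, after division by it, the same barycentre.
    works-or-separated : ∀ x π → Works x π ⊎ Separated x π
    works-or-separated x π = convert (gordan {9} 10 (λ i → lifted (π i) (x i)))
      where
      convert : (∃[ w ] ((∀ i → NN (w i)) × Pos (Σᶠ w) × (∀ k → Σᶠ (λ i → w i * lifted (π i) (x i) k) ≈ 0#))) ⊎ Separated x π → Works x π ⊎ Separated x π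
      convert (inj₂ sep) = inj₂ sep
      convert (inj₁ (w , w≥0 , w>0 , e)) = inj₁ (normalise (Pos-inverse W>0))
        where
        S : Fin 4 → Fin 3 → Carrier
        S t r = Σᶠ (λ i → (δ (π i) t * w i) * coord r (x i))
        difference : ∀ t r → Σᶠ (λ i → w i * block (π i) (x i) (t , r)) ≈ 0#
        difference t r = trans (Σ-cong {10} λ i → *-congˡ {w i} (reflexive (≡.cong (block (π i) (x i)) (≡.sym (remQuot-combine t r))))) (e (combine t r))
        same : ∀ (t : Fin 3) r → S (inject₁ t) r ≈ S last r
        same t r = trans (solve 2 (λ a b → a := (a :+ :- b) :+ b) refl (S (inject₁ t) r) (S last r)) (trans (+-congʳ (trans (sym (split t r)) (difference t r))) (+-identityˡ _))
          where
          split : ∀ t r → Σᶠ (λ i → w i * block (π i) (x i) (t , r)) ≈ S (inject₁ t) r + - S last r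
          split t r = trans (Σ-cong {10} λ i → solve 4 (λ w d d′ c → w :* ((d :+ :- d′) :* c) := (d :* w) :* c :+ :- ((d′ :* w) :* c)) refl (w i) (δ (π i) (inject₁ t)) (δ (π i) last) (coord r (x i)))
            (trans (Σ-+ {10} (λ i → (δ (π i) (inject₁ t) * w i) * coord r (x i)) (λ i → - ((δ (π i) last * w i) * coord r (x i))))
              (+-congˡ (Σ-neg {10} (λ i → (δ (π i) last * w i) * coord r (x i)))))
        all-same : ∀ t r → S t r ≈ S last r
        all-same zero                   r = same zero r
        all-same (suc zero)             r = same (suc zero) r
        all-same (suc (suc zero))       r = same (suc (suc zero)) r
        all-same (suc (suc (suc zero))) r = refl
        W = S last zero
        total-weight : Σᶠ w ≈ W + (W + (W + W))
        total-weight = trans (Σ-cong {10} λ i → trans (sym (*-identityˡ _)) (trans (*-congʳ (sym (δ-sum (π i))))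
            (trans (solve 5 (λ a b c d w → (a :+ (b :+ (c :+ d))) :* w := a :* w :+ (b :* w :+ (c :* w :+ d :* w))) refl (δ (π i) zero) (δ (π i) (suc zero)) (δ (π i) (suc (suc zero))) (δ (π i) last) (w i))
              (+-cong (one zero i) (+-cong (one (suc zero) i) (+-cong (one (suc (suc zero)) i) (one last i)))))))
          (trans (Σ-+ {10} (term zero) (λ i → term (suc zero) i + (term (suc (suc zero)) i + term last i))) (+-cong (all-same zero zero) (trans (Σ-+ {10} (term (suc zero)) (λ i → term (suc (suc zero)) i + term last i)) (+-cong (all-same (suc zero) zero)
            (trans (Σ-+ {10} (term (suc (suc zero))) (term last)) (+-congʳ (all-same (suc (suc zero)) zero)))))))
          where
          term : Fin 4 → Fin 10 → Carrier
          term t i = (δ (π i) t * w i) * 1#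
          one : ∀ t i → δ (π i) t * w i ≈ term t i
          one t i = sym (*-identityʳ _)
        -- The total weight is four times `W`, so a vanishing `W` would make the whole relation
        -- trivial.
        W>0 : Pos W
        W>0 = Σ-NN {10} (λ i → (δ (π i) last * w i) * 1#) (λ i → NN-* (NN-* (δ-NN (π i) last) (w≥0 i)) NN-1) , λ W≈0 → proj₂ w>0
          (trans total-weight (trans (+-cong W≈0 (+-cong W≈0 (+-cong W≈0 W≈0))) (trans (+-identityˡ _) (trans (+-identityˡ _) (+-identityˡ _)))))
        normalise : ∃[ z ] (Pos z × (W * z ≈ 1#)) → Works x π
        normalise (z , z>0 , Wz) = (z * S last (suc zero) , z * S last (suc (suc zero))) , inside
          where
          inside : ∀ t → InConv x (λ i → π i ≡ t) (z * S last (suc zero) , z * S last (suc (suc zero)))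
          inside t = (λ i → z * (δ (π i) t * w i)) ,
            (λ i → NN-* (proj₁ z>0) (NN-* (δ-NN (π i) t) (w≥0 i))) ,
            (λ i ¬p → trans (*-congˡ (trans (*-congʳ (δ-≢ (π i) t ¬p)) (zeroˡ _))) (zeroʳ _)) ,
            trans (Σ-cong {10} λ i → *-congˡ {z} (sym (*-identityʳ (δ (π i) t * w i)))) (trans (scaled zero) (trans (*-comm _ _) Wz)) ,
            trans (Σ-cong {10} λ i → *-assoc z (δ (π i) t * w i) (proj₁ (x i))) (scaled (suc zero)) ,
            trans (Σ-cong {10} λ i → *-assoc z (δ (π i) t * w i) (proj₂ (x i))) (scaled (suc (suc zero)))
            where
            scaled : ∀ r → Σᶠ (λ i → z * ((δ (π i) t * w i) * coord r (x i))) ≈ z * S last r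
            scaled r = trans (Σ-* {10} z (λ i → (δ (π i) t * w i) * coord r (x i))) (*-congˡ (all-same t r))

-- Perturbation into general position.

module GeneralPosition where
  open OrderedField
  open Separation
  open import Data.Nat.Base as ℕ using (ℕ; zero; suc)
  open import Data.Fin.Base as Fin using (Fin; zero; suc; toℕ; remQuot; inject₁)
  open import Data.Fin.Properties using (_≟_; toℕ-injective)
  import Data.Nat.Properties as ℕ
  open import Data.Vec.Properties using (lookup∘tabulate)
  open import Data.Integer.Base using (+_)
  open import Data.Vec.Base using (Vec; []; _∷_; lookup; tabulate)
  open import Data.Product.Base using (_×_; _,_; proj₁; proj₂; ∃-syntax)
  open import Data.Sum.Base using (_⊎_; inj₁; inj₂)
  open import Data.Empty using (⊥; ⊥-elim)
  open import Function.Base using (_∘_)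
  open import Relation.Nullary using (¬_; Dec; yes; no; contradiction)
  open import Relation.Binary.PropositionalEquality as ≡ using (_≡_; _≢_)
  open import Relation.Binary.Definitions using (tri<; tri≈; tri>)

  module Approximation {c ℓ ℓ₂} (ℝ : RealField c ℓ ℓ₂) where
    open Sums ℝ

    parameter : ℕ → Carrier
    parameter zero    = 0#
    parameter (suc n) = 1# + parameter n

    parameter-NN : ∀ n → NN (parameter n)
    parameter-NN zero    = NN-0
    parameter-NN (suc n) = NN-+ NN-1 (parameter-NN n)

    parameter-< : ∀ {m n} → m ℕ.< n → Pos (parameter n + - parameter m)
    parameter-< {zero}  {suc n} (ℕ.s≤s _) = Pos-resp (solve 1 (λ a → a := a :+ :- con (+ 0)) refl _) (Pos-+ Pos-1 (parameter-NN n))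
    parameter-< {suc m} {suc n} (ℕ.s≤s p) = Pos-resp (solve 3 (λ o a b → a :+ :- b := (o :+ a) :+ :- (o :+ b)) refl 1# (parameter n) (parameter m)) (parameter-< p)

    parameter-≢ : ∀ {n} (i j : Fin n) → i ≢ j → ¬ (parameter (toℕ j) + - parameter (toℕ i) ≈ 0#)
    parameter-≢ i j i≢j e with ℕ.<-cmp (toℕ i) (toℕ j)
    ... | tri< p _ _ = proj₂ (parameter-< p) e
    ... | tri≈ _ p _ = i≢j (toℕ-injective p)
    ... | tri> _ _ p = proj₂ (parameter-< p) (trans (solve 2 (λ a b → a :+ :- b := :- (b :+ :- a)) refl (parameter (toℕ i)) (parameter (toℕ j)))
                         (trans (-‿cong e) -0#≈0#))

    -- The direction of perturbation: distinct points of a parabola, no three of which lie on a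
    -- line.
    moment : Fin 10 → Point
    moment i = parameter (toℕ i) , parameter (toℕ i) * parameter (toℕ i)

    shifted : (Fin 10 → Point) → Carrier → Fin 10 → Point
    shifted x ε i = proj₁ (x i) + ε * proj₁ (moment i) , proj₂ (x i) + ε * proj₂ (moment i)

    -- The coefficient of ε² is a Vandermonde determinant, hence nonzero.
    eventually-general : ∀ x → Eventually (λ ε → General (shifted x ε))
    eventually-general x = eventually-∀ λ i → eventually-∀ λ j → eventually-∀ λ k → one i j k
      where
      one : ∀ i j k → Eventually (λ ε → i ≢ j → i ≢ k → j ≢ k → ¬ (orientation (shifted x ε i) (shifted x ε j) (shifted x ε k) ≈ 0#))
      one i j k with i ≟ j | i ≟ k | j ≟ k
      ... | yes p | _ | _ = eventually-always λ ε q → contradiction p q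
      ... | no _ | yes p | _ = eventually-always λ ε _ q → contradiction p q
      ... | no _ | no _ | yes p = eventually-always λ ε _ _ q → contradiction p q
      ... | no i≢j | no i≢k | no j≢k = eventually-map
              (λ ε _ ¬z _ _ _ z → ¬z (trans (sym (expand (proj₁ (x i)) (proj₂ (x i)) (proj₁ (x j)) (proj₂ (x j)) (proj₁ (x k)) (proj₂ (x k)) (parameter (toℕ i)) (parameter (toℕ j)) (parameter (toℕ k)) ε)) z))
              (eventually-≉0 _ _ _ λ z → parameter-≢ j k j≢k (noZeroDivisors (parameter-≢ i k i≢k) (noZeroDivisors (parameter-≢ i j i≢j) z)))
        where
        expand : ∀ p₁ p₂ q₁ q₂ r₁ r₂ a b d ε →
          orientation (p₁ + ε * a , p₂ + ε * (a * a)) (q₁ + ε * b , q₂ + ε * (b * b)) (r₁ + ε * d , r₂ + ε * (d * d)) ≈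
          orientation (p₁ , p₂) (q₁ , q₂) (r₁ , r₂) +
          (ε * (((q₁ + - p₁) * (d * d + - (a * a)) + (b + - a) * (r₂ + - p₂)) + - ((q₂ + - p₂) * (d + - a) + (b * b + - (a * a)) * (r₁ + - p₁)))
           + (ε * ε) * ((b + - a) * ((d + - a) * (d + - b))))
        expand = solve 10 (λ p₁ p₂ q₁ q₂ r₁ r₂ a b d e →
          ((q₁ :+ e :* b) :+ :- (p₁ :+ e :* a)) :* ((r₂ :+ e :* (d :* d)) :+ :- (p₂ :+ e :* (a :* a))) :+ :- (((q₂ :+ e :* (b :* b)) :+ :- (p₂ :+ e :* (a :* a))) :* ((r₁ :+ e :* d) :+ :- (p₁ :+ e :* a)))
          := ((q₁ :+ :- p₁) :* (r₂ :+ :- p₂) :+ :- ((q₂ :+ :- p₂) :* (r₁ :+ :- p₁))) :+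
          (e :* (((q₁ :+ :- p₁) :* (d :* d :+ :- (a :* a)) :+ (b :+ :- a) :* (r₂ :+ :- p₂)) :+ :- ((q₂ :+ :- p₂) :* (d :+ :- a) :+ (b :* b :+ :- (a :* a)) :* (r₁ :+ :- p₁)))
           :+ (e :* e) :* ((b :+ :- a) :* ((d :+ :- a) :* (d :+ :- b))))) refl

    Spread : (Fin 10 → Point) → Set _
    Spread y = ∀ i j → i ≢ j → ¬ (proj₁ (y i) + - proj₁ (y j) ≈ 0#)

    eventually-spread : ∀ x → Eventually (λ ε → Spread (shifted x ε))
    eventually-spread x = eventually-∀ λ i → eventually-∀ λ j → one i j
      where
      one : ∀ i j → Eventually (λ ε → i ≢ j → ¬ (proj₁ (shifted x ε i) + - proj₁ (shifted x ε j) ≈ 0#))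
      one i j with j ≟ i
      ... | yes p = eventually-always λ ε q → contradiction (≡.sym p) q
      ... | no j≢i = eventually-map (λ ε _ ¬z _ z → ¬z (trans (sym (expand (proj₁ (x i)) (proj₁ (x j)) (parameter (toℕ i)) (parameter (toℕ j)) ε)) (trans (*-congˡ z) (zeroʳ ε))))
                       (eventually-≉0 0# _ _ (parameter-≢ j i j≢i))
        where
        -- The additional factor `ε` turns the linear expression into a quadratic one whose `ε²`
        -- coefficient is nonzero, the form in which `eventually-≉0` applies.
        expand : ∀ p q a b ε → ε * ((p + ε * a) + - (q + ε * b)) ≈ 0# + (ε * (p + - q) + (ε * ε) * (a + - b))
        expand = solve 5 (λ p q a b e → e :* ((p :+ e :* a) :+ :- (q :+ e :* b)) := con (+ 0) :+ (e :* (p :+ :- q) :+ (e :* e) :* (a :+ :- b))) refl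

    -- The functional is kept: its ten values are affine in `ε` and positive at `ε = 0`.
    eventually-separated : ∀ x π → Separated x π → Eventually (λ ε → Separated (shifted x ε) π)
    eventually-separated x π (f , sep) = eventually-map (λ ε _ q → f , q)
      (eventually-∀ λ i → eventually-map (λ ε _ q → Pos-resp (sym (shift i ε)) q) (eventually-pos (dot f (λ k → slope (π i) i (remQuot 3 k))) (sep i)))
      where
      velocity : Fin 3 → Fin 10 → Carrier
      velocity zero             i = 0#
      velocity (suc zero)       i = proj₁ (moment i)
      velocity (suc (suc zero)) i = proj₂ (moment i)
      slope : Fin 4 → Fin 10 → Fin 3 × Fin 3 → Carrier
      slope s i (t , r) = (δ s (inject₁ t) + - δ s last) * velocity r i
      moved : ∀ r i ε → coord r (shifted x ε i) ≈ coord r (x i) + ε * velocity r i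
      moved zero             i ε = sym (trans (+-congˡ (zeroʳ ε)) (+-identityʳ _))
      moved (suc zero)       i ε = refl
      moved (suc (suc zero)) i ε = refl
      pointwise : ∀ a s i ε k → a * block s (shifted x ε i) k ≈ 1# * (a * block s (x i) k) + ε * (a * slope s i k)
      pointwise a s i ε (t , r) = trans (*-congˡ (*-congˡ (moved r i ε)))
        (trans (solve 5 (λ a d c e v → a :* (d :* (c :+ e :* v)) := a :* (d :* c) :+ e :* (a :* (d :* v))) refl a (δ s (inject₁ t) + - δ s last) (coord r (x i)) ε (velocity r i))
          (+-congʳ (sym (*-identityˡ _))))
      shift : ∀ i ε → value f (π i) (shifted x ε i) ≈ value f (π i) (x i) + ε * dot f (λ k → slope (π i) i (remQuot 3 k))
      shift i ε = trans (Σ-cong {9} λ k → pointwise (f k) (π i) i ε (remQuot 3 k))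
        (trans (Σ-+ {9} (λ k → 1# * (f k * lifted (π i) (x i) k)) (λ k → ε * (f k * slope (π i) i (remQuot 3 k))))
          (+-cong (trans (Σ-* {9} 1# (λ k → f k * lifted (π i) (x i) k)) (*-identityˡ _)) (Σ-* {9} ε (λ k → f k * slope (π i) i (remQuot 3 k)))))

    eventually-vec : ∀ {m n a} {P : Vec (Fin m) n → Carrier → Set a} → (∀ v → Eventually (P v)) → Eventually (λ ε → ∀ v → P v ε)
    eventually-vec {n = zero}  {P = P} f = eventually-map (λ { ε _ p [] → p }) (f [])
    eventually-vec {n = suc n} {P = P} f = eventually-map (λ { ε _ p (i ∷ v) → p i v }) (eventually-∀ λ i → eventually-vec λ v → f (i ∷ v))

    choose : ∀ {n a b} {A : Fin n → Set a} {B : Fin n → Set b} → (∀ i → A i ⊎ B i) → (∃[ i ] A i) ⊎ (∀ i → B i)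
    choose {zero}  f = inj₂ λ ()
    choose {suc n} f with f zero | choose (f ∘ suc)
    ... | inj₁ a | _            = inj₁ (zero , a)
    ... | inj₂ _ | inj₁ (i , a) = inj₁ (suc i , a)
    ... | inj₂ b | inj₂ g       = inj₂ λ { zero → b ; (suc i) → g i }

    choose-vec : ∀ {m n a b} {A : Vec (Fin m) n → Set a} {B : Vec (Fin m) n → Set b} → (∀ v → A v ⊎ B v) → (∃[ v ] A v) ⊎ (∀ v → B v)
    choose-vec {n = zero} f with f []
    ... | inj₁ a = inj₁ ([] , a)
    ... | inj₂ b = inj₂ λ { [] → b }
    choose-vec {n = suc n} {A = A} {B} f with choose {A = λ i → ∃[ v ] A (i ∷ v)} {B = λ i → ∀ v → B (i ∷ v)} (λ i → choose-vec λ v → f (i ∷ v))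
    ... | inj₁ (i , v , a) = inj₁ (i ∷ v , a)
    ... | inj₂ g = inj₂ λ { (i ∷ v) → g i v }

    -- If every admissible partition failed at `x`, each would have a separating functional, and
    -- these finitely many would survive one common small shift into general position, where
    -- `general` provides a partition that works. Partitions are run through as vectors; `R-ext`
    -- carries `R` over from functions to their tabulations.
    from-general : ∀ {a} (R : (Fin 10 → Fin 4) → Set a) → (∀ π → Dec (R π)) → (∀ {π ρ} → (∀ i → ρ i ≡ π i) → R π → R ρ) →
                   (∀ y → General y → Spread y → ∃[ π ] (R π × Works y π)) → ∀ x → ∃[ π ] (R π × Works x π)
    from-general {a} R R? R-ext general x = conclude (choose-vec attempt)
      where
      attempt : ∀ (v : Vec (Fin 4) 10) → (R (lookup v) × Works x (lookup v)) ⊎ (R (lookup v) → Separated x (lookup v))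
      attempt v = decide (R? (lookup v)) (works-or-separated x (lookup v))
        where
        decide : Dec (R (lookup v)) → Works x (lookup v) ⊎ Separated x (lookup v) → (R (lookup v) × Works x (lookup v)) ⊎ (R (lookup v) → Separated x (lookup v))
        decide (no ¬r) _        = inj₂ λ r → contradiction r ¬r
        decide (yes r) (inj₁ w) = inj₁ (r , w)
        decide (yes r) (inj₂ s) = inj₂ λ _ → s

      module _ (sep : ∀ v → R (lookup v) → Separated x (lookup v)) where
        far : ∀ (v : Vec (Fin 4) 10) → Eventually (λ ε → R (lookup v) → Separated (shifted x ε) (lookup v))
        far v = decide (R? (lookup v))
          where
          decide : Dec (R (lookup v)) → Eventually (λ ε → R (lookup v) → Separated (shifted x ε) (lookup v))
          decide (no ¬r) = eventually-always λ ε r → contradiction r ¬r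
          decide (yes r) = eventually-map (λ ε _ s _ → s) (eventually-separated x (lookup v) (sep v r))

        absurd : ∀ ε → (∀ v → R (lookup v) → Separated (shifted x ε) (lookup v)) → ¬ (∃[ π ] (R π × Works (shifted x ε) π))
        absurd ε bad (π , r , p , inside) = separated⇒¬works (shifted x ε) (lookup v) (bad v (R-ext (lookup∘tabulate π) r))
            (p , λ t → let w , w≥0 , outside , rest = inside t in
              w , w≥0 , (λ i ¬q → outside i λ q → ¬q (≡.trans (lookup∘tabulate π i) q)) , rest)
          where
          v : Vec (Fin 4) 10
          v = tabulate π

        refute : Eventually (λ ε → (General (shifted x ε) × Spread (shifted x ε)) × (∀ v → R (lookup v) → Separated (shifted x ε) (lookup v))) → ⊥
        refute (ε , ε>0 , small) = clash (small ε ε>0 (NN-≈0 (-‿inverseʳ ε)))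
          where
          clash : (General (shifted x ε) × Spread (shifted x ε)) × (∀ v → R (lookup v) → Separated (shifted x ε) (lookup v)) → ⊥
          clash ((gen , spread) , bad) = absurd ε bad (general (shifted x ε) gen spread)

      conclude : (∃[ v ] (R (lookup v) × Works x (lookup v))) ⊎ (∀ v → R (lookup v) → Separated x (lookup v)) → ∃[ π ] (R π × Works x π)
      conclude (inj₁ (v , r , w)) = lookup v , r , w
      conclude (inj₂ sep) = ⊥-elim (refute sep (eventually-× (eventually-× (eventually-general x) (eventually-spread x)) (eventually-vec (far sep))))

-- The game on words and its exhaustive search.

module Search where
  open import Data.Nat.Base using (ℕ; zero; suc; _+_; _≡ᵇ_; _<ᵇ_)
  open import Data.Bool.Base using (Bool; true; false; _∧_; _∨_; not; if_then_else_)
  open import Data.List.Base using (List; []; _∷_; _++_; map; _∷ʳ_; reverse; _ʳ++_)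
  open import Data.Product.Base using (_×_; _,_)

  data Item (A : Set) : Set where
    u l : A → Item A

  Word : Set → Set
  Word A = List (Item A)

  flipᵢ : ∀ {A} → Item A → Item A
  flipᵢ (u x) = l x
  flipᵢ (l x) = u x

  flip : ∀ {A} → Word A → Word A
  flip = map flipᵢ

  -- The moment at which the rays of an upper `c` and a lower `d` coincide; `pre` and `post` are the
  -- remaining letters on either side of them.
  data Event (A : Set) : Set where
    event : (pre : Word A) (c d : A) (post : Word A) → Event A

  member : ℕ → List ℕ → Bool
  member x []       = false
  member x (y ∷ ys) = (x ≡ᵇ y) ∨ member x ys

  -- Letters of equal colour in one run are interchangeable for the search, so each value is drawn
  -- only once; `seen` collects the entries already passed.
  picks : List ℕ → List ℕ → List (ℕ × List ℕ)
  picks seen []       = []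
  picks seen (x ∷ xs) =
    if member x seen then picks (x ∷ seen) xs else (x , seen ++ xs) ∷ picks (x ∷ seen) xs

  emit₁ : Word ℕ → ℕ → List ℕ → Word ℕ → List (ℕ × List ℕ) → List (Event ℕ) → List (Event ℕ)
  emit₁ pre c us w []              es = es
  emit₁ pre c us w ((d , ls) ∷ ps) es = event (pre ++ map u us) c d (map l ls ++ w) ∷ emit₁ pre c us w ps es

  emit : Word ℕ → List (ℕ × List ℕ) → List (ℕ × List ℕ) → Word ℕ → List (Event ℕ) → List (Event ℕ)
  emit pre []              qs w es = es
  emit pre ((c , us) ∷ ps) qs w es = emit₁ pre c us w qs (emit pre ps qs w es)

  -- The order within a run is unknown, so any letter of a `u`-run may meet any letter of the
  -- `l`-run right after it. `us` and `ls` collect the current two runs. An `l`-run followed by a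
  -- `u`-run gives nothing, because those rays turn away from each other.
  events′ : Word ℕ → List ℕ → List ℕ → Word ℕ → List (Event ℕ)
  events′ pre us ls           []        = emit pre (picks [] us) (picks [] ls) [] []
  events′ pre us ls           (l y ∷ w) = events′ pre us (ls ∷ʳ y) w
  events′ pre us []           (u x ∷ w) = events′ pre (us ∷ʳ x) [] w
  events′ pre us ls@(_ ∷ _)   (u x ∷ w) =
    emit pre (picks [] us) (picks [] ls) (u x ∷ w) (events′ (pre ++ map u us ++ map l ls) (x ∷ []) [] w)

  events : Word ℕ → List (Event ℕ)
  events = events′ [] [] []

  spanU : ∀ {A} → Word A → List A
  spanU (u x ∷ w) = x ∷ spanU w
  spanU _         = []

  dropU : ∀ {A} → Word A → Word A
  dropU (u x ∷ w) = dropU w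
  dropU w         = w

  spanL : ∀ {A} → Word A → List A
  spanL (l x ∷ w) = x ∷ spanL w
  spanL _         = []

  dropL : ∀ {A} → Word A → Word A
  dropL (l x ∷ w) = dropL w
  dropL w         = w

  -- A word lists the points seen from p by their angle modulo π, u above and l below the segment from b to f.
  -- path n m: p slides from its place on that segment towards f; the opponent picks the order of the crossings,
  -- n bounds the number of changes of segment and m the number of crossings passed on one segment.
  module Game (prune : ℕ → ℕ → ℕ → Word ℕ → Bool)
              (goalV : ℕ → ℕ → Word ℕ → ℕ → ℕ → Word ℕ → Bool)
              (goalX : ℕ → Word ℕ → Bool) where
    mutual
      path : ℕ → ℕ → ℕ → ℕ → Word ℕ → Bool
      path n m f b w = prune n f b w ∧ (allEvents n m f b (events w) ∧ stop n f b w)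

      allEvents : ℕ → ℕ → ℕ → ℕ → List (Event ℕ) → Bool
      allEvents n m f b [] = true
      allEvents n m f b (event pre c d post ∷ es) =
        (goalV f b pre c d post ∨ continue n m f b pre c d post) ∧ allEvents n m f b es

      -- The smaller budget is tried first, so that a change of segment is spent only when a cheaper
      -- play does not win.
      continue : ℕ → ℕ → ℕ → ℕ → Word ℕ → ℕ → ℕ → Word ℕ → Bool
      continue n zero f b pre c d post = false
      continue zero (suc m) f b pre c d post = path zero m f b (pre ++ l d ∷ u c ∷ post)
      continue (suc n) (suc m) f b pre c d post =
        continue n (suc m) f b pre c d post ∨ (explore n f b pre c d post ∨ path (suc n) m f b (pre ++ l d ∷ u c ∷ post))

      -- The other segment may be followed towards either end; the two words arise by one and by
      -- three quarter turns about `p`.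
      explore : ℕ → ℕ → ℕ → Word ℕ → ℕ → ℕ → Word ℕ → Bool
      explore n f b pre c d post =
        -- Eight letters contain at most `4 * 4` pairs of a `u` before an `l`, and every crossing
        -- destroys one of them, so sixteen crossings suffice for any slide.
        path n 16 c d (post ++ l f ∷ u b ∷ flip pre) ∨ path n 16 d c (flip post ++ l b ∷ u f ∷ pre)

      stop : ℕ → ℕ → ℕ → Word ℕ → Bool
      stop zero    f b w = goalX f (l b ∷ w)
      stop (suc n) f b w = goalX f (l b ∷ w) ∨ exploreX n 10 f (l b ∷ w)

      -- At a point the reference line is turned run by run, and letters passed go to the end with
      -- the other sign. Every turn passes at least one of nine letters, so the ten turns granted by
      -- `stop` exceed half a revolution.
      exploreX : ℕ → ℕ → ℕ → Word ℕ → Bool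
      exploreX n zero q s = false
      exploreX n (suc k) q s@(l _ ∷ _) = exploreX n k q (dropL s ++ map u (spanL s))
      exploreX n (suc k) q s@(u _ ∷ _) =
        fromFirst n q (picks [] (spanU s)) (dropU s) ∨ exploreX n k q (dropU s ++ map l (spanU s))
      exploreX n (suc k) q [] = false

      -- Which point of the leading run comes first is not known, so the slide has to win for every
      -- candidate.
      fromFirst : ℕ → ℕ → List (ℕ × List ℕ) → Word ℕ → Bool
      fromFirst n q []              w = true
      fromFirst n q ((x , us) ∷ ps) w = path n 16 x q (map u us ++ w) ∧ fromFirst n q ps w

    fromVertex : ℕ → ℕ → ℕ → Word ℕ → ℕ → ℕ → Word ℕ → Bool
    fromVertex n f b pre c d post =
      (path n 16 f b (pre ++ l d ∷ u c ∷ post) ∨ path n 16 b f (flip pre ++ l c ∷ u d ∷ flip post)) ∨ explore n f b pre c d post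

  mutual
    -- At the goals the triples have to exhaust the word, so the first remaining letter always opens
    -- the next triple. `skipped` holds, in reverse, the letters passed over.
    triples : ℕ → Word ℕ → Bool
    triples zero    _         = true
    triples (suc k) []        = false
    triples (suc k) (u a ∷ w) = secondU k a [] w
    triples (suc k) (l a ∷ w) = secondL k a [] w

    secondU : ℕ → ℕ → Word ℕ → Word ℕ → Bool
    secondU k a skipped []        = false
    secondU k a skipped (u b ∷ w) = secondU k a (u b ∷ skipped) w
    secondU k a skipped (l b ∷ w) =
      (if a ≡ᵇ b then false else thirdU k a b skipped w) ∨ secondU k a (l b ∷ skipped) w

    secondL : ℕ → ℕ → Word ℕ → Word ℕ → Bool
    secondL k a skipped []        = false
    secondL k a skipped (l b ∷ w) = secondL k a (l b ∷ skipped) w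
    secondL k a skipped (u b ∷ w) =
      (if a ≡ᵇ b then false else thirdL k a b skipped w) ∨ secondL k a (u b ∷ skipped) w

    thirdU : ℕ → ℕ → ℕ → Word ℕ → Word ℕ → Bool
    thirdU k a b skipped []        = false
    thirdU k a b skipped (l c ∷ w) = thirdU k a b (l c ∷ skipped) w
    thirdU k a b skipped (u c ∷ w) =
      (if (a ≡ᵇ c) ∨ (b ≡ᵇ c) then false else triples k (skipped ʳ++ w)) ∨ thirdU k a b (u c ∷ skipped) w

    thirdL : ℕ → ℕ → ℕ → Word ℕ → Word ℕ → Bool
    thirdL k a b skipped []        = false
    thirdL k a b skipped (u c ∷ w) = thirdL k a b (u c ∷ skipped) w
    thirdL k a b skipped (l c ∷ w) =
      (if (a ≡ᵇ c) ∨ (b ≡ᵇ c) then false else triples k (skipped ʳ++ w)) ∨ thirdL k a b (l c ∷ skipped) w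

  -- At a crossing the parts are two segments and two triangles: `2 + 2 + 3 + 3 = 10`.
  colV : ℕ → ℕ → Word ℕ → ℕ → ℕ → Word ℕ → Bool
  colV f b pre c d post = not (f ≡ᵇ b) ∧ (not (c ≡ᵇ d) ∧ triples 2 (pre ++ post))

  -- At a point the parts are the point itself and three triangles: `1 + 3 + 3 + 3 = 10`.
  colX : ℕ → Word ℕ → Bool
  colX q s = triples 3 s

  -- Only a cut-off for the search: a line turning about p must keep at least three of the eight points on each side.
  balanced : ℕ → Word ℕ → Bool
  balanced 3 []        = true
  balanced 4 []        = true
  balanced 5 []        = true
  balanced 3 (l _ ∷ w) = balanced 4 w
  balanced 4 (l _ ∷ w) = balanced 5 w
  balanced 4 (u _ ∷ w) = balanced 3 w
  balanced 5 (u _ ∷ w) = balanced 4 w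
  balanced _ _         = false

  uppers : Word ℕ → ℕ
  uppers []        = 0
  uppers (u _ ∷ w) = suc (uppers w)
  uppers (l _ ∷ w) = uppers w

  -- It only makes `path` fail earlier, so soundness is not affected. With no change of segment
  -- left, a segment with ends of one colour rules out every goal at a crossing on it, leaving only
  -- the arrival at `f`.
  colPrune : ℕ → ℕ → ℕ → Word ℕ → Bool
  colPrune zero    f b w = not (f ≡ᵇ b) ∧ balanced (uppers w) w
  colPrune (suc n) f b w = balanced (uppers w) w

  module Col = Game colPrune colV colX

  deepenV : ℕ → ℕ → ℕ → ℕ → Word ℕ → ℕ → ℕ → Word ℕ → Bool
  deepenV zero    n f b pre c d post = false
  deepenV (suc k) n f b pre c d post = Col.fromVertex n f b pre c d post ∨ deepenV k (suc n) f b pre c d post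

  winV : ℕ → ℕ → Word ℕ → ℕ → ℕ → Word ℕ → Bool
  winV f b pre c d post = colV f b pre c d post ∨ deepenV 6 0 f b pre c d post

  -- One letter is passed per turn. The eighteen turns granted by `deepenX` are a full revolution
  -- past nine points, in which every point is in front as an upper letter exactly once.
  rootX : ℕ → ℕ → ℕ → Word ℕ → Bool
  rootX n zero    q s         = false
  rootX n (suc k) q (u x ∷ w) = Col.path n 16 x q w ∨ rootX n k q (w ∷ʳ l x)
  rootX n (suc k) q (l x ∷ w) = rootX n k q (w ∷ʳ u x)
  rootX n (suc k) q []        = false

  deepenX : ℕ → ℕ → ℕ → Word ℕ → Bool
  deepenX zero    n q s = false
  deepenX (suc k) n q s = rootX n 18 q s ∨ deepenX k (suc n) q s

  winX : ℕ → Word ℕ → Bool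
  winX q s = colX q s ∨ deepenX 6 0 q s

  -- The eight root words, three at a crossing and five at a point. One list of colours is tested
  -- against all eight, since it is not known which of them a configuration reaches.
  win₁ win₂ win₃ win₄ win₅ win₆ win₇ win₈ allWin : List ℕ → Bool
  win₁ (a ∷ b ∷ c ∷ d ∷ e ∷ f ∷ g ∷ h ∷ i ∷ j ∷ []) = winV a b (u e ∷ l f ∷ l g ∷ u h ∷ u i ∷ l j ∷ []) c d []
  win₁ _ = false
  win₂ (a ∷ b ∷ c ∷ d ∷ e ∷ f ∷ g ∷ h ∷ i ∷ j ∷ []) = winV a b (u e ∷ l f ∷ l g ∷ u h ∷ []) c d (u i ∷ l j ∷ [])
  win₂ _ = false
  win₃ (a ∷ b ∷ c ∷ d ∷ e ∷ f ∷ g ∷ h ∷ i ∷ j ∷ []) = winV a b (u e ∷ l f ∷ l g ∷ u h ∷ []) c d (l i ∷ u j ∷ [])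
  win₃ _ = false
  win₄ (a ∷ b ∷ c ∷ d ∷ e ∷ f ∷ g ∷ h ∷ i ∷ j ∷ []) = winX a (u b ∷ u c ∷ u d ∷ l e ∷ l f ∷ u g ∷ l h ∷ u i ∷ u j ∷ [])
  win₄ _ = false
  win₅ (a ∷ b ∷ c ∷ d ∷ e ∷ f ∷ g ∷ h ∷ i ∷ j ∷ []) = winX a (u b ∷ l c ∷ u d ∷ l e ∷ u f ∷ l g ∷ u h ∷ l i ∷ u j ∷ [])
  win₅ _ = false
  win₆ (a ∷ b ∷ c ∷ d ∷ e ∷ f ∷ g ∷ h ∷ i ∷ j ∷ []) = winX a (u b ∷ u c ∷ l d ∷ u e ∷ u f ∷ l g ∷ l h ∷ u i ∷ u j ∷ [])
  win₆ _ = false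
  win₇ (a ∷ b ∷ c ∷ d ∷ e ∷ f ∷ g ∷ h ∷ i ∷ j ∷ []) = winX a (u b ∷ u c ∷ u d ∷ l e ∷ l f ∷ l g ∷ u h ∷ u i ∷ u j ∷ [])
  win₇ _ = false
  win₈ (a ∷ b ∷ c ∷ d ∷ e ∷ f ∷ g ∷ h ∷ i ∷ j ∷ []) = winX a (u b ∷ u c ∷ l d ∷ u e ∷ l f ∷ u g ∷ l h ∷ u i ∷ u j ∷ [])
  win₈ _ = false
  allWin w = win₁ w ∧ (win₂ w ∧ (win₃ w ∧ (win₄ w ∧ (win₅ w ∧ (win₆ w ∧ (win₇ w ∧ win₈ w))))))

  count : ℕ → List ℕ → ℕ
  count x [] = 0
  count x (y ∷ ys) = if x ≡ᵇ y then suc (count x ys) else count x ys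

  -- A colouring with two classes of total size at most 3 is skipped: it can be coarsened.
  exceptional : List ℕ → ℕ → ℕ → List ℕ → Bool
  exceptional w a n []       = false
  exceptional w a n (b ∷ bs) = (not (a ≡ᵇ b) ∧ (n + count b w <ᵇ 4)) ∨ exceptional w a n bs

  loose : List ℕ → List ℕ → Bool
  loose w []       = false
  loose w (a ∷ as) = (if 2 <ᵇ count a w then false else exceptional w a (count a w) w) ∨ loose w as

  mutual
    -- Restricted growth strings, kept in reverse, list every set partition once: the next position
    -- takes an earlier colour or the first new one, `m`. Once the loose ones are skipped, only
    -- class sizes `3+3+3+1`, `3+3+2+2` and `2+2+2+2+2` remain.
    enumerate : ℕ → ℕ → List ℕ → Bool
    enumerate zero    m acc = loose acc acc ∨ allWin (reverse acc)
    enumerate (suc k) m acc = enumerate k (suc m) (m ∷ acc) ∧ reuse k m m acc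

    reuse : ℕ → ℕ → ℕ → List ℕ → Bool
    reuse k zero    m acc = true
    reuse k (suc j) m acc = (if count j acc <ᵇ 3 then enumerate k m (j ∷ acc) else true) ∧ reuse k j m acc

-- Cross products, angular order and earliest events.

module Plane where
  open OrderedField
  open Separation
  open Search
  open import Data.Integer.Base using (+_)
  open import Data.List.Base using (List; []; _∷_; _++_; map)
  open import Data.List.Relation.Unary.All as All using (All; []; _∷_)
  import Data.List.Relation.Unary.All.Properties as All
  open import Data.List.Relation.Unary.Any using (here; there)
  open import Data.List.Relation.Unary.AllPairs as AllPairs using (AllPairs; []; _∷_)
  import Data.List.Relation.Unary.AllPairs.Properties as AllPairs
  open import Data.List.Membership.Propositional using (_∈_)
  import Data.List.Membership.Propositional.Properties as ∈
  open import Data.Product.Base using (_×_; _,_; proj₁; proj₂; ∃-syntax)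
  open import Data.Sum.Base using (_⊎_; inj₁; inj₂)
  open import Data.Unit.Base using (⊤; tt)
  open import Data.Empty using (⊥)
  open import Relation.Binary.PropositionalEquality as ≡ using (_≡_)

  label : ∀ {A} → Item A → A
  label (u x) = x
  label (l x) = x

  Opposite : ∀ {A} → Item A → Item A → Set
  Opposite (u _) (l _) = ⊤
  Opposite (l _) (u _) = ⊤
  Opposite _     _     = ⊥

  opposite-flip : ∀ {A} (a b : Item A) → Opposite (flipᵢ a) (flipᵢ b) → Opposite a b
  opposite-flip (u _) (l _) _ = tt
  opposite-flip (l _) (u _) _ = tt

  label-flip : ∀ {A} (w : Word A) → map label (flip w) ≡ map label w
  label-flip []        = ≡.refl
  label-flip (u x ∷ w) = ≡.cong (x ∷_) (label-flip w)
  label-flip (l x ∷ w) = ≡.cong (x ∷_) (label-flip w)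

  AllPairs-middle : ∀ {a r} {A : Set a} {R : A → A → Set r} xs {y ys} → AllPairs R (xs ++ y ∷ ys) → All (λ x → R x y) xs × All (R y) ys
  AllPairs-middle []       (p ∷ _)  = [] , p
  AllPairs-middle (x ∷ xs) (p ∷ ps) with All.++⁻ʳ xs p | AllPairs-middle xs ps
  ... | q ∷ _ | q₁ , q₂ = q ∷ q₁ , q₂

  AllPairs-++⁻ : ∀ {a r} {A : Set a} {R : A → A → Set r} xs {ys} → AllPairs R (xs ++ ys) → AllPairs R xs × AllPairs R ys × All (λ x → All (R x) ys) xs
  AllPairs-++⁻ []       ps       = [] , ps , []
  AllPairs-++⁻ (x ∷ xs) (p ∷ ps) with AllPairs-++⁻ xs ps
  ... | q , r , s = All.++⁻ˡ xs p ∷ q , r , All.++⁻ʳ xs p ∷ s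

  module Vectors {c ℓ ℓ₂} (ℝ : RealField c ℓ ℓ₂) where
    open Sums ℝ public

    neg : Point → Point
    neg (a , b) = - a , - b

    opaque
      cross : Point → Point → Carrier
      cross (a₁ , a₂) (b₁ , b₂) = a₁ * b₂ + - (a₂ * b₁)

    infix 4 _≋_
    _≋_ : Point → Point → Set ℓ
    a ≋ b = (proj₁ a ≈ proj₁ b) × (proj₂ a ≈ proj₂ b)

    opaque
      unfolding cross

      cross-cong : ∀ {a a′ b b′} → a ≋ a′ → b ≋ b′ → cross a b ≈ cross a′ b′
      cross-cong (p , q) (r , s) = +-cong (*-cong p s) (-‿cong (*-cong q r))

      cross-negʳ : ∀ a b → cross a (neg b) ≈ cross b a
      cross-negʳ (a₁ , a₂) (b₁ , b₂) = solve 4 (λ a₁ a₂ b₁ b₂ → a₁ :* :- b₂ :+ :- (a₂ :* :- b₁) := b₁ :* a₂ :+ :- (b₂ :* a₁)) refl a₁ a₂ b₁ b₂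

      cross-negˡ : ∀ a b → cross (neg a) b ≈ cross b a
      cross-negˡ (a₁ , a₂) (b₁ , b₂) = solve 4 (λ a₁ a₂ b₁ b₂ → :- a₁ :* b₂ :+ :- (:- a₂ :* b₁) := b₁ :* a₂ :+ :- (b₂ :* a₁)) refl a₁ a₂ b₁ b₂

      cross-anti : ∀ a b → cross a b ≈ - cross b a
      cross-anti (a₁ , a₂) (b₁ , b₂) = solve 4 (λ a₁ a₂ b₁ b₂ → a₁ :* b₂ :+ :- (a₂ :* b₁) := :- (b₁ :* a₂ :+ :- (b₂ :* a₁))) refl a₁ a₂ b₁ b₂

      cross-self : ∀ a → cross a a ≈ 0#
      cross-self (a₁ , a₂) = solve 2 (λ a₁ a₂ → a₁ :* a₂ :+ :- (a₂ :* a₁) := con (+ 0)) refl a₁ a₂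

      -- The three-term Grassmann-Plücker relation. It makes the angular order transitive on the
      -- open half-plane to the left of `f`.
      plücker : ∀ f a b d → cross f a * cross b d + cross f d * cross a b ≈ cross f b * cross a d
      plücker (f₁ , f₂) (a₁ , a₂) (b₁ , b₂) (d₁ , d₂) = solve 8 (λ f₁ f₂ a₁ a₂ b₁ b₂ d₁ d₂ →
        (f₁ :* a₂ :+ :- (f₂ :* a₁)) :* (b₁ :* d₂ :+ :- (b₂ :* d₁)) :+ (f₁ :* d₂ :+ :- (f₂ :* d₁)) :* (a₁ :* b₂ :+ :- (a₂ :* b₁))
        := (f₁ :* b₂ :+ :- (f₂ :* b₁)) :* (a₁ :* d₂ :+ :- (a₂ :* d₁))) refl f₁ f₂ a₁ a₂ b₁ b₂ d₁ d₂

    cross-trans-NN : ∀ f a b d → Pos (cross f a) → Pos (cross f b) → Pos (cross f d) →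
                     NN (cross a b) → NN (cross b d) → NN (cross a d)
    cross-trans-NN f a b d fa fb fd ab bd = NN-cancel fb (NN-resp (plücker f a b d) (NN-+ (NN-* (proj₁ fa) bd) (NN-* (proj₁ fd) ab)))

    cross-trans : ∀ f a b d → Pos (cross f a) → Pos (cross f b) → Pos (cross f d) →
                  Pos (cross a b) → Pos (cross b d) → Pos (cross a d)
    cross-trans f a b d fa fb fd ab bd = Pos-cancel fb (Pos-resp (plücker f a b d) (Pos-+ (Pos-* fa bd) (NN-* (proj₁ fd) (proj₁ ab))))

    -- s f + t b = 0: the origin divides the segment from f to b in the ratio t : s.
    Balanced : Carrier → Carrier → Point → Point → Set ℓ
    Balanced s t f b = (s * proj₁ f + t * proj₁ b ≈ 0#) × (s * proj₂ f + t * proj₂ b ≈ 0#)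

    balanced-sym : ∀ {s t f b} → Balanced s t f b → Balanced t s b f
    balanced-sym (p , q) = trans (+-comm _ _) p , trans (+-comm _ _) q

    opaque
      unfolding cross

      -- Balance says `t b = - s f`, which trades the side of `a` with respect to `b` for its side
      -- with respect to `f`.
      balanced-cross : ∀ {s t f b} → Balanced s t f b → ∀ a → t * cross a b ≈ s * cross f a
      balanced-cross {s} {t} {f₁ , f₂} {b₁ , b₂} (p , q) (a₁ , a₂) = begin
        t * (a₁ * b₂ + - (a₂ * b₁))
          ≈⟨ solve 8 (λ s t f₁ f₂ b₁ b₂ a₁ a₂ → t :* (a₁ :* b₂ :+ :- (a₂ :* b₁)) :=
               s :* (f₁ :* a₂ :+ :- (f₂ :* a₁)) :+ ((s :* f₂ :+ t :* b₂) :* a₁ :+ :- ((s :* f₁ :+ t :* b₁) :* a₂))) refl s t f₁ f₂ b₁ b₂ a₁ a₂ ⟩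
        s * (f₁ * a₂ + - (f₂ * a₁)) + ((s * f₂ + t * b₂) * a₁ + - ((s * f₁ + t * b₁) * a₂))
          ≈⟨ +-congˡ (trans (+-cong (trans (*-congʳ q) (zeroˡ _)) (trans (-‿cong (trans (*-congʳ p) (zeroˡ _))) -0#≈0#)) (+-identityˡ _)) ⟩
        s * (f₁ * a₂ + - (f₂ * a₁)) + 0#  ≈⟨ +-identityʳ _ ⟩
        s * (f₁ * a₂ + - (f₂ * a₁)) ∎
        where open import Relation.Binary.Reasoning.Setoid setoid

    balanced-Pos : ∀ {s t f b} → Pos s → Pos t → Balanced s t f b → ∀ a → Pos (cross f a) → Pos (cross a b)
    balanced-Pos p q e a r = Pos-cancel q (Pos-resp (sym (balanced-cross e a)) (Pos-* p r))

    balanced-NN : ∀ {s t f b} → NN s → Pos t → Balanced s t f b → ∀ a → NN (cross f a) → NN (cross a b)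
    balanced-NN p q e a r = NN-cancel q (NN-resp (sym (balanced-cross e a)) (NN-* p r))

    module Minimum {a} {A : Set a} (F G : A → Carrier) where
      -- `F q / G q` is the time of the event `q`: either nothing happens before time one, or some
      -- `q` is earliest. Ratios are compared by cross multiplication, which avoids division.
      minimum : ∀ ps → All (λ q → Pos (G q)) ps →
        All (λ q → NN (F q + - G q)) ps ⊎
        ∃[ q ] (q ∈ ps × Pos (G q + - F q) × All (λ r → NN (F r * G q + - (F q * G r))) ps)
      minimum [] [] = inj₁ []
      minimum (r ∷ ps) (Gr ∷ Gs) with minimum ps Gs
      ... | inj₁ all with sign (F r + - G r)
      ...   | positive p = inj₁ (proj₁ p ∷ all)
      ...   | vanishes p = inj₁ (NN-≈0 p ∷ all)
      ...   | negative p = inj₂ (r , here ≡.refl , r< , NN-≈0 (-‿inverseʳ _) ∷ All.zipWith (λ { {q} (s , t) → NN-resp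
                (solve 4 (λ f g f′ g′ → (f′ :+ :- g′) :* g :+ g′ :* (g :+ :- f) := f′ :* g :+ :- (f :* g′)) refl (F r) (G r) (F q) (G q))
                (NN-+ (NN-* s (proj₁ Gr)) (NN-* (proj₁ t) (proj₁ r<))) }) (all , Gs))
        where
        r< : Pos (G r + - F r)
        r< = Pos-resp (solve 2 (λ f g → :- (f :+ :- g) := g :+ :- f) refl (F r) (G r)) p
      minimum (r ∷ ps) (Gr ∷ Gs) | inj₂ (q , q∈ , q< , all) with sign (F r * G q + - (F q * G r))
      ...   | positive p = inj₂ (q , there q∈ , q< , proj₁ p ∷ all)
      ...   | vanishes p = inj₂ (q , there q∈ , q< , NN-≈0 p ∷ all)
      ...   | negative p = inj₂ (r , here ≡.refl , r< , NN-≈0 (-‿inverseʳ _) ∷ All.zipWith (λ { {s} (t , v) → NN-cancel Gq (NN-resp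
                (solve 6 (λ f g f′ g′ f″ g″ → g :* (f″ :* g′ :+ :- (f′ :* g″)) :+ g″ :* :- (f :* g′ :+ :- (f′ :* g)) := g′ :* (f″ :* g :+ :- (f :* g″))) refl (F r) (G r) (F q) (G q) (F s) (G s))
                (NN-+ (NN-* (proj₁ Gr) t) (NN-* (proj₁ v) (proj₁ p)))) }) (all , Gs))
        where
        Gq : Pos (G q)
        Gq = All.lookup Gs q∈
        r< : Pos (G r + - F r)
        r< = Pos-cancel Gq (Pos-resp (solve 4 (λ f g f′ g′ → :- (f :* g′ :+ :- (f′ :* g)) :+ g :* (g′ :+ :- f′) := g′ :* (g :+ :- f)) refl (F r) (G r) (F q) (G q))
               (Pos-+ p (NN-* (proj₁ Gr) (proj₁ q<))))

  lowers : ∀ {A : Set} → Word A → List A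
  lowers []        = []
  lowers (u x ∷ w) = lowers w
  lowers (l x ∷ w) = x ∷ lowers w

  crossings : ∀ {A : Set} → Word A → List (A × A)
  crossings []        = []
  crossings (u x ∷ w) = map (x ,_) (lowers w) ++ crossings w
  crossings (l x ∷ w) = crossings w

  lowers-split : ∀ {A : Set} {y : A} w → y ∈ lowers w → ∃[ β ] ∃[ γ ] w ≡ β ++ l y ∷ γ
  lowers-split (u x ∷ w) p with lowers-split w p
  ... | β , γ , ≡.refl = u x ∷ β , γ , ≡.refl
  lowers-split (l x ∷ w) (here ≡.refl) = [] , w , ≡.refl
  lowers-split (l x ∷ w) (there p) with lowers-split w p
  ... | β , γ , ≡.refl = l x ∷ β , γ , ≡.refl

  crossings-split : ∀ {A : Set} {x y : A} w → (x , y) ∈ crossings w → ∃[ α ] ∃[ β ] ∃[ γ ] w ≡ α ++ u x ∷ β ++ l y ∷ γ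
  crossings-split (l z ∷ w) p with crossings-split w p
  ... | α , β , γ , ≡.refl = l z ∷ α , β , γ , ≡.refl
  crossings-split (u z ∷ w) p with ∈.∈-++⁻ (map (z ,_) (lowers w)) p
  ... | inj₁ q with ∈.∈-map⁻ (z ,_) q
  ...   | y , y∈ , ≡.refl with lowers-split w y∈
  ...     | β , γ , ≡.refl = [] , β , γ , ≡.refl
  crossings-split (u z ∷ w) p | inj₂ q with crossings-split w q
  ...   | α , β , γ , ≡.refl = u z ∷ α , β , γ , ≡.refl


-- Geometric states of the moving point, and the slide along a segment.

module States where
  open OrderedField
  open Separation
  open Search
  open import Level using (_⊔_)
  open import Data.Fin.Base using (Fin)
  open import Data.Integer.Base using (+_)
  open import Data.List.Base using (List; []; _∷_; _++_; map; allFin)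
  open import Data.List.Properties using (++-assoc; map-++)
  open import Data.List.Relation.Unary.All as All using (All; []; _∷_)
  import Data.List.Relation.Unary.All.Properties as All
  open import Data.List.Relation.Unary.AllPairs as AllPairs using (AllPairs; []; _∷_)
  import Data.List.Relation.Unary.AllPairs.Properties as AllPairs
  open import Data.List.Relation.Unary.Unique.Propositional using (Unique)
  import Data.List.Relation.Unary.Unique.Propositional.Properties as Unique
  open import Data.List.Relation.Binary.Permutation.Propositional using (_↭_; prep; swap; ↭-refl; ↭-sym; ↭-trans; ↭-reflexive; ↭⇒↭ₛ)
  import Data.List.Relation.Binary.Permutation.Propositional.Properties as ↭
  import Data.List.Relation.Binary.Permutation.Setoid.Properties as ↭ₛ
  import Data.Product.Base as Σ
  open import Data.Product.Base using (_×_; _,_; proj₁; proj₂; ∃-syntax)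
  open import Data.Sum.Base using (_⊎_; inj₁; inj₂)
  open import Data.Unit.Base using (tt)
  open import Data.Empty using (⊥; ⊥-elim)
  open import Function.Base using (_∘_)
  open import Relation.Nullary using (¬_)
  open import Relation.Binary.PropositionalEquality as ≡ using (_≡_; _≢_)
  open Plane

  module States {c ℓ ℓ₂} (ℝ : RealField c ℓ ℓ₂) (X : Fin 10 → Geometry.Point ℝ) (general : Sums.General ℝ X) where
    open Vectors ℝ

    Label : Set
    Label = Fin 10

    vec : Point → Label → Point
    vec p i = proj₁ (X i) + - proj₁ p , proj₂ (X i) + - proj₂ p

    -- Lower points are reflected in p, so that all directions lie in one half-plane.
    ray : Point → Item Label → Point
    ray p (u i) = vec p i
    ray p (l i) = neg (vec p i)

    ray-flipˡ : ∀ p a w → cross (ray p (flipᵢ a)) w ≈ cross w (ray p a)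
    ray-flipˡ p (u i) w = cross-negˡ (vec p i) w
    ray-flipˡ p (l i) w = sym (cross-negʳ w (vec p i))

    ray-flipʳ : ∀ p w a → cross w (ray p (flipᵢ a)) ≈ cross (ray p a) w
    ray-flipʳ p w (u i) = cross-negʳ w (vec p i)
    ray-flipʳ p w (l i) = sym (cross-negˡ (vec p i) w)

    ray-cross≈0 : ∀ p a b → cross (ray p a) (ray p b) ≈ 0# → cross (vec p (label a)) (vec p (label b)) ≈ 0#
    ray-cross≈0 p (u i) (u j) e = e
    ray-cross≈0 p (u i) (l j) e = trans (cross-anti _ _) (trans (-‿cong (trans (sym (cross-negʳ (vec p i) (vec p j))) e)) -0#≈0#)
    ray-cross≈0 p (l i) (u j) e = trans (cross-anti _ _) (trans (-‿cong (trans (sym (cross-negˡ (vec p i) (vec p j))) e)) -0#≈0#)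
    ray-cross≈0 p (l i) (l j) e = trans (sym (trans (cross-negˡ (vec p i) (neg (vec p j))) (cross-negˡ (vec p j) (vec p i)))) e

    -- Letters of equal sign are left unordered, because they may change places without `p` meeting
    -- a segment. Ties are allowed, so that a crossing satisfies both the word before it and the
    -- word after it.
    InOrder : Point → Item Label → Item Label → Set _
    InOrder p a b = Opposite a b → NN (cross (ray p a) (ray p b))

    Ordered′ : Point → Word Label → Set _
    Ordered′ p = AllPairs (InOrder p)

    ordered-flip : ∀ {p} w → Ordered′ p w → Ordered′ p (flip w)
    ordered-flip {p} w o = AllPairs.map⁺ (AllPairs.map (λ {a} {b} h op → NN-resp
      (sym (trans (ray-flipˡ p a (ray p (flipᵢ b))) (ray-flipˡ p b (ray p a)))) (h (opposite-flip a b op))) o)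

    -- `s` may vanish: then `p` is the end `b` itself, where a slide out of one of the ten points
    -- starts.
    record Flat (p : Point) (f b : Label) (w : Word Label) : Set (c ⊔ ℓ ⊔ ℓ₂) where
      field
        {s t}   : Carrier
        s≥0     : NN s
        t>0     : Pos t
        between : Balanced s t (vec p f) (vec p b)
        ahead   : All (λ a → Pos (cross (vec p f) (ray p a))) w
        ordered : Ordered′ p w
        labels  : f ∷ b ∷ map label w ↭ allFin 10

    -- `pre` lists the rays between those of `f` and `x`, `post` the rays between those of `x` and
    -- `b`.
    record Vertex (p : Point) (f b : Label) (pre : Word Label) (x y : Label) (post : Word Label) : Set (c ⊔ ℓ ⊔ ℓ₂) where
      field
        {s t s′ t′} : Carrier
        s>0 : Pos s
        t>0 : Pos t
        s′>0 : Pos s′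
        t′>0 : Pos t′
        between  : Balanced s t (vec p f) (vec p b)
        between′ : Balanced s′ t′ (vec p x) (vec p y)
        upper    : Pos (cross (vec p f) (vec p x))
        before   : All (λ a → Pos (cross (vec p f) (ray p a)) × Pos (cross (ray p a) (vec p x))) pre
        after    : All (λ a → Pos (cross (vec p f) (ray p a)) × Pos (cross (vec p x) (ray p a))) post
        pre-ordered  : Ordered′ p pre
        post-ordered : Ordered′ p post
        labels   : f ∷ b ∷ x ∷ y ∷ map label (pre ++ post) ↭ allFin 10

    -- A quarter turn about `p`: `x` takes the place of `f`, and the sector `pre`, passed by the
    -- reference direction, comes last with its signs exchanged.
    rotate : ∀ {p f b pre x y post} → Vertex p f b pre x y post → Vertex p x y post b f (flip pre)
    rotate {p} {f} {b} {pre} {x} {y} {post} v = record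
      { s>0 = s′>0 ; t>0 = t′>0 ; s′>0 = t>0 ; t′>0 = s>0 ; between = between′ ; between′ = balanced-sym between
      ; upper = balanced-Pos s>0 t>0 between (vec p x) upper
      ; before = All.map (λ {a} (fa , xa) → xa , balanced-Pos s>0 t>0 between (ray p a) fa) after
      ; after = All.map⁺ (All.map (λ {a} (fa , ax) → Pos-resp (sym (ray-flipʳ p (vec p x) a)) ax ,
          Pos-resp (sym (ray-flipʳ p (vec p b) a)) (balanced-Pos s>0 t>0 between (ray p a) fa)) before)
      ; pre-ordered = post-ordered
      ; post-ordered = ordered-flip pre pre-ordered
      ; labels = ↭-trans reorder labels }
      where
      open Vertex v
      reorder : x ∷ y ∷ b ∷ f ∷ map label (post ++ flip pre) ↭ f ∷ b ∷ x ∷ y ∷ map label (pre ++ post)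
      reorder = ↭-trans (↭.shifts (x ∷ y ∷ []) (b ∷ f ∷ [])) (↭-trans (swap b f ↭-refl) (prep f (prep b (prep x (prep y
        (↭-trans (↭-reflexive (≡.trans (map-++ label post (flip pre)) (≡.cong (map label post ++_) (label-flip pre))))
          (↭-trans (↭.++-comm (map label post) (map label pre)) (↭-reflexive (≡.sym (map-++ label pre post))))))))))

    pre<post : ∀ {p f b pre x y post} → Vertex p f b pre x y post → All (λ a → All (λ a′ → NN (cross (ray p a) (ray p a′))) post) pre
    pre<post {p} {f} {x = x} v = All.map (λ {a} (fa , ax) → All.map (λ {a′} (fa′ , xa′) →
        cross-trans-NN (vec p f) (ray p a) (vec p x) (ray p a′) fa upper fa′ (proj₁ ax) (proj₁ xa′)) after) before
      where open Vertex v

    -- No step past the crossing is needed: at `p` the rays `u x` and `l y` have the same direction,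
    -- and since `Ordered′` is weak the exchanged word already holds at this very point.
    depart : ∀ {p f b pre x y post} → Vertex p f b pre x y post → Flat p f b (pre ++ l y ∷ u x ∷ post)
    depart {p} {f} {b} {pre} {x} {y} {post} v = record
      { s≥0 = proj₁ s>0 ; t>0 = t>0 ; between = between
      ; ahead = All.++⁺ (All.map proj₁ before) (fy ∷ upper ∷ All.map proj₁ after)
      ; ordered = AllPairs.++⁺ pre-ordered ((yx ∷ All.map (λ {a} (fa , xa) _ → NN-resp (sym (cross-negˡ (vec p y) (ray p a))) (proj₁ (xy (ray p a) xa))) after)
          ∷ All.map (λ (fa , xa) _ → proj₁ xa) after ∷ post-ordered)
          (All.zipWith (λ { {a} ((fa , ax) , later) → (λ _ → NN-resp (sym (cross-negʳ (ray p a) (vec p y))) (proj₁ (yx′ (ray p a) ax)))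
              ∷ (λ _ → proj₁ ax) ∷ All.map (λ h _ → h) later }) (before , pre<post v))
      ; labels = ↭-trans (prep f (prep b (↭-trans (↭-reflexive (map-++ label pre (l y ∷ u x ∷ post))) (↭-trans (↭.shifts (map label pre) (y ∷ x ∷ []))
          (↭-trans (swap y x ↭-refl) (prep x (prep y (↭-reflexive (≡.sym (map-++ label pre post))))))))) ) labels }
      where
      open Vertex v
      xy : ∀ a → Pos (cross (vec p x) a) → Pos (cross a (vec p y))
      xy = balanced-Pos s′>0 t′>0 between′
      yx′ : ∀ a → Pos (cross a (vec p x)) → Pos (cross (vec p y) a)
      yx′ a h = Pos-cancel t′>0 (Pos-resp
        (trans (solve 2 (λ s k → s :* k := :- (s :* :- k)) refl _ (cross a (vec p x)))
          (trans (-‿cong (trans (*-congˡ (sym (cross-anti (vec p x) a))) (sym (balanced-cross between′ a))))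
            (trans (solve 2 (λ t k → :- (t :* k) := t :* :- k) refl _ (cross a (vec p y))) (*-congˡ (sym (cross-anti (vec p y) a))))))
        (Pos-* s′>0 h))
      fy : Pos (cross (vec p f) (neg (vec p y)))
      fy = Pos-resp (sym (cross-negʳ (vec p f) (vec p y))) (yx′ (vec p f) upper)
      yx : InOrder p (l y) (u x)
      yx _ = NN-resp (sym (cross-negˡ (vec p y) (vec p x))) (balanced-NN (proj₁ s′>0) t′>0 between′ (vec p x) (NN-≈0 (cross-self (vec p x))))

    unique : ∀ {is} → is ↭ allFin 10 → Unique is
    unique σ = ↭ₛ.Unique-resp-↭ (≡.setoid Label) (↭⇒↭ₛ (↭-sym σ)) (Unique.allFin⁺ 10)

    opaque
      unfolding cross

      orientation≈cross : ∀ q i j → cross (vec (X q) i) (vec (X q) j) ≈ orientation (X q) (X i) (X j)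
      orientation≈cross q i j = refl

      -- `orientation` is the sum of the three cross products formed from the vectors based at an
      -- arbitrary `p`.
      collinear : ∀ p i j k → cross (vec p i) (vec p j) ≈ 0# → cross (vec p j) (vec p k) ≈ 0# → cross (vec p k) (vec p i) ≈ 0# →
                  orientation (X i) (X j) (X k) ≈ 0#
      collinear p i j k ij jk ki = trans (solve 8 (λ p₁ p₂ i₁ i₂ j₁ j₂ k₁ k₂ →
          (j₁ :+ :- i₁) :* (k₂ :+ :- i₂) :+ :- ((j₂ :+ :- i₂) :* (k₁ :+ :- i₁)) :=
          ((i₁ :+ :- p₁) :* (j₂ :+ :- p₂) :+ :- ((i₂ :+ :- p₂) :* (j₁ :+ :- p₁))) :+ (((j₁ :+ :- p₁) :* (k₂ :+ :- p₂) :+ :- ((j₂ :+ :- p₂) :* (k₁ :+ :- p₁)))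
            :+ ((k₁ :+ :- p₁) :* (i₂ :+ :- p₂) :+ :- ((k₂ :+ :- p₂) :* (i₁ :+ :- p₁))))) refl
          (proj₁ p) (proj₂ p) (proj₁ (X i)) (proj₂ (X i)) (proj₁ (X j)) (proj₂ (X j)) (proj₁ (X k)) (proj₂ (X k)))
        (trans (+-cong ij (+-cong jk ki)) (trans (+-identityˡ _) (+-identityˡ _)))

    move : Point → Carrier → Point → Point
    move p τ d = proj₁ p + τ * proj₁ d , proj₂ p + τ * proj₂ d

    infixl 6 _⊖_·_
    _⊖_·_ : Point → Carrier → Point → Point
    a ⊖ τ · d = proj₁ a + - (τ * proj₁ d) , proj₂ a + - (τ * proj₂ d)

    vec-move : ∀ p τ d i → vec (move p τ d) i ≋ (vec p i ⊖ τ · d)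
    vec-move p τ d i = solve 4 (λ x p t d → x :+ :- (p :+ t :* d) := (x :+ :- p) :+ :- (t :* d)) refl _ _ _ _ ,
                       solve 4 (λ x p t d → x :+ :- (p :+ t :* d) := (x :+ :- p) :+ :- (t :* d)) refl _ _ _ _

    neg-cong : ∀ {a b} → a ≋ b → neg a ≋ neg b
    neg-cong (p , q) = -‿cong p , -‿cong q

    opaque
      unfolding cross

      -- Both vectors are shifted by the same multiple of `d`, so there is no quadratic term, and
      -- the time of a tie is a quotient of two cross products.
      cross-move-ul : ∀ a b d τ → cross (a ⊖ τ · d) (neg (b ⊖ τ · d)) ≈ cross a (neg b) + - (τ * (cross d a + cross d (neg b)))
      cross-move-ul (a₁ , a₂) (b₁ , b₂) (d₁ , d₂) τ = solve 7 (λ a₁ a₂ b₁ b₂ d₁ d₂ t →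
          (a₁ :+ :- (t :* d₁)) :* :- (b₂ :+ :- (t :* d₂)) :+ :- ((a₂ :+ :- (t :* d₂)) :* :- (b₁ :+ :- (t :* d₁))) :=
          (a₁ :* :- b₂ :+ :- (a₂ :* :- b₁)) :+ :- (t :* ((d₁ :* a₂ :+ :- (d₂ :* a₁)) :+ (d₁ :* :- b₂ :+ :- (d₂ :* :- b₁))))) refl a₁ a₂ b₁ b₂ d₁ d₂ τ

      cross-move-lu : ∀ a b d τ → cross (neg (a ⊖ τ · d)) (b ⊖ τ · d) ≈ cross (neg a) b + τ * (cross d (neg a) + cross d b)
      cross-move-lu (a₁ , a₂) (b₁ , b₂) (d₁ , d₂) τ = solve 7 (λ a₁ a₂ b₁ b₂ d₁ d₂ t →
          :- (a₁ :+ :- (t :* d₁)) :* (b₂ :+ :- (t :* d₂)) :+ :- (:- (a₂ :+ :- (t :* d₂)) :* (b₁ :+ :- (t :* d₁))) :=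
          (:- a₁ :* b₂ :+ :- (:- a₂ :* b₁)) :+ t :* ((d₁ :* :- a₂ :+ :- (d₂ :* :- a₁)) :+ (d₁ :* b₂ :+ :- (d₂ :* b₁)))) refl a₁ a₂ b₁ b₂ d₁ d₂ τ

      cross-along : ∀ a d τ → cross d (a ⊖ τ · d) ≈ cross d a
      cross-along (a₁ , a₂) (d₁ , d₂) τ = solve 5 (λ a₁ a₂ d₁ d₂ t →
          d₁ :* (a₂ :+ :- (t :* d₂)) :+ :- (d₂ :* (a₁ :+ :- (t :* d₁))) := d₁ :* a₂ :+ :- (d₂ :* a₁)) refl a₁ a₂ d₁ d₂ τ

    opaque
      unfolding cross

      cross-shrink : ∀ d τ a → cross (d ⊖ τ · d) a ≈ (1# + - τ) * cross d a
      cross-shrink (d₁ , d₂) τ (a₁ , a₂) = trans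
        (solve 5 (λ t d₁ d₂ a₁ a₂ → (d₁ :+ :- (t :* d₁)) :* a₂ :+ :- ((d₂ :+ :- (t :* d₂)) :* a₁)
          := (d₁ :* a₂ :+ :- (d₂ :* a₁)) :+ :- t :* (d₁ :* a₂ :+ :- (d₂ :* a₁))) refl τ d₁ d₂ a₁ a₂)
        (trans (+-congʳ (sym (*-identityˡ _))) (sym (distribʳ _ _ _)))

      -- Cramer's rule for three vectors in the plane. At a tie the right-hand side vanishes, and
      -- the remaining coefficients place the point between `x` and `y`.
      cross-balance₁ : ∀ d x y → cross d (neg y) * proj₁ x + cross d x * proj₁ y ≈ cross x (neg y) * proj₁ d
      cross-balance₁ (d₁ , d₂) (x₁ , x₂) (y₁ , y₂) = solve 6 (λ d₁ d₂ x₁ x₂ y₁ y₂ → (d₁ :* :- y₂ :+ :- (d₂ :* :- y₁)) :* x₁ :+ (d₁ :* x₂ :+ :- (d₂ :* x₁)) :* y₁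
        := (x₁ :* :- y₂ :+ :- (x₂ :* :- y₁)) :* d₁) refl d₁ d₂ x₁ x₂ y₁ y₂

      cross-balance₂ : ∀ d x y → cross d (neg y) * proj₂ x + cross d x * proj₂ y ≈ cross x (neg y) * proj₂ d
      cross-balance₂ (d₁ , d₂) (x₁ , x₂) (y₁ , y₂) = solve 6 (λ d₁ d₂ x₁ x₂ y₁ y₂ → (d₁ :* :- y₂ :+ :- (d₂ :* :- y₁)) :* x₂ :+ (d₁ :* x₂ :+ :- (d₂ :* x₁)) :* y₂
        := (x₁ :* :- y₂ :+ :- (x₂ :* :- y₁)) :* d₂) refl d₁ d₂ x₁ x₂ y₁ y₂

      cross-zeroˡ : ∀ d → d ≋ (0# , 0#) → ∀ a → cross d a ≈ 0#
      cross-zeroˡ d (e₁ , e₂) a = trans (+-cong (trans (*-congʳ e₁) (zeroˡ _)) (trans (-‿cong (trans (*-congʳ e₂) (zeroˡ _))) -0#≈0#)) (+-identityˡ _)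

    cross-along-ray : ∀ p d τ a → cross d (ray (move p τ d) a) ≈ cross d (ray p a)
    cross-along-ray p d τ (u i) = trans (cross-cong (refl , refl) (vec-move p τ d i)) (cross-along (vec p i) d τ)
    cross-along-ray p d τ (l i) = trans (cross-negʳ d (vec (move p τ d) i)) (trans (cross-anti (vec (move p τ d) i) d)
      (trans (-‿cong (cross-along-ray p d τ (u i))) (trans (sym (cross-anti (vec p i) d)) (sym (cross-negʳ d (vec p i))))))

    -- Behaviour of the crossings of the word while p moves in direction d: only a pair in the order u, l can tie.
    reach : Point → Label × Label → Carrier
    reach p (x , y) = cross (vec p x) (neg (vec p y))

    ordered-move : ∀ p d τ w → NN τ → All (λ a → Pos (cross d (ray p a))) w → Ordered′ p w →
      All (λ xy → NN (reach p xy + - (τ * (cross d (vec p (proj₁ xy)) + cross d (neg (vec p (proj₂ xy))))))) (crossings w) →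
      Ordered′ (move p τ d) w
    ordered-move p d τ [] τ≥0 h o q = []
    ordered-move p d τ (l x ∷ w) τ≥0 (hx ∷ h) (ox ∷ o) q = lus w h ox ∷ ordered-move p d τ w τ≥0 h o q
      where
      lus : ∀ w → All (λ a → Pos (cross d (ray p a))) w → All (InOrder p (l x)) w → All (InOrder (move p τ d) (l x)) w
      lus [] [] [] = []
      lus (l y ∷ w) (_ ∷ h) (_ ∷ o) = (λ ()) ∷ lus w h o
      lus (u y ∷ w) (hy ∷ h) (oy ∷ o) = (λ _ → NN-resp
        (sym (trans (cross-cong (neg-cong (vec-move p τ d x)) (vec-move p τ d y)) (cross-move-lu (vec p x) (vec p y) d τ)))
        (NN-+ (oy tt) (NN-* τ≥0 (NN-+ (proj₁ hx) (proj₁ hy))))) ∷ lus w h o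
    ordered-move p d τ (u x ∷ w) τ≥0 (hx ∷ h) (ox ∷ o) q =
      uls w (All.map⁻ (All.++⁻ˡ (map (x ,_) (lowers w)) q)) ∷ ordered-move p d τ w τ≥0 h o (All.++⁻ʳ (map (x ,_) (lowers w)) q)
      where
      uls : ∀ w → All (λ y → NN (reach p (x , y) + - (τ * (cross d (vec p x) + cross d (neg (vec p y)))))) (lowers w) → All (InOrder (move p τ d) (u x)) w
      uls [] [] = []
      uls (u y ∷ w) q = (λ ()) ∷ uls w q
      uls (l y ∷ w) (qy ∷ q) = (λ _ → NN-resp
        (sym (trans (cross-cong (vec-move p τ d x) (neg-cong (vec-move p τ d y))) (cross-move-ul (vec p x) (vec p y) d τ))) qy) ∷ uls w q

    ray-cong : ∀ {p q} → p ≋ q → ∀ a → ray p a ≋ ray q a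
    ray-cong (e₁ , e₂) (u i) = +-congˡ (-‿cong e₁) , +-congˡ (-‿cong e₂)
    ray-cong e         (l i) = neg-cong (ray-cong e (u i))

    ordered-resp : ∀ {p q} → p ≋ q → ∀ {w} → Ordered′ p w → Ordered′ q w
    ordered-resp e = AllPairs.map λ {a} {b} h op → NN-resp (cross-cong (ray-cong e a) (ray-cong e b)) (h op)

    -- In the state after a slide, `a` is the end left behind, taken as a lower letter; its ray is
    -- the direction of travel, and all other rays lie strictly to the left of it.
    record XState (q : Label) (a : Item Label) (w : Word Label) : Set (c ⊔ ℓ ⊔ ℓ₂) where
      field
        ahead   : All (λ a′ → Pos (cross (ray (X q) a) (ray (X q) a′))) w
        ordered : Ordered′ (X q) w
        labels  : q ∷ label a ∷ map label w ↭ allFin 10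

    -- The two letters that meet need not be neighbours: `β₁` belongs to the run of `x` and `β₂` to
    -- the run of `y`, so both can be moved out of the way by reordering within runs.
    record Crossing (f b : Label) (w : Word Label) : Set (c ⊔ ℓ ⊔ ℓ₂) where
      field
        {q}     : Point
        {x y}   : Label
        α       : Word Label
        β₁ β₂   : List Label
        γ       : Word Label
        split   : w ≡ α ++ u x ∷ map u β₁ ++ map l β₂ ++ l y ∷ γ
        vertex  : Vertex q f b (α ++ map u β₁) x y (map l β₂ ++ γ)

    AllPairs-remove : ∀ {a r} {A : Set a} {R : A → A → Set r} xs {y ys} → AllPairs R (xs ++ y ∷ ys) → AllPairs R (xs ++ ys)
    AllPairs-remove []       (_ ∷ ps) = ps
    AllPairs-remove (x ∷ xs) {y} {ys} (p ∷ ps) = All.++⁺ (All.++⁻ˡ xs p) (All.tail (All.++⁻ʳ xs p)) ∷ AllPairs-remove xs ps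

    All-middle : ∀ {a r} {A : Set a} {P : A → Set r} xs {y ys} → All P (xs ++ y ∷ ys) → P y
    All-middle xs ps = All.head (All.++⁻ʳ xs ps)

    module Slide {p f b w} (flat : Flat p f b w) where
      open Flat flat

      d : Point
      d = vec p f

      -- The rate at which `reach` decreases during the slide, measured so that `p` is at `f` at
      -- time one.
      gain : Label × Label → Carrier
      gain (x , y) = cross d (vec p x) + cross d (neg (vec p y))

      gains : All (λ xy → Pos (gain xy)) (crossings w)
      gains = All.tabulate λ { {x , y} xy∈ → pos (crossings-split w xy∈) }
        where
        pos : ∀ {x y} → ∃[ α ] ∃[ β ] ∃[ γ ] w ≡ α ++ u x ∷ β ++ l y ∷ γ → Pos (gain (x , y))
        pos (α , β , γ , ≡.refl) with All.++⁻ʳ α ahead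
        ... | hx ∷ h with All.++⁻ʳ β h
        ...   | hy ∷ _ = Pos-+ hx (proj₁ hy)

      arrive : All (λ xy → NN (reach p xy + - gain xy)) (crossings w) → XState f (l b) w
      arrive all = record
        { ahead   = All.map (λ {a} h → Pos-resp (sym (cross-negˡ (vec (X f) b) (ray (X f) a)))
                      (balanced-Pos (NN-+-Pos s≥0 t>0) t>0 between″ (ray (X f) a)
                        (Pos-resp (trans (sym (cross-along-ray p d 1# a)) (cross-cong (refl , refl) (ray-cong there′ a))) h))) ahead
        ; ordered = ordered-resp there′ (ordered-move p d 1# w NN-1 ahead ordered
                      (All.map (λ {xy} → NN-resp (+-congˡ (-‿cong (sym (*-identityˡ (gain xy)))))) all))
        ; labels  = labels }
        where
        there′ : move p 1# d ≋ X f
        there′ = trans (+-congˡ (*-identityˡ _)) (solve 2 (λ p x → p :+ (x :+ :- p) := x) refl _ _) ,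
                 trans (+-congˡ (*-identityˡ _)) (solve 2 (λ p x → p :+ (x :+ :- p) := x) refl _ _)
        between″ : Balanced (s + t) t d (vec (X f) b)
        between″ = trans (solve 5 (λ s t x p b → (s :+ t) :* (x :+ :- p) :+ t :* (b :+ :- x) := s :* (x :+ :- p) :+ t :* (b :+ :- p)) refl s t _ _ _) (proj₁ between) ,
                   trans (solve 5 (λ s t x p b → (s :+ t) :* (x :+ :- p) :+ t :* (b :+ :- x) := s :* (x :+ :- p) :+ t :* (b :+ :- p)) refl s t _ _ _) (proj₂ between)

      module Meet {x y} (α β γ : Word Label) (w≡ : w ≡ α ++ u x ∷ β ++ l y ∷ γ) (g>0 : Pos (gain (x , y)))
                  (first : All (λ r → NN (reach p r * gain (x , y) + - (reach p (x , y) * gain r))) (crossings w))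
                  (τ : Carrier) (τ≥0 : NN τ) (gτ : gain (x , y) * τ ≈ reach p (x , y)) (1-τ>0 : Pos (1# + - τ)) where

        q : Point
        q = move p τ d

        ordered₁ : Ordered′ q w
        ordered₁ = ordered-move p d τ w τ≥0 ahead ordered (All.map (λ {r} h → NN-cancel g>0 (NN-resp
          (sym (trans (solve 4 (λ g t r g′ → g :* (r :+ :- (t :* g′)) := r :* g :+ :- ((g :* t) :* g′)) refl (gain (x , y)) τ (reach p r) (gain r))
            (+-congˡ (-‿cong (*-congʳ gτ))))) h)) first)

        cross-d₁ : ∀ a → cross (vec q f) a ≈ (1# + - τ) * cross d a
        cross-d₁ a = trans (cross-cong (vec-move p τ d f) (refl , refl)) (cross-shrink d τ a)

        ahead₁ : All (λ a → Pos (cross (vec q f) (ray q a))) w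
        ahead₁ = All.map (λ {a} h → Pos-resp (sym (trans (cross-d₁ (ray q a)) (*-congˡ (cross-along-ray p d τ a)))) (Pos-* 1-τ>0 h)) ahead

        tie : cross (vec q x) (neg (vec q y)) ≈ 0#
        tie = trans (cross-cong (vec-move p τ d x) (neg-cong (vec-move p τ d y))) (trans (cross-move-ul (vec p x) (vec p y) d τ)
                (trans (+-congˡ (-‿cong (trans (*-comm _ _) gτ))) (-‿inverseʳ _)))

        tie′ : cross (vec q x) (vec q y) ≈ 0#
        tie′ = trans (cross-anti (vec q x) (vec q y)) (trans (-‿cong (trans (sym (cross-negʳ (vec q x) (vec q y))) tie)) -0#≈0#)

        ahead₂ : All (λ a → Pos (cross (vec q f) (ray q a))) (α ++ u x ∷ β ++ l y ∷ γ)
        ahead₂ = ≡.subst (All (λ a → Pos (cross (vec q f) (ray q a)))) w≡ ahead₁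

        split-ahead : Pos (cross (vec q f) (vec q x)) × Pos (cross (vec q f) (neg (vec q y)))
        split-ahead = All-middle α ahead₂ , All-middle β (All.tail (All.++⁻ʳ α ahead₂))

        between′ : Balanced (cross (vec q f) (neg (vec q y))) (cross (vec q f) (vec q x)) (vec q x) (vec q y)
        between′ = trans (cross-balance₁ (vec q f) (vec q x) (vec q y)) (trans (*-congʳ tie) (zeroˡ _)) ,
                   trans (cross-balance₂ (vec q f) (vec q x) (vec q y)) (trans (*-congʳ tie) (zeroˡ _))

        distinct-labels : AllPairs (λ a a′ → label a ≢ label a′) (α ++ u x ∷ β ++ l y ∷ γ)
        distinct-labels = AllPairs.map⁻ (≡.subst (λ w → AllPairs _≢_ (map label w)) w≡ (AllPairs.tail (AllPairs.tail (unique labels))))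

        x≢ : All (λ a → label a ≢ x) α × All (λ a → x ≢ label a) (β ++ l y ∷ γ)
        x≢ = AllPairs-middle α distinct-labels

        y≢ : All (λ a → label a ≢ y) (α ++ u x ∷ β) × All (λ a → y ≢ label a) γ
        y≢ = AllPairs-middle (α ++ u x ∷ β) (≡.subst (AllPairs _) (≡.sym (++-assoc α (u x ∷ β) (l y ∷ γ))) distinct-labels)

        x≢y : x ≢ y
        x≢y = All-middle β (proj₂ x≢)

        -- The line through `x` and `y` passes through `q` and, by general position, contains no
        -- third point. This is what makes comparisons with that line strict.
        nonzero : ∀ k → x ≢ k → y ≢ k → ¬ (cross (vec q x) (vec q k) ≈ 0#)
        nonzero k x≢k y≢k e = general x y k x≢y x≢k y≢k (collinear q x y k tie′
          (noZeroDivisors (proj₂ (proj₁ split-ahead)) (trans (*-congˡ (cross-anti (vec q y) (vec q k)))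
            (trans (solve 2 (λ t k → t :* :- k := :- (t :* k)) refl _ _) (trans (-‿cong (trans (balanced-cross between′ (vec q k)) (trans (*-congˡ e) (zeroʳ _)))) -0#≈0#))))
          (trans (cross-anti (vec q k) (vec q x)) (trans (-‿cong e) -0#≈0#)))

        Before After : Item Label → Set _
        Before a = Pos (cross (ray q a) (vec q x))
        After  a = Pos (cross (vec q x) (ray q a))

        -- Letters of the sign of `x` carry no order relative to it. Their order relative to `y` is
        -- used instead and transported along the common line of `x` and `y`.
        before-u : ∀ k → x ≢ k → y ≢ k → InOrder q (u k) (l y) → Before (u k)
        before-u k x≢k y≢k h = NN-cancel (proj₂ split-ahead) (NN-resp
            (trans (*-congˡ (trans (cross-negʳ (vec q k) (vec q y)) (cross-anti (vec q y) (vec q k))))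
              (trans (solve 2 (λ t k → t :* :- k := :- (t :* k)) refl _ _) (trans (-‿cong (balanced-cross between′ (vec q k)))
                (trans (solve 2 (λ t k → :- (t :* k) := t :* :- k) refl _ _) (*-congˡ (sym (cross-anti (vec q k) (vec q x))))))))
            (NN-* (proj₁ (proj₁ split-ahead)) (h tt))) ,
          λ e → nonzero k x≢k y≢k (trans (cross-anti (vec q x) (vec q k)) (trans (-‿cong e) -0#≈0#))

        before-l : ∀ k → x ≢ k → y ≢ k → InOrder q (l k) (u x) → Before (l k)
        before-l k x≢k y≢k h = h tt , λ e → nonzero k x≢k y≢k (trans (sym (cross-negˡ (vec q k) (vec q x))) e)

        after-u : ∀ k → x ≢ k → y ≢ k → InOrder q (l y) (u k) → After (u k)
        after-u k x≢k y≢k h = NN-cancel (proj₂ split-ahead) (NN-resp (trans (*-congˡ (cross-negˡ (vec q y) (vec q k))) (balanced-cross between′ (vec q k)))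
            (NN-* (proj₁ (proj₁ split-ahead)) (h tt))) , nonzero k x≢k y≢k

        after-l : ∀ k → x ≢ k → y ≢ k → InOrder q (u x) (l k) → After (l k)
        after-l k x≢k y≢k h = h tt , λ e → nonzero k x≢k y≢k (trans (cross-anti (vec q x) (vec q k))
            (trans (-‿cong (trans (sym (cross-negʳ (vec q x) (vec q k))) e)) -0#≈0#))

        -- Between `x` and `y` a letter is ordered only against the one of opposite sign: an upper
        -- letter precedes `y`, hence the common line, while a lower letter follows `x`, hence the
        -- common line.
        Middle : Item Label → Set _
        Middle (u k) = Before (u k)
        Middle (l k) = After (l k)

        ordered₂ : Ordered′ q (α ++ u x ∷ β ++ l y ∷ γ)
        ordered₂ = ≡.subst (Ordered′ q) w≡ ordered₁

        around-x : All (λ a → InOrder q a (u x)) α × All (InOrder q (u x)) (β ++ l y ∷ γ)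
        around-x = AllPairs-middle α ordered₂

        around-y : All (λ a → InOrder q a (l y)) (α ++ u x ∷ β) × All (InOrder q (l y)) γ
        around-y = AllPairs-middle (α ++ u x ∷ β) (≡.subst (Ordered′ q) (≡.sym (++-assoc α (u x ∷ β) (l y ∷ γ))) ordered₂)

        α-before : All Before α
        α-before = go α (proj₁ x≢) (All.++⁻ˡ α (proj₁ y≢)) (proj₁ around-x) (All.++⁻ˡ α (proj₁ around-y))
          where
          go : ∀ α → All (λ a → label a ≢ x) α → All (λ a → label a ≢ y) α → All (λ a → InOrder q a (u x)) α → All (λ a → InOrder q a (l y)) α → All Before α
          go [] [] [] [] [] = []
          go (u k ∷ α) (m ∷ ms) (n ∷ ns) (_ ∷ os) (o ∷ ps) = before-u k (m ∘ ≡.sym) (n ∘ ≡.sym) o ∷ go α ms ns os ps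
          go (l k ∷ α) (m ∷ ms) (n ∷ ns) (o ∷ os) (_ ∷ ps) = before-l k (m ∘ ≡.sym) (n ∘ ≡.sym) o ∷ go α ms ns os ps

        γ-after : All After γ
        γ-after = go γ (All.tail (All.++⁻ʳ β (proj₂ x≢))) (proj₂ y≢) (All.tail (All.++⁻ʳ β (proj₂ around-x))) (proj₂ around-y)
          where
          go : ∀ γ → All (λ a → x ≢ label a) γ → All (λ a → y ≢ label a) γ → All (InOrder q (u x)) γ → All (InOrder q (l y)) γ → All After γ
          go [] [] [] [] [] = []
          go (u k ∷ γ) (m ∷ ms) (n ∷ ns) (_ ∷ os) (o ∷ ps) = after-u k m n o ∷ go γ ms ns os ps
          go (l k ∷ γ) (m ∷ ms) (n ∷ ns) (o ∷ os) (_ ∷ ps) = after-l k m n o ∷ go γ ms ns os ps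

        β-middle : All Middle β
        β-middle = go β (All.++⁻ˡ β (proj₂ x≢)) (All.tail (All.++⁻ʳ α (proj₁ y≢))) (All.++⁻ˡ β (proj₂ around-x)) (All.tail (All.++⁻ʳ α (proj₁ around-y)))
          where
          go : ∀ β → All (λ a → x ≢ label a) β → All (λ a → label a ≢ y) β → All (InOrder q (u x)) β → All (λ a → InOrder q a (l y)) β → All Middle β
          go [] [] [] [] [] = []
          go (u k ∷ β) (m ∷ ms) (n ∷ ns) (_ ∷ os) (o ∷ ps) = before-u k m (n ∘ ≡.sym) o ∷ go β ms ns os ps
          go (l k ∷ β) (m ∷ ms) (n ∷ ns) (o ∷ os) (_ ∷ ps) = after-l k m (n ∘ ≡.sym) o ∷ go β ms ns os ps

        β-ahead : All (λ a → Pos (cross (vec q f) (ray q a))) β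
        β-ahead = All.++⁻ˡ β (All.tail (All.++⁻ʳ α ahead₂))

        β-ordered : Ordered′ q β
        β-ordered = proj₁ (AllPairs-++⁻ β (AllPairs.tail (proj₁ (proj₂ (AllPairs-++⁻ α ordered₂)))))

        -- Upper rays in `β` precede the line of `x` and lower rays follow it, so a lower letter in
        -- front of an upper one would contradict the order of the word. Hence `β` is a `u`-run
        -- followed by an `l`-run.
        β-lower : ∀ k β → Pos (cross (vec q f) (ray q (l k))) → After (l k) → All (λ a → Pos (cross (vec q f) (ray q a))) β → All Middle β → All (InOrder q (l k)) β → ∃[ β₂ ] β ≡ map l β₂
        β-lower k [] hk ak [] [] [] = [] , ≡.refl
        β-lower k (l j ∷ β) hk ak (_ ∷ hs) (_ ∷ ms) (_ ∷ os) = Σ.map (j ∷_) (≡.cong (l j ∷_)) (β-lower k β hk ak hs ms os)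
        β-lower k (u j ∷ β) hk ak (hj ∷ _) (mj ∷ _) (oj ∷ _) = ⊥-elim (Pos-contra
          (cross-trans (vec q f) (vec q j) (vec q x) (ray q (l k)) hj (proj₁ split-ahead) hk mj ak)
          (NN-resp (cross-anti (ray q (l k)) (vec q j)) (oj tt)))

        β-split : ∀ β → All (λ a → Pos (cross (vec q f) (ray q a))) β → All Middle β → Ordered′ q β → ∃[ β₁ ] ∃[ β₂ ] β ≡ map u β₁ ++ map l β₂
        β-split [] [] [] [] = [] , [] , ≡.refl
        β-split (u k ∷ β) (_ ∷ hs) (_ ∷ ms) (_ ∷ os) = Σ.map (k ∷_) (λ (β₂ , e) → β₂ , ≡.cong (u k ∷_) e) (β-split β hs ms os)
        β-split (l k ∷ β) (hk ∷ hs) (mk ∷ ms) (ok ∷ os) = [] , Σ.map (k ∷_) (≡.cong (l k ∷_)) (β-lower k β hk mk hs ms ok)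

        between₁ : Balanced (s + t * τ) (t * (1# + - τ)) (vec q f) (vec q b)
        between₁ = trans (+-cong (*-congˡ (proj₁ (vec-move p τ d f))) (*-congˡ (proj₁ (vec-move p τ d b))))
                     (trans (expand (proj₁ d) (proj₁ (vec p b))) (trans (*-congˡ (proj₁ between)) (zeroʳ _))) ,
                   trans (+-cong (*-congˡ (proj₂ (vec-move p τ d f))) (*-congˡ (proj₂ (vec-move p τ d b))))
                     (trans (expand (proj₂ d) (proj₂ (vec p b))) (trans (*-congˡ (proj₂ between)) (zeroʳ _)))
          where
          expand : ∀ d e → (s + t * τ) * (d + - (τ * d)) + t * (1# + - τ) * (e + - (τ * d)) ≈ (1# + - τ) * (s * d + t * e)
          expand d e = trans (+-congʳ (*-congˡ (trans (+-congʳ (sym (*-identityˡ d))) refl)))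
            (trans (solve 6 (λ o s t k d e → (s :+ t :* k) :* (o :* d :+ :- (k :* d)) :+ t :* (o :+ :- k) :* (e :+ :- (k :* d))
               := (o :+ :- k) :* (s :* d :+ t :* e)) refl 1# s t τ d e) refl)

        -- The crossing is not at the end `b`: otherwise `τ` and `s` both vanish, `p` is `b`, and
        -- the tie puts `b` on the line of `x` and `y`.
        s₁>0 : Pos (s + t * τ)
        s₁>0 = NN-+ s≥0 (NN-* (proj₁ t>0) τ≥0) , λ e → b-collinear (noZeroDivisors (proj₂ t>0) (second e)) (first′ e)
          where
          first′ : s + t * τ ≈ 0# → s ≈ 0#
          first′ e = NN-antisym s≥0 (NN-resp (trans (solve 2 (λ s r → r := (s :+ r) :+ :- s) refl s (t * τ)) (trans (+-congʳ e) (+-identityˡ _))) (NN-* (proj₁ t>0) τ≥0))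
          second : s + t * τ ≈ 0# → t * τ ≈ 0#
          second e = trans (solve 2 (λ s r → r := (s :+ r) :+ :- s) refl s (t * τ)) (trans (+-cong e (trans (-‿cong (first′ e)) -0#≈0#)) (+-identityˡ _))
          b≢ : All (λ a → b ≢ label a) (α ++ u x ∷ β ++ l y ∷ γ)
          b≢ = All.map⁻ (≡.subst (λ w → All (b ≢_) (map label w)) w≡ (AllPairs.head (AllPairs.tail (unique labels))))
          b-collinear : τ ≈ 0# → s ≈ 0# → ⊥
          b-collinear τ≈0 s≈0 = general b x y (All-middle α b≢) (All-middle β (All.tail (All.++⁻ʳ α b≢))) x≢y (collinear p b x y (zero-cross (vec p x)) (trans (cross-anti (vec p x) (vec p y))
                    (trans (-‿cong (trans (sym (cross-negʳ (vec p x) (vec p y))) (trans (sym gτ) (trans (*-congˡ τ≈0) (zeroʳ _))))) -0#≈0#))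
                    (trans (cross-anti (vec p y) (vec p b)) (trans (-‿cong (zero-cross (vec p y))) -0#≈0#)))
            where
            zero-vec₁ : proj₁ (vec p b) ≈ 0#
            zero-vec₁ = noZeroDivisors (proj₂ t>0) (trans (sym (+-identityˡ _)) (trans (+-congʳ (sym (trans (*-congʳ s≈0) (zeroˡ _)))) (proj₁ between)))
            zero-vec₂ : proj₂ (vec p b) ≈ 0#
            zero-vec₂ = noZeroDivisors (proj₂ t>0) (trans (sym (+-identityˡ _)) (trans (+-congʳ (sym (trans (*-congʳ s≈0) (zeroˡ _)))) (proj₂ between)))
            zero-cross : ∀ a → cross (vec p b) a ≈ 0#
            zero-cross = cross-zeroˡ (vec p b) (zero-vec₁ , zero-vec₂)

        build : ∃[ β₁ ] ∃[ β₂ ] β ≡ map u β₁ ++ map l β₂ → Crossing f b w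
        build (β₁ , β₂ , ≡.refl) = record
          { α = α ; β₁ = β₁ ; β₂ = β₂ ; γ = γ
          ; split = ≡.trans w≡ (≡.cong (λ v → α ++ u x ∷ v) (++-assoc (map u β₁) (map l β₂) (l y ∷ γ)))
          ; vertex = record
            { s>0 = s₁>0 ; t>0 = Pos-* t>0 1-τ>0 ; s′>0 = proj₂ split-ahead ; t′>0 = proj₁ split-ahead
            ; between = between₁ ; between′ = between′ ; upper = proj₁ split-ahead
            ; before = All.zip (All.++⁺ (All.++⁻ˡ α ahead₂) (All.++⁻ˡ (map u β₁) β-ahead) , All.++⁺ α-before (middle-u β₁ (All.++⁻ˡ (map u β₁) β-middle)))
            ; after  = All.zip (All.++⁺ (All.++⁻ʳ (map u β₁) β-ahead) (All.tail (All.++⁻ʳ (map u β₁ ++ map l β₂) (All.tail (All.++⁻ʳ α ahead₂)))) ,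
                         All.++⁺ (middle-l β₂ (All.++⁻ʳ (map u β₁) β-middle)) γ-after)
            ; pre-ordered  = proj₁ (AllPairs-++⁻ (α ++ map u β₁) rest-ordered)
            ; post-ordered = proj₁ (proj₂ (AllPairs-++⁻ (α ++ map u β₁) rest-ordered))
            ; labels = ↭-trans (prep f (prep b (↭-trans (↭.map⁺ label (↭-sym reorder)) (↭-reflexive (≡.cong (map label) (≡.sym w≡)))))) labels } }
          where
          middle-u : ∀ ks → All Middle (map u ks) → All Before (map u ks)
          middle-u [] [] = []
          middle-u (k ∷ ks) (m ∷ ms) = m ∷ middle-u ks ms
          middle-l : ∀ ks → All Middle (map l ks) → All After (map l ks)
          middle-l [] [] = []
          middle-l (k ∷ ks) (m ∷ ms) = m ∷ middle-l ks ms
          regroup : (α ++ (map u β₁ ++ map l β₂)) ++ γ ≡ (α ++ map u β₁) ++ (map l β₂ ++ γ)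
          regroup = ≡.trans (≡.cong (_++ γ) (≡.sym (++-assoc α (map u β₁) (map l β₂)))) (++-assoc (α ++ map u β₁) (map l β₂) γ)
          rest-ordered : Ordered′ q ((α ++ map u β₁) ++ (map l β₂ ++ γ))
          rest-ordered = ≡.subst (Ordered′ q) regroup (AllPairs-remove (α ++ (map u β₁ ++ map l β₂))
            (≡.subst (Ordered′ q) (≡.sym (++-assoc α (map u β₁ ++ map l β₂) (l y ∷ γ))) (AllPairs-remove α ordered₂)))
          reorder : α ++ u x ∷ (map u β₁ ++ map l β₂) ++ l y ∷ γ ↭ u x ∷ l y ∷ (α ++ map u β₁) ++ (map l β₂ ++ γ)
          reorder = ↭-trans (↭.shift (u x) α _) (prep (u x) (↭-trans (↭-reflexive (≡.sym (++-assoc α (map u β₁ ++ map l β₂) (l y ∷ γ))))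
            (↭-trans (↭.shift (l y) (α ++ (map u β₁ ++ map l β₂)) γ) (prep (l y) (↭-reflexive regroup)))))

        crossing : Crossing f b w
        crossing = build (β-split β β-ahead β-middle β-ordered)

      slide : XState f (l b) w ⊎ Crossing f b w
      slide with Minimum.minimum (reach p) gain (crossings w) gains
      ... | inj₁ all = inj₁ (arrive all)
      ... | inj₂ ((x , y) , xy∈ , early , first) with crossings-split w xy∈ | Pos-inverse (All.lookup gains xy∈)
      ...   | α , β , γ , w≡ | z , z>0 , gz = inj₂ (Meet.crossing α β γ w≡ g>0 first (reach p (x , y) * z) (NN-* reach≥0 (proj₁ z>0)) gτ 1-τ>0)
        where
        g>0 : Pos (gain (x , y))
        g>0 = All.lookup gains xy∈

        gτ : gain (x , y) * (reach p (x , y) * z) ≈ reach p (x , y)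
        gτ = trans (solve 3 (λ g r z → g :* (r :* z) := r :* (g :* z)) refl (gain (x , y)) (reach p (x , y)) z) (trans (*-congˡ gz) (*-identityʳ _))

        reach≥0 : NN (reach p (x , y))
        reach≥0 with AllPairs-middle α (≡.subst (Ordered′ p) w≡ ordered)
        ... | _ , h with All.++⁻ʳ β h
        ...   | hy ∷ _ = hy tt

        1-τ>0 : Pos (1# + - (reach p (x , y) * z))
        1-τ>0 = Pos-cancel g>0 (Pos-resp (sym (trans (distribˡ _ _ _) (+-cong (*-identityʳ _)
                  (trans (solve 2 (λ g t → g :* :- t := :- (g :* t)) refl (gain (x , y)) (reach p (x , y) * z)) (-‿cong gτ))))) early)


-- Words up to order within runs, and completeness of the list of events.

module Runs where
  open OrderedField
  open Separation
  open Search
  open import Data.Nat.Base using (ℕ)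
  open import Data.Fin.Base using (zero; suc)
  open import Data.List.Base using (List; []; _∷_; _++_; map)
  open import Data.List.Properties using (++-assoc; map-++)
  open import Data.List.Relation.Unary.All using ([]; _∷_)
  open import Data.List.Relation.Unary.Any using (here; there)
  open import Data.List.Relation.Unary.AllPairs using ([]; _∷_)
  open import Data.List.Relation.Binary.Permutation.Propositional using (_↭_; prep; swap; ↭-refl; ↭-sym; ↭-trans)
  import Data.List.Relation.Binary.Permutation.Propositional.Properties as ↭
  open import Data.List.Membership.Propositional using (_∈_)
  import Data.List.Membership.Propositional.Properties as ∈
  open import Data.Product.Base using (_×_; _,_; proj₁; proj₂; ∃-syntax)
  open import Data.Sum.Base using (_⊎_; inj₁; inj₂)
  open import Relation.Nullary using (contradiction)
  open import Relation.Binary.PropositionalEquality as ≡ using (_≡_; _≢_)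
  open Plane
  open States
  open import Data.Bool.Base using (true; false; _∧_; _∨_)
  open import Data.Nat.Base using (zero; suc; _≡ᵇ_)
  import Data.Nat.Properties as ℕ
  open import Relation.Nullary using (yes; no)

  mapᵢ : ∀ {A B : Set} → (A → B) → Item A → Item B
  mapᵢ g (u x) = u (g x)
  mapᵢ g (l x) = l (g x)

  mapʷ : ∀ {A B : Set} → (A → B) → Word A → Word B
  mapʷ g = map (mapᵢ g)

  mapʷ-flip : ∀ {A B : Set} (g : A → B) w → mapʷ g (flip w) ≡ flip (mapʷ g w)
  mapʷ-flip g []        = ≡.refl
  mapʷ-flip g (u x ∷ w) = ≡.cong (l (g x) ∷_) (mapʷ-flip g w)
  mapʷ-flip g (l x ∷ w) = ≡.cong (u (g x) ∷_) (mapʷ-flip g w)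

  mapʷ-u : ∀ {A B : Set} (g : A → B) xs → mapʷ g (map u xs) ≡ map u (map g xs)
  mapʷ-u g []       = ≡.refl
  mapʷ-u g (x ∷ xs) = ≡.cong (u (g x) ∷_) (mapʷ-u g xs)

  mapʷ-l : ∀ {A B : Set} (g : A → B) xs → mapʷ g (map l xs) ≡ map l (map g xs)
  mapʷ-l g []       = ≡.refl
  mapʷ-l g (x ∷ xs) = ≡.cong (l (g x) ∷_) (mapʷ-l g xs)

  flip-flip : ∀ {A : Set} (w : Word A) → flip (flip w) ≡ w
  flip-flip []        = ≡.refl
  flip-flip (u x ∷ w) = ≡.cong (u x ∷_) (flip-flip w)
  flip-flip (l x ∷ w) = ≡.cong (l x ∷_) (flip-flip w)

  -- Equality of words up to reordering within the runs of equal sign.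
  infix 4 _~_
  data _~_ {A : Set} : Word A → Word A → Set where
    ~refl  : ∀ {v} → v ~ v
    prep  : ∀ a {v w} → v ~ w → a ∷ v ~ a ∷ w
    swapU : ∀ x y {v} → u x ∷ u y ∷ v ~ u y ∷ u x ∷ v
    swapL : ∀ x y {v} → l x ∷ l y ∷ v ~ l y ∷ l x ∷ v
    ~trans : ∀ {v w z} → v ~ w → w ~ z → v ~ z

  ~-reflexive : ∀ {A : Set} {v w : Word A} → v ≡ w → v ~ w
  ~-reflexive ≡.refl = ~refl

  ~-sym : ∀ {A : Set} {v w : Word A} → v ~ w → w ~ v
  ~-sym ~refl        = ~refl
  ~-sym (prep a e)  = prep a (~-sym e)
  ~-sym (swapU x y) = swapU y x
  ~-sym (swapL x y) = swapL y x
  ~-sym (~trans e f) = ~trans (~-sym f) (~-sym e)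

  ~⇒↭ : ∀ {A : Set} {v w : Word A} → v ~ w → v ↭ w
  ~⇒↭ ~refl        = ↭-refl
  ~⇒↭ (prep a e)  = _↭_.prep a (~⇒↭ e)
  ~⇒↭ (swapU x y) = _↭_.swap (u x) (u y) ↭-refl
  ~⇒↭ (swapL x y) = _↭_.swap (l x) (l y) ↭-refl
  ~⇒↭ (~trans e f) = ↭-trans (~⇒↭ e) (~⇒↭ f)

  ~-++ˡ : ∀ {A : Set} (v : Word A) {w z} → w ~ z → v ++ w ~ v ++ z
  ~-++ˡ []      e = e
  ~-++ˡ (a ∷ v) e = prep a (~-++ˡ v e)

  ~-++ʳ : ∀ {A : Set} {v w : Word A} z → v ~ w → v ++ z ~ w ++ z
  ~-++ʳ z ~refl        = ~refl
  ~-++ʳ z (prep a e)  = prep a (~-++ʳ z e)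
  ~-++ʳ z (swapU x y) = swapU x y
  ~-++ʳ z (swapL x y) = swapL x y
  ~-++ʳ z (~trans e f) = ~trans (~-++ʳ z e) (~-++ʳ z f)

  ~-++ : ∀ {A : Set} {v v′ w w′ : Word A} → v ~ v′ → w ~ w′ → v ++ w ~ v′ ++ w′
  ~-++ {v′ = v′} {w = w} e f = ~trans (~-++ʳ w e) (~-++ˡ v′ f)

  ↭⇒~u : ∀ {A : Set} {xs ys : List A} → xs ↭ ys → map u xs ~ map u ys
  ↭⇒~u _↭_.refl         = ~refl
  ↭⇒~u (_↭_.prep x e)   = prep (u x) (↭⇒~u e)
  ↭⇒~u (_↭_.swap x y e) = ~trans (prep (u x) (prep (u y) (↭⇒~u e))) (swapU x y)
  ↭⇒~u (_↭_.trans e f)  = ~trans (↭⇒~u e) (↭⇒~u f)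

  ↭⇒~l : ∀ {A : Set} {xs ys : List A} → xs ↭ ys → map l xs ~ map l ys
  ↭⇒~l _↭_.refl         = ~refl
  ↭⇒~l (_↭_.prep x e)   = prep (l x) (↭⇒~l e)
  ↭⇒~l (_↭_.swap x y e) = ~trans (prep (l x) (prep (l y) (↭⇒~l e))) (swapL x y)
  ↭⇒~l (_↭_.trans e f)  = ~trans (↭⇒~l e) (↭⇒~l f)

  -- Reorderings of a word of colours lift to the word of labels beneath it, so an event listed by
  -- the search can be matched with an actual crossing.
  ~-map-inv : ∀ {A B : Set} (g : A → B) {v w} → v ~ w → ∀ s → w ≡ mapʷ g s → ∃[ s′ ] (v ≡ mapʷ g s′ × s′ ~ s)
  ~-map-inv g ~refl s e = s , e , ~refl
  ~-map-inv g (prep a r) (b ∷ s) ≡.refl with ~-map-inv g r s ≡.refl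
  ... | s′ , ≡.refl , r′ = b ∷ s′ , ≡.refl , prep b r′
  ~-map-inv g (swapU x y) (u a ∷ u b ∷ s) ≡.refl = u b ∷ u a ∷ s , ≡.refl , swapU b a
  ~-map-inv g (swapL x y) (l a ∷ l b ∷ s) ≡.refl = l b ∷ l a ∷ s , ≡.refl , swapL b a
  ~-map-inv g (~trans r₁ r₂) s e with ~-map-inv g r₂ s e
  ... | s₁ , e₁ , q₁ with ~-map-inv g r₁ s₁ e₁
  ...   | s₂ , e₂ , q₂ = s₂ , e₂ , ~trans q₂ q₁

  ~-map⁺ : ∀ {A B : Set} (g : A → B) {v w} → v ~ w → mapʷ g v ~ mapʷ g w
  ~-map⁺ g ~refl        = ~refl
  ~-map⁺ g (prep a e)  = prep (mapᵢ g a) (~-map⁺ g e)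
  ~-map⁺ g (swapU x y) = swapU (g x) (g y)
  ~-map⁺ g (swapL x y) = swapL (g x) (g y)
  ~-map⁺ g (~trans e f) = ~trans (~-map⁺ g e) (~-map⁺ g f)

  ~-spanU : ∀ {A : Set} {v w : Word A} → v ~ w → spanU v ↭ spanU w × dropU v ~ dropU w
  ~-spanU ~refl = ↭-refl , ~refl
  ~-spanU (prep (u x) e) = _↭_.prep x (proj₁ (~-spanU e)) , proj₂ (~-spanU e)
  ~-spanU (prep (l x) e) = ↭-refl , prep (l x) e
  ~-spanU (swapU x y) = _↭_.swap x y ↭-refl , ~refl
  ~-spanU (swapL x y) = ↭-refl , swapL x y
  ~-spanU (~trans e f) = ↭-trans (proj₁ (~-spanU e)) (proj₁ (~-spanU f)) , ~trans (proj₂ (~-spanU e)) (proj₂ (~-spanU f))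

  ~-spanL : ∀ {A : Set} {v w : Word A} → v ~ w → spanL v ↭ spanL w × dropL v ~ dropL w
  ~-spanL ~refl = ↭-refl , ~refl
  ~-spanL (prep (l x) e) = _↭_.prep x (proj₁ (~-spanL e)) , proj₂ (~-spanL e)
  ~-spanL (prep (u x) e) = ↭-refl , prep (u x) e
  ~-spanL (swapL x y) = _↭_.swap x y ↭-refl , ~refl
  ~-spanL (swapU x y) = ↭-refl , swapU x y
  ~-spanL (~trans e f) = ↭-trans (proj₁ (~-spanL e)) (proj₁ (~-spanL f)) , ~trans (proj₂ (~-spanL e)) (proj₂ (~-spanL f))

  span-dropU : ∀ {A : Set} (w : Word A) → w ≡ map u (spanU w) ++ dropU w
  span-dropU []        = ≡.refl
  span-dropU (u x ∷ w) = ≡.cong (u x ∷_) (span-dropU w)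
  span-dropU (l x ∷ w) = ≡.refl

  span-dropL : ∀ {A : Set} (w : Word A) → w ≡ map l (spanL w) ++ dropL w
  span-dropL []        = ≡.refl
  span-dropL (l x ∷ w) = ≡.cong (l x ∷_) (span-dropL w)
  span-dropL (u x ∷ w) = ≡.refl

  mapʷ-spanU : ∀ {A B : Set} (g : A → B) w → spanU (mapʷ g w) ≡ map g (spanU w) × dropU (mapʷ g w) ≡ mapʷ g (dropU w)
  mapʷ-spanU g []        = ≡.refl , ≡.refl
  mapʷ-spanU g (u x ∷ w) = ≡.cong (g x ∷_) (proj₁ (mapʷ-spanU g w)) , proj₂ (mapʷ-spanU g w)
  mapʷ-spanU g (l x ∷ w) = ≡.refl , ≡.refl

  mapʷ-spanL : ∀ {A B : Set} (g : A → B) w → spanL (mapʷ g w) ≡ map g (spanL w) × dropL (mapʷ g w) ≡ mapʷ g (dropL w)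
  mapʷ-spanL g []        = ≡.refl , ≡.refl
  mapʷ-spanL g (l x ∷ w) = ≡.cong (g x ∷_) (proj₁ (mapʷ-spanL g w)) , proj₂ (mapʷ-spanL g w)
  mapʷ-spanL g (u x ∷ w) = ≡.refl , ≡.refl

  ∧-split : ∀ {a b} → a ∧ b ≡ true → a ≡ true × b ≡ true
  ∧-split {true} e = ≡.refl , e

  ∨-split : ∀ {a b} → a ∨ b ≡ true → a ≡ true ⊎ b ≡ true
  ∨-split {true}  e = inj₁ ≡.refl
  ∨-split {false} e = inj₂ e

  ≡ᵇ-refl : ∀ n → (n ≡ᵇ n) ≡ true
  ≡ᵇ-refl zero    = ≡.refl
  ≡ᵇ-refl (suc n) = ≡ᵇ-refl n

  ≡ᵇ-true : ∀ m n → (m ≡ᵇ n) ≡ true → m ≡ n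
  ≡ᵇ-true zero    zero    e = ≡.refl
  ≡ᵇ-true (suc m) (suc n) e = ≡.cong suc (≡ᵇ-true m n e)

  ≡ᵇ-false : ∀ {m n} → m ≢ n → (m ≡ᵇ n) ≡ false
  ≡ᵇ-false {m} {n} m≢n with m ≡ᵇ n in e
  ... | true  = contradiction (≡ᵇ-true m n e) m≢n
  ... | false = ≡.refl

  -- Only the first occurrence of each value is listed, so the remainder is determined merely up to
  -- permutation.
  picks-complete : ∀ {c} seen xs → c ∈ xs → member c seen ≡ false → ∃[ rest ] ((c , rest) ∈ picks seen xs × c ∷ rest ↭ seen ++ xs)
  picks-complete {c} seen (x ∷ xs) c∈ new with c ℕ.≟ x
  ... | yes ≡.refl rewrite new = seen ++ xs , here ≡.refl , ↭-sym (↭.shift c seen xs)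
  ... | no c≢x with c∈
  ...   | here c≡x = contradiction c≡x c≢x
  ...   | there c∈′ with picks-complete (x ∷ seen) xs c∈′ (≡.trans (≡.cong (_∨ member c seen) (≡ᵇ-false c≢x)) new)
  ...     | rest , r∈ , e with member x seen
  ...       | true  = rest , r∈ , ↭-trans e (↭-sym (↭.shift x seen xs))
  ...       | false = rest , there r∈ , ↭-trans e (↭-sym (↭.shift x seen xs))

  emit₁-∈ : ∀ {pre c us w d ls} qs es → (d , ls) ∈ qs → event (pre ++ map u us) c d (map l ls ++ w) ∈ emit₁ pre c us w qs es
  emit₁-∈ (_ ∷ qs) es (here ≡.refl) = here ≡.refl
  emit₁-∈ (_ ∷ qs) es (there p)     = there (emit₁-∈ qs es p)

  emit₁-⊇ : ∀ {pre c us w e} qs es → e ∈ es → e ∈ emit₁ pre c us w qs es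
  emit₁-⊇ []       es p = p
  emit₁-⊇ (_ ∷ qs) es p = there (emit₁-⊇ qs es p)

  emit-∈ : ∀ {pre c us w d ls} ps qs es → (c , us) ∈ ps → (d , ls) ∈ qs → event (pre ++ map u us) c d (map l ls ++ w) ∈ emit pre ps qs w es
  emit-∈ (_ ∷ ps) qs es (here ≡.refl) q = emit₁-∈ qs _ q
  emit-∈ {pre} (_ ∷ ps) qs es (there p) q = emit₁-⊇ qs _ (emit-∈ ps qs es p q)

  emit-⊇ : ∀ {pre w e} ps qs es → e ∈ es → e ∈ emit pre ps qs w es
  emit-⊇ []       qs es p = p
  emit-⊇ (_ ∷ ps) qs es p = emit₁-⊇ qs _ (emit-⊇ ps qs es p)

  -- The search lists each crossing only up to the order within runs.
  Found : Word ℕ → ℕ → ℕ → Word ℕ → List (Event ℕ) → Set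
  Found pre c d post es = ∃[ pre′ ] ∃[ post′ ] (event pre′ c d post′ ∈ es × pre′ ~ pre × post′ ~ post)

  found-emit : ∀ pre us₁ c us₂ ls₁ d ls₂ w es →
    Found (pre ++ map u (us₁ ++ us₂)) c d (map l (ls₁ ++ ls₂) ++ w) (emit pre (picks [] (us₁ ++ c ∷ us₂)) (picks [] (ls₁ ++ d ∷ ls₂)) w es)
  found-emit pre us₁ c us₂ ls₁ d ls₂ w es
    with picks-complete [] (us₁ ++ c ∷ us₂) (∈.∈-insert us₁) ≡.refl | picks-complete [] (ls₁ ++ d ∷ ls₂) (∈.∈-insert ls₁) ≡.refl
  ... | us , u∈ , eu | ls , l∈ , el = _ , _ , emit-∈ _ _ es u∈ l∈ ,
        ~-++ˡ pre (↭⇒~u (↭.drop-∷ (↭-trans eu (↭.shift c us₁ us₂)))) , ~-++ʳ w (↭⇒~l (↭.drop-∷ (↭-trans el (↭.shift d ls₁ ls₂))))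

  found-weaken : ∀ {pre c d post es es′} → (∀ {e} → e ∈ es → e ∈ es′) → Found pre c d post es → Found pre c d post es′
  found-weaken f (pre′ , post′ , p , rest) = pre′ , post′ , f p , rest

  found-resp : ∀ {pre pre′ c d post post′ es} → pre ~ pre′ → post ~ post′ → Found pre c d post es → Found pre′ c d post′ es
  found-resp e f (p , q , r , s , t) = p , q , r , ~trans s e , ~trans t f

  map-∷ʳ-++ : ∀ {A B : Set} (f : A → B) xs x ys → map f (xs ++ x ∷ []) ++ ys ≡ map f xs ++ f x ∷ ys
  map-∷ʳ-++ f xs x ys = ≡.trans (≡.cong (_++ ys) (map-++ f xs (x ∷ []))) (++-assoc (map f xs) (f x ∷ []) ys)

  -- This lemma and the next three follow the scan by `events′` according to what it has read: past
  -- `d`, inside the lower run before `d`, inside the upper run after `c`, or not yet at `c`.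
  events-after : ∀ pre us₁ c us₂ ls₁ d ls₂ γ →
    Found (pre ++ map u (us₁ ++ us₂)) c d (map l (ls₁ ++ ls₂) ++ γ) (events′ pre (us₁ ++ c ∷ us₂) (ls₁ ++ d ∷ ls₂) γ)
  events-after pre us₁ c us₂ ls₁ d ls₂ [] = found-emit pre us₁ c us₂ ls₁ d ls₂ [] []
  events-after pre us₁ c us₂ ls₁ d ls₂ (l y ∷ γ) = ≡.subst (λ ls → Found _ c d _ (events′ pre _ ls γ)) (≡.sym (++-assoc ls₁ (d ∷ ls₂) (y ∷ [])))
    (found-resp ~refl (~-reflexive (≡.trans (≡.cong (λ ls → map l ls ++ γ) (≡.sym (++-assoc ls₁ ls₂ (y ∷ [])))) (map-∷ʳ-++ l (ls₁ ++ ls₂) y γ)))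
      (events-after pre us₁ c us₂ ls₁ d (ls₂ ++ y ∷ []) γ))
  events-after pre us₁ c us₂ [] d ls₂ (u x ∷ γ) = found-emit pre us₁ c us₂ [] d ls₂ (u x ∷ γ) _
  events-after pre us₁ c us₂ (z ∷ ls₁) d ls₂ (u x ∷ γ) = found-emit pre us₁ c us₂ (z ∷ ls₁) d ls₂ (u x ∷ γ) _

  events-lower : ∀ pre us₁ c us₂ ls₁ β₂ d γ →
    Found (pre ++ map u (us₁ ++ us₂)) c d (map l (ls₁ ++ β₂) ++ γ) (events′ pre (us₁ ++ c ∷ us₂) ls₁ (map l β₂ ++ l d ∷ γ))
  events-lower pre us₁ c us₂ ls₁ [] d γ = found-resp ~refl (~-reflexive ≡.refl) (events-after pre us₁ c us₂ ls₁ d [] γ)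
  events-lower pre us₁ c us₂ ls₁ (y ∷ β₂) d γ = found-resp ~refl (~-reflexive (≡.cong (λ ls → map l ls ++ γ) (++-assoc ls₁ (y ∷ []) β₂)))
    (events-lower pre us₁ c us₂ (ls₁ ++ y ∷ []) β₂ d γ)

  events-upper : ∀ pre us₁ c us₂ β₁ β₂ d γ →
    Found (pre ++ map u (us₁ ++ us₂ ++ β₁)) c d (map l β₂ ++ γ) (events′ pre (us₁ ++ c ∷ us₂) [] (map u β₁ ++ map l β₂ ++ l d ∷ γ))
  events-upper pre us₁ c us₂ [] β₂ d γ = found-resp (~-reflexive (≡.cong (λ us → pre ++ map u (us₁ ++ us)) (≡.sym (++-identityʳ us₂)))) ~refl
      (events-lower pre us₁ c us₂ [] β₂ d γ)
    where open import Data.List.Properties using (++-identityʳ)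
  events-upper pre us₁ c us₂ (x ∷ β₁) β₂ d γ = ≡.subst (λ us → Found _ c d _ (events′ pre us [] (map u β₁ ++ map l β₂ ++ l d ∷ γ))) (≡.sym (++-assoc us₁ (c ∷ us₂) (x ∷ [])))
    (found-resp (~-reflexive (≡.cong (λ us → pre ++ map u (us₁ ++ us)) (++-assoc us₂ (x ∷ []) β₁))) ~refl
      (events-upper pre us₁ c (us₂ ++ x ∷ []) β₁ β₂ d γ))

  events-before : ∀ pre us ls α c β₁ β₂ d γ →
    Found ((pre ++ map u us ++ map l ls) ++ α ++ map u β₁) c d (map l β₂ ++ γ) (events′ pre us ls (α ++ u c ∷ map u β₁ ++ map l β₂ ++ l d ∷ γ))
  events-before pre us [] [] c β₁ β₂ d γ = found-resp (~-reflexive (shape us)) ~refl (events-upper pre us c [] β₁ β₂ d γ)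
    where
    shape : ∀ us → pre ++ map u (us ++ β₁) ≡ (pre ++ map u us ++ []) ++ map u β₁
    shape us = ≡.trans (≡.cong (pre ++_) (map-++ u us β₁)) (≡.trans (≡.sym (++-assoc pre (map u us) (map u β₁)))
      (≡.cong (λ w → (pre ++ w) ++ map u β₁) (≡.sym (++-identityʳ (map u us)))))
      where open import Data.List.Properties using (++-identityʳ)
  events-before pre us (z ∷ ls) [] c β₁ β₂ d γ = found-weaken (emit-⊇ (picks [] us) (picks [] (z ∷ ls)) _)
    (events-upper (pre ++ map u us ++ map l (z ∷ ls)) [] c [] β₁ β₂ d γ)
  events-before pre us ls (l y ∷ α) c β₁ β₂ d γ = found-resp (~-reflexive (shape us ls)) ~refl (events-before pre us (ls ++ y ∷ []) α c β₁ β₂ d γ)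
    where
    shape : ∀ us ls → (pre ++ map u us ++ map l (ls ++ y ∷ [])) ++ α ++ map u β₁ ≡ (pre ++ map u us ++ map l ls) ++ l y ∷ α ++ map u β₁
    shape us ls = ≡.trans (≡.cong (λ w → (pre ++ map u us ++ w) ++ α ++ map u β₁) (map-++ l ls (y ∷ [])))
      (≡.trans (≡.cong (_++ α ++ map u β₁) (≡.trans (≡.cong (pre ++_) (≡.sym (++-assoc (map u us) (map l ls) (l y ∷ [])))) (≡.sym (++-assoc pre (map u us ++ map l ls) (l y ∷ [])))))
        (++-assoc (pre ++ map u us ++ map l ls) (l y ∷ []) (α ++ map u β₁)))
  events-before pre us [] (u x ∷ α) c β₁ β₂ d γ = found-resp (~-reflexive (shape us)) ~refl (events-before pre (us ++ x ∷ []) [] α c β₁ β₂ d γ)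
    where
    open import Data.List.Properties using (++-identityʳ)
    shape : ∀ us → (pre ++ map u (us ++ x ∷ []) ++ []) ++ α ++ map u β₁ ≡ (pre ++ map u us ++ []) ++ u x ∷ α ++ map u β₁
    shape us = ≡.trans (≡.cong (λ w → (pre ++ w) ++ α ++ map u β₁) (≡.trans (++-identityʳ _) (map-++ u us (x ∷ []))))
      (≡.trans (≡.cong (_++ α ++ map u β₁) (≡.sym (++-assoc pre (map u us) (u x ∷ []))))
        (≡.trans (++-assoc (pre ++ map u us) (u x ∷ []) (α ++ map u β₁)) (≡.cong (λ w → (pre ++ w) ++ u x ∷ α ++ map u β₁) (≡.sym (++-identityʳ (map u us))))))
  events-before pre us (z ∷ ls) (u x ∷ α) c β₁ β₂ d γ = found-weaken (emit-⊇ (picks [] us) (picks [] (z ∷ ls)) _)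
    (found-resp (~-reflexive (++-assoc (pre ++ map u us ++ map l (z ∷ ls)) (u x ∷ []) (α ++ map u β₁))) ~refl
      (events-before (pre ++ map u us ++ map l (z ∷ ls)) (x ∷ []) [] α c β₁ β₂ d γ))

  events-complete : ∀ α c β₁ β₂ d γ → Found (α ++ map u β₁) c d (map l β₂ ++ γ) (events (α ++ u c ∷ map u β₁ ++ map l β₂ ++ l d ∷ γ))
  events-complete = events-before [] [] []

-- Turning about a point, and soundness of the game.

module Sweep where
  open OrderedField
  open Separation
  open Search
  open import Level using (_⊔_)
  open import Data.Nat.Base using (ℕ)
  open import Data.Fin.Base using (Fin; zero; suc)
  open import Data.List.Base using (List; []; _∷_; _++_; map; allFin)
  open import Data.List.Properties using (++-assoc; map-++)
  open import Data.List.Relation.Unary.All as All using (All; []; _∷_)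
  import Data.List.Relation.Unary.All.Properties as All
  open import Data.List.Relation.Unary.Any using (here; there)
  open import Data.List.Relation.Unary.AllPairs as AllPairs using (AllPairs; []; _∷_)
  import Data.List.Relation.Unary.AllPairs.Properties as AllPairs
  open import Data.List.Relation.Binary.Permutation.Propositional using (_↭_; prep; swap; ↭-refl; ↭-sym; ↭-trans; ↭-reflexive)
  import Data.List.Relation.Binary.Permutation.Propositional.Properties as ↭
  open import Data.List.Membership.Propositional using (_∈_)
  import Data.List.Membership.Propositional.Properties as ∈
  open import Data.Product.Base using (_×_; _,_; proj₁; proj₂; ∃-syntax)
  open import Data.Sum.Base using (_⊎_; inj₁; inj₂; [_,_]′)
  open import Data.Unit.Base using (tt)
  open import Data.Empty using (⊥-elim)
  open import Relation.Nullary using (¬_; contradiction)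
  open import Relation.Binary.PropositionalEquality as ≡ using (_≡_; _≢_)
  open Plane
  open States
  open Runs
  open import Data.Bool.Base using (Bool; true; _∨_)
  open import Data.Nat.Base using (zero; suc)

  module Rotations {c ℓ ℓ₂} (ℝ : RealField c ℓ ℓ₂) (X : Fin 10 → Geometry.Point ℝ) (general : Sums.General ℝ X) where
    open Vectors ℝ
    open States.States ℝ X general

    -- The swapped neighbours have equal sign, and `InOrder` is vacuous for them.
    ordered-~ : ∀ {p v w} → v ~ w → Ordered′ p v → Ordered′ p w
    ordered-~ ~refl o = o
    ordered-~ (prep a e) (h ∷ o) = ↭.All-resp-↭ (~⇒↭ e) h ∷ ordered-~ e o
    ordered-~ (swapU x y) ((_ ∷ hx) ∷ hy ∷ o) = ((λ ()) ∷ hy) ∷ hx ∷ o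
    ordered-~ (swapL x y) ((_ ∷ hx) ∷ hy ∷ o) = ((λ ()) ∷ hy) ∷ hx ∷ o
    ordered-~ (~trans e f) o = ordered-~ f (ordered-~ e o)

    flat-~ : ∀ {p f b v w} → v ~ w → Flat p f b v → Flat p f b w
    flat-~ {f = f} {b} e flat = record
      { s≥0 = s≥0 ; t>0 = t>0 ; between = between
      ; ahead = ↭.All-resp-↭ (~⇒↭ e) ahead
      ; ordered = ordered-~ e ordered
      ; labels = ↭-trans (_↭_.prep f (_↭_.prep b (↭.map⁺ label (↭-sym (~⇒↭ e))))) labels }
      where open Flat flat

    vertex-~ : ∀ {p f b pre pre′ x y post post′} → pre ~ pre′ → post ~ post′ → Vertex p f b pre x y post → Vertex p f b pre′ x y post′
    vertex-~ {f = f} {b} {x = x} {y} e e′ v = record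
      { s>0 = s>0 ; t>0 = t>0 ; s′>0 = s′>0 ; t′>0 = t′>0 ; between = between ; between′ = between′ ; upper = upper
      ; before = ↭.All-resp-↭ (~⇒↭ e) before
      ; after = ↭.All-resp-↭ (~⇒↭ e′) after
      ; pre-ordered = ordered-~ e pre-ordered
      ; post-ordered = ordered-~ e′ post-ordered
      ; labels = ↭-trans (_↭_.prep f (_↭_.prep b (_↭_.prep x (_↭_.prep y (↭.map⁺ label (↭-sym (~⇒↭ (~-++ e e′)))))))) labels }
      where open Vertex v

    Sorted : Label → Word Label → Set _
    Sorted q = AllPairs (λ a b → Pos (cross (ray (X q) a) (ray (X q) b)))

    -- Here the rays are strictly sorted within runs as well. Only then do all other rays lie on one
    -- side of the first one, as is needed for leaving towards it.
    record XFull (q : Label) (w : Word Label) : Set (c ⊔ ℓ ⊔ ℓ₂) where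
      field
        sorted : Sorted q w
        labels : q ∷ map label w ↭ allFin 10

    turn : ∀ {q a w} → XFull q (a ∷ w) → XFull q (w ++ flipᵢ a ∷ [])
    turn {q} {a} {w} s with XFull.sorted s
    ... | h ∷ o = record
      { sorted = AllPairs.++⁺ o ([] ∷ []) (All.map (λ {b} k → Pos-resp (sym (ray-flipʳ (X q) (ray (X q) b) a)) k ∷ []) h)
      ; labels = ↭-trans (_↭_.prep q (↭-trans (↭-reflexive (map-++ label w (flipᵢ a ∷ [])))
          (↭-trans (↭.++-comm (map label w) (label (flipᵢ a) ∷ [])) (↭-reflexive (≡.cong (_∷ map label w) (same a)))))) (XFull.labels s) }
      where
      same : ∀ a → label (flipᵢ a) ≡ label a
      same (u _) = ≡.refl
      same (l _) = ≡.refl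

    turnU : ∀ {q} us w → XFull q (map u us ++ w) → XFull q (w ++ map l us)
    turnU []       w s = ≡.subst (XFull _) (≡.sym (++-identityʳ w)) s
      where open import Data.List.Properties using (++-identityʳ)
    turnU (x ∷ us) w s = ≡.subst (XFull _) (++-assoc w (l x ∷ []) (map l us))
      (turnU us (w ++ l x ∷ []) (≡.subst (XFull _) (++-assoc (map u us) w (l x ∷ [])) (turn s)))

    turnL : ∀ {q} ls w → XFull q (map l ls ++ w) → XFull q (w ++ map u ls)
    turnL []       w s = ≡.subst (XFull _) (≡.sym (++-identityʳ w)) s
      where open import Data.List.Properties using (++-identityʳ)
    turnL (x ∷ ls) w s = ≡.subst (XFull _) (++-assoc w (u x ∷ []) (map u ls))
      (turnL ls (w ++ u x ∷ []) (≡.subst (XFull _) (++-assoc (map l ls) w (u x ∷ [])) (turn s)))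

    leave : ∀ {q x w} → XFull q (u x ∷ w) → Flat (X q) x q w
    leave {q} {x} {w} s with XFull.sorted s
    ... | h ∷ o = record
      { s≥0 = NN-0 ; t>0 = Pos-1
      ; between = trans (+-cong (zeroˡ _) (trans (*-identityˡ _) (-‿inverseʳ _))) (+-identityˡ _) ,
                  trans (+-cong (zeroˡ _) (trans (*-identityˡ _) (-‿inverseʳ _))) (+-identityˡ _)
      ; ahead = h
      ; ordered = AllPairs.map (λ k _ → proj₁ k) o
      ; labels = ↭-trans (_↭_.swap x q ↭-refl) (XFull.labels s) }

    module Sort (q : Label) (r : Point) where
      Left : Item Label → Set _
      Left a = Pos (cross r (ray (X q) a))

      compare : ∀ a b → label a ≢ label b → q ≢ label a → q ≢ label b →
                Pos (cross (ray (X q) a) (ray (X q) b)) ⊎ Pos (cross (ray (X q) b) (ray (X q) a))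
      compare a b a≢b q≢a q≢b with sign (cross (ray (X q) a) (ray (X q) b))
      ... | positive p = inj₁ p
      ... | negative p = inj₂ (Pos-resp (sym (cross-anti (ray (X q) b) (ray (X q) a))) p)
      ... | vanishes p = ⊥-elim (general q (label a) (label b) q≢a q≢b a≢b (trans (sym (orientation≈cross q (label a) (label b))) (ray-cross≈0 (X q) a b p)))

      -- Insertion exchanges only letters of equal sign: letters of opposite sign are already weakly
      -- ordered, and general position excludes ties. The direction `r` provides the half-plane
      -- needed for transitivity.
      insert : ∀ a w → Left a → All Left w → All (InOrder (X q) a) w → All (λ b → label a ≢ label b) w → q ≢ label a → All (λ b → q ≢ label b) w →
               Sorted q w → ∃[ v ] (v ~ a ∷ w × Sorted q v)
      insert a [] la [] [] [] q≢a [] [] = a ∷ [] , ~refl , [] ∷ []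
      insert a (b ∷ w) la (lb ∷ ls) (ob ∷ os) (a≢b ∷ a≢) q≢a (q≢b ∷ q≢) (h ∷ o) with compare a b a≢b q≢a q≢b
      ... | inj₁ p = a ∷ b ∷ w , ~refl , (p ∷ All.zipWith (λ { {x} (lx , bx) → cross-trans r (ray (X q) a) (ray (X q) b) (ray (X q) x) la lb lx p bx }) (ls , h)) ∷ h ∷ o
      ... | inj₂ p with insert a w la ls os a≢ q≢a q≢ o
      ...   | v , e , o′ = b ∷ v , ~trans (prep b e) (exchange a b same) , ↭.All-resp-↭ (↭-sym (~⇒↭ e)) (p ∷ h) ∷ o′
        where
        same : ¬ Opposite b a
        same op = Pos-contra p (NN-resp (cross-anti (ray (X q) a) (ray (X q) b)) (ob (symmetric a b op)))
          where
          symmetric : ∀ (a b : Item Label) → Opposite b a → Opposite a b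
          symmetric (u _) (l _) _ = tt
          symmetric (l _) (u _) _ = tt
        exchange : ∀ a b {w} → ¬ Opposite b a → b ∷ a ∷ w ~ a ∷ b ∷ w
        exchange (u x) (u y) _  = swapU y x
        exchange (l x) (l y) _  = swapL y x
        exchange (u x) (l y) ¬o = contradiction tt ¬o
        exchange (l x) (u y) ¬o = contradiction tt ¬o

      sort : ∀ w → All Left w → Ordered′ (X q) w → AllPairs (λ a b → label a ≢ label b) w → All (λ b → q ≢ label b) w → ∃[ v ] (v ~ w × Sorted q v)
      sort [] [] [] [] [] = [] , ~refl , []
      sort (a ∷ w) (la ∷ ls) (oa ∷ os) (a≢ ∷ ≢s) (q≢a ∷ q≢) with sort w ls os ≢s q≢
      ... | v , e , o with ~⇒↭ (~-sym e)
      ...   | e′ with insert a v la (↭.All-resp-↭ e′ ls) (↭.All-resp-↭ e′ oa) (↭.All-resp-↭ e′ a≢) q≢a (↭.All-resp-↭ e′ q≢) o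
      ...     | v′ , f , o′ = v′ , ~trans f (prep a e) , o′

    full : ∀ {q a w} → XState q a w → ∃[ v ] (v ~ w × XFull q (a ∷ v))
    full {q} {a} {w} s with unique labels
      where open XState s
    ... | (_ ∷ q≢) ∷ _ ∷ ≢s with Sort.sort q (ray (X q) a) w (XState.ahead s) (XState.ordered s) (AllPairs.map⁻ ≢s) (All.map⁻ q≢)
    ...   | v , e , o = v , e , record
      { sorted = ↭.All-resp-↭ (↭-sym (~⇒↭ e)) (XState.ahead s) ∷ o
      ; labels = ↭-trans (_↭_.prep q (_↭_.prep (label a) (↭.map⁺ label (~⇒↭ e)))) (XState.labels s) }

    -- The labelling `g` is a parameter because the game is played twice: with a single number,
    -- where only signs count, and with actual colours. A successful search is followed along the
    -- true configuration, whose next event is always among those the search has answered.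
    module Soundness
      (prune : ℕ → ℕ → ℕ → Word ℕ → Bool)
      (goalV : ℕ → ℕ → Word ℕ → ℕ → ℕ → Word ℕ → Bool)
      (goalX : ℕ → Word ℕ → Bool)
      (g : Label → ℕ) {ρ} (Reach : Set ρ)
      (goalV-sound : ∀ {p f b pre x y post} → Vertex p f b pre x y post → goalV (g f) (g b) (mapʷ g pre) (g x) (g y) (mapʷ g post) ≡ true → Reach)
      (goalX-sound : ∀ {q a w} → XState q a w → goalX (g q) (mapʷ g (a ∷ w)) ≡ true → Reach)
      where
      open Game prune goalV goalX

      allEvents-∈ : ∀ n m f b es {pre c d post} → event pre c d post ∈ es → allEvents n m f b es ≡ true →
                    (goalV f b pre c d post ∨ continue n m f b pre c d post) ≡ true
      allEvents-∈ n m f b (event _ _ _ _ ∷ es) (here ≡.refl) e = proj₁ (∧-split e)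
      allEvents-∈ n m f b (event pre c d post ∷ es) (there p) e =
        allEvents-∈ n m f b es p (proj₂ (∧-split {goalV f b pre c d post ∨ continue n m f b pre c d post} e))

      fromFirst-∈ : ∀ n q ps w {x us} → (x , us) ∈ ps → fromFirst n q ps w ≡ true → path n 16 x q (map u us ++ w) ≡ true
      fromFirst-∈ n q ((x , us) ∷ ps) w (here ≡.refl) e = proj₁ (∧-split e)
      fromFirst-∈ n q ((x , us) ∷ ps) w (there p) e = fromFirst-∈ n q ps w p (proj₂ (∧-split {path n 16 x q (map u us ++ w)} e))

      depart-word : ∀ pre (x y : Label) post → mapʷ g (pre ++ l y ∷ u x ∷ post) ≡ mapʷ g pre ++ l (g y) ∷ u (g x) ∷ mapʷ g post
      depart-word pre x y post = map-++ (mapᵢ g) pre (l y ∷ u x ∷ post)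

      mutual
        path-sound : ∀ n m {p f b w} → Flat p f b w → path n m (g f) (g b) (mapʷ g w) ≡ true → Reach
        path-sound n m {f = f} {b} {w} flat e
          with ∧-split {allEvents n m (g f) (g b) (events (mapʷ g w))} (proj₂ (∧-split {prune n (g f) (g b) (mapʷ g w)} e))
        ... | e₁ , e₂ with Slide.slide flat
        ...   | inj₁ xs = stop-sound n xs e₂
        ...   | inj₂ cr = crossing-sound n m cr e₁

        crossing-sound : ∀ n m {f b w} → Crossing f b w → allEvents n m (g f) (g b) (events (mapʷ g w)) ≡ true → Reach
        crossing-sound n m {f} {b} {w} cr e with events-complete (mapʷ g α) (g x) (map g β₁) (map g β₂) (g y) (mapʷ g γ)
          where open Crossing cr
        ... | pre , post , ev∈ , pre~ , post~
            with ~-map-inv g pre~ (Crossing.α cr ++ map u (Crossing.β₁ cr)) (≡.sym (≡.trans (map-++ (mapᵢ g) (Crossing.α cr) _) (≡.cong (mapʷ g (Crossing.α cr) ++_) (mapʷ-u g (Crossing.β₁ cr)))))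
               | ~-map-inv g post~ (map l (Crossing.β₂ cr) ++ Crossing.γ cr) (≡.sym (≡.trans (map-++ (mapᵢ g) (map l (Crossing.β₂ cr)) _) (≡.cong (_++ mapʷ g (Crossing.γ cr)) (mapʷ-l g (Crossing.β₂ cr)))))
        ...   | pre′ , ≡.refl , r | post′ , ≡.refl , r′ with ∨-split (allEvents-∈ n m (g f) (g b) (events (mapʷ g w)) (≡.subst (λ v → event (mapʷ g pre′) _ _ (mapʷ g post′) ∈ events v) (≡.sym word) ev∈) e)
          where
          open Crossing cr
          word : mapʷ g w ≡ mapʷ g α ++ u (g x) ∷ map u (map g β₁) ++ map l (map g β₂) ++ l (g y) ∷ mapʷ g γ
          word = ≡.trans (≡.cong (mapʷ g) split) (≡.trans (map-++ (mapᵢ g) α _) (≡.cong (λ v → mapʷ g α ++ u (g x) ∷ v)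
            (≡.trans (map-++ (mapᵢ g) (map u β₁) _) (≡.cong₂ _++_ (mapʷ-u g β₁)
              (≡.trans (map-++ (mapᵢ g) (map l β₂) _) (≡.cong (_++ l (g y) ∷ mapʷ g γ) (mapʷ-l g β₂)))))))
        ...     | inj₁ goal = goalV-sound (vertex-~ (~-sym r) (~-sym r′) (Crossing.vertex cr)) goal
        ...     | inj₂ next = continue-sound n m (vertex-~ (~-sym r) (~-sym r′) (Crossing.vertex cr)) next

        continue-sound : ∀ n m {p f b pre x y post} → Vertex p f b pre x y post →
                         continue n m (g f) (g b) (mapʷ g pre) (g x) (g y) (mapʷ g post) ≡ true → Reach
        continue-sound zero (suc m) {pre = pre} {x} {y} {post} v e =
          path-sound zero m (depart v) (≡.subst (λ w → path zero m _ _ w ≡ true) (≡.sym (depart-word pre x y post)) e)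
        continue-sound (suc n) (suc m) {f = f} {b} {pre} {x} {y} {post} v e =
          [ continue-sound n (suc m) v ,
            (λ e′ → [ explore-sound n v ,
                      (λ e″ → path-sound (suc n) m (depart v) (≡.subst (λ w → path (suc n) m _ _ w ≡ true) (≡.sym (depart-word pre x y post)) e″)) ]′
                    (∨-split {explore n (g f) (g b) (mapʷ g pre) (g x) (g y) (mapʷ g post)} e′)) ]′
          (∨-split {continue n (suc m) (g f) (g b) (mapʷ g pre) (g x) (g y) (mapʷ g post)} e)

        explore-sound : ∀ n {p f b pre x y post} → Vertex p f b pre x y post →
                        explore n (g f) (g b) (mapʷ g pre) (g x) (g y) (mapʷ g post) ≡ true → Reach
        explore-sound n {f = f} {b} {pre} {x} {y} {post} v e
          with ∨-split {path n 16 (g x) (g y) (mapʷ g post ++ l (g f) ∷ u (g b) ∷ flip (mapʷ g pre))} e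
        ... | inj₁ e₁ = path-sound n 16 (depart (rotate v)) (≡.subst (λ w → path n 16 _ _ w ≡ true)
                (≡.sym (≡.trans (depart-word post b f (flip pre)) (≡.cong (λ w → mapʷ g post ++ l (g f) ∷ u (g b) ∷ w) (mapʷ-flip g pre)))) e₁)
        -- Three quarter turns bring `y` to the front.
        ... | inj₂ e₂ = path-sound n 16 (depart (rotate (rotate (rotate v)))) (≡.subst (λ w → path n 16 _ _ w ≡ true)
                (≡.sym (≡.trans (depart-word (flip post) f b (flip (flip pre)))
                  (≡.cong₂ (λ v w → v ++ l (g b) ∷ u (g f) ∷ w) (mapʷ-flip g post) (≡.cong (mapʷ g) (flip-flip pre))))) e₂)

        stop-sound : ∀ n {f b w} → XState f (l b) w → stop n (g f) (g b) (mapʷ g w) ≡ true → Reach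
        stop-sound zero    s e = goalX-sound s e
        stop-sound (suc n) {f} {b} {w} s e with ∨-split {goalX (g f) (l (g b) ∷ mapʷ g w)} e
        ... | inj₁ e₁ = goalX-sound s e₁
        ... | inj₂ e₂ with full s
        ...   | v , v~w , xf = exploreX-sound n 10 xf (~-map⁺ g (prep (l b) (~-sym v~w))) e₂

        exploreX-sound : ∀ n k {q s a} → XFull q s → a ~ mapʷ g s → exploreX n k (g q) a ≡ true → Reach
        exploreX-sound n (suc k) {q} {s} {l x ∷ a} xf r e = exploreX-sound n k
          (turnL (spanL s) (dropL s) (≡.subst (XFull q) (span-dropL s) xf))
          (~trans (~-++ (proj₂ (~-spanL r)) (↭⇒~u (proj₁ (~-spanL r))))
            (~-reflexive (≡.trans (≡.cong₂ (λ v w → v ++ map u w) (proj₂ (mapʷ-spanL g s)) (proj₁ (mapʷ-spanL g s)))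
              (≡.sym (≡.trans (map-++ (mapᵢ g) (dropL s) _) (≡.cong (mapʷ g (dropL s) ++_) (mapʷ-u g (spanL s)))))))) e
        exploreX-sound n (suc k) {q} {s} {u x ∷ a} xf r e
          with ∨-split {fromFirst n (g q) (picks [] (spanU (u x ∷ a))) (dropU a)} e
        ... | inj₂ e₂ = exploreX-sound n k
          (turnU (spanU s) (dropU s) (≡.subst (XFull q) (span-dropU s) xf))
          (~trans (~-++ (proj₂ (~-spanU r)) (↭⇒~l (proj₁ (~-spanU r))))
            (~-reflexive (≡.trans (≡.cong₂ (λ v w → v ++ map l w) (proj₂ (mapʷ-spanU g s)) (proj₁ (mapʷ-spanU g s)))
              (≡.sym (≡.trans (map-++ (mapᵢ g) (dropU s) _) (≡.cong (mapʷ g (dropU s) ++_) (mapʷ-l g (spanU s)))))))) e₂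
        ... | inj₁ e₁ = first-sound n s xf r e₁

        first-sound : ∀ n {q x a} s → XFull q s → u x ∷ a ~ mapʷ g s → fromFirst n (g q) (picks [] (spanU (u x ∷ a))) (dropU a) ≡ true → Reach
        first-sound n {q} {x} {a} [] xf r e with ↭.↭-empty-inv (~⇒↭ r)
        ... | ()
        first-sound n {q} {x} {a} (l y ∷ s) xf r e with ↭.↭-empty-inv (proj₁ (~-spanU r))
        ... | ()
        first-sound n {q} {x} {a} (u y ∷ s) xf r e
          with picks-complete {g y} [] (spanU (u x ∷ a)) (↭.∈-resp-↭ (↭-sym (proj₁ (~-spanU r))) (here ≡.refl)) ≡.refl
        ... | rest , r∈ , perm
            with ~-map-inv g {map u rest ++ dropU a} {mapʷ g s} (~trans (~-++ (↭⇒~u (↭.drop-∷ (↭-trans perm (proj₁ (~-spanU r))))) (proj₂ (~-spanU r))) (~-reflexive (≡.sym (span-dropU (mapʷ g s))))) s ≡.refl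
        ...   | s′ , eq , s′~s = path-sound n 16 (flat-~ (~-sym s′~s) (leave xf))
                (≡.subst (λ w → path n 16 (g y) (g q) w ≡ true) eq (fromFirst-∈ n (g q) _ (dropU a) r∈ e))

      fromVertex-sound : ∀ n {p f b pre x y post} → Vertex p f b pre x y post →
                         fromVertex n (g f) (g b) (mapʷ g pre) (g x) (g y) (mapʷ g post) ≡ true → Reach
      fromVertex-sound n {f = f} {b} {pre} {x} {y} {post} v e
        with ∨-split {path n 16 (g f) (g b) (mapʷ g pre ++ l (g y) ∷ u (g x) ∷ mapʷ g post)
                      ∨ path n 16 (g b) (g f) (flip (mapʷ g pre) ++ l (g x) ∷ u (g y) ∷ flip (mapʷ g post))} e
      ... | inj₂ e₂ = explore-sound n v e₂
      ... | inj₁ e₁ with ∨-split {path n 16 (g f) (g b) (mapʷ g pre ++ l (g y) ∷ u (g x) ∷ mapʷ g post)} e₁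
      ...   | inj₁ e₃ = path-sound n 16 (depart v) (≡.subst (λ w → path n 16 _ _ w ≡ true) (≡.sym (depart-word pre x y post)) e₃)
      ...   | inj₂ e₄ = path-sound n 16 (depart (rotate (rotate v))) (≡.subst (λ w → path n 16 _ _ w ≡ true)
                (≡.sym (≡.trans (depart-word (flip pre) y x (flip post))
                  (≡.cong₂ (λ v w → v ++ l (g x) ∷ u (g y) ∷ w) (mapʷ-flip g pre) (mapʷ-flip g post)))) e₄)

-- From alternating triples to rainbow partitions.

module RainbowTriples where
  open OrderedField
  open Separation
  open Search
  open import Level using (_⊔_)
  open import Data.Nat.Base using (ℕ)
  open import Data.Fin.Base using (Fin; zero; suc)
  open import Data.Integer.Base using (+_)
  open import Data.List.Base using (List; []; _∷_; _++_; map; allFin)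
  open import Data.List.Properties using (map-++; map-∘)
  open import Data.List.Relation.Unary.All as All using (All; []; _∷_)
  import Data.List.Relation.Unary.All.Properties as All
  open import Data.List.Relation.Unary.Any using (here; there)
  open import Data.List.Relation.Unary.AllPairs as AllPairs using (AllPairs; []; _∷_)
  import Data.List.Relation.Unary.AllPairs.Properties as AllPairs
  open import Data.List.Relation.Unary.Unique.Propositional using (Unique)
  import Data.List.Relation.Unary.Unique.Propositional.Properties as Unique
  open import Data.List.Relation.Binary.Permutation.Propositional using (_↭_; prep; swap; ↭-refl; ↭-sym; ↭-trans; ↭-reflexive)
  import Data.List.Relation.Binary.Permutation.Propositional.Properties as ↭
  open import Data.List.Membership.Propositional using (_∈_)
  import Data.List.Membership.Propositional.Properties as ∈
  open import Data.Product.Base using (_×_; _,_; proj₁; proj₂; ∃-syntax)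
  open import Data.Sum.Base using (_⊎_; inj₁; inj₂)
  open import Data.Unit.Base using (tt)
  open import Function.Base using (_∘_)
  open import Relation.Nullary using (¬_; contradiction)
  open import Relation.Binary.PropositionalEquality as ≡ using (_≡_; _≢_)
  open Plane
  open States
  open Runs
  open Sweep
  open import Data.Bool.Base using (true; false; _∨_; not; if_then_else_)
  open import Data.Nat.Base using (zero; suc; _≡ᵇ_)
  import Data.Nat.Base as ℕ
  import Data.Nat.Properties as ℕ
  open import Data.List.Base using (concat; lookup; length; _ʳ++_)
  open import Data.List.Properties using (length-map)
  open import Data.List.Relation.Unary.Any as Any using (Any)
  open import Data.List.Relation.Binary.Sublist.Propositional using (_⊆_; []; _∷_; _∷ʳ_; ⊆-refl; ⊆-trans; minimum)

  ≡ᵇ-≢ : ∀ m n → (m ≡ᵇ n) ≡ false → m ≢ n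
  ≡ᵇ-≢ m .m e ≡.refl with ≡.trans (≡.sym e) (≡ᵇ-refl m)
  ... | ()

  not-true : ∀ {b} → not b ≡ true → b ≡ false
  not-true {false} _ = ≡.refl

  ∨-false : ∀ {a b} → (a ∨ b) ≡ false → a ≡ false × b ≡ false
  ∨-false {false} {false} _ = ≡.refl , ≡.refl

  if-false : ∀ {a b} → (if a then false else b) ≡ true → a ≡ false × b ≡ true
  if-false {false} e = ≡.refl , e

  All-⊆ : ∀ {a r} {A : Set a} {P : A → Set r} {xs ys} → xs ⊆ ys → All P ys → All P xs
  All-⊆ [] [] = []
  All-⊆ (y ∷ʳ s) (_ ∷ ps) = All-⊆ s ps
  All-⊆ (≡.refl ∷ s) (p ∷ ps) = p ∷ All-⊆ s ps

  AllPairs-⊆ : ∀ {a r} {A : Set a} {R : A → A → Set r} {xs ys} → xs ⊆ ys → AllPairs R ys → AllPairs R xs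
  AllPairs-⊆ [] [] = []
  AllPairs-⊆ (y ∷ʳ s) (_ ∷ ps) = AllPairs-⊆ s ps
  AllPairs-⊆ (≡.refl ∷ s) (p ∷ ps) = All-⊆ s p ∷ AllPairs-⊆ s ps

  ʳ++-⊆ : ∀ {a} {A : Set a} (xs : List A) {ys zs} → ys ⊆ zs → xs ʳ++ ys ⊆ xs ʳ++ zs
  ʳ++-⊆ []       s = s
  ʳ++-⊆ (x ∷ xs) s = ʳ++-⊆ xs (≡.refl ∷ s)

  ʳ++-shift : ∀ {a} {A : Set a} (xs : List A) {y ys} → xs ʳ++ (y ∷ ys) ↭ y ∷ (xs ʳ++ ys)
  ʳ++-shift []       = ↭-refl
  ʳ++-shift (x ∷ xs) {y} {ys} = ↭-trans (resp xs (swap x y ↭-refl)) (ʳ++-shift xs)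
    where
    resp : ∀ xs {ys zs} → ys ↭ zs → xs ʳ++ ys ↭ xs ʳ++ zs
    resp []       p = p
    resp (x ∷ xs) p = resp xs (prep x p)

  map-ʳ++ : ∀ {A B : Set} (f : A → B) xs ys → map f xs ʳ++ map f ys ≡ map f (xs ʳ++ ys)
  map-ʳ++ f []       ys = ≡.refl
  map-ʳ++ f (x ∷ xs) ys = map-ʳ++ f xs (x ∷ ys)

  module Triples {L : Set} (g : L → ℕ) where
    data Alternating : Item L → Item L → Item L → Set where
      ulu : ∀ {a b c} → Alternating (u a) (l b) (u c)
      lul : ∀ {a b c} → Alternating (l a) (u b) (l c)

    record Triple (w : Word L) : Set where
      field
        {a b c} : Item L
        alternates : Alternating a b c
        within : a ∷ b ∷ c ∷ [] ⊆ w
        ab : g (label a) ≢ g (label b)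
        ac : g (label a) ≢ g (label c)
        bc : g (label b) ≢ g (label c)

    members : ∀ {w} → Triple w → List L
    members t = label a ∷ label b ∷ label c ∷ []
      where open Triple t

    weaken : ∀ {v w} → v ⊆ w → Triple v → Triple w
    weaken s t = record { Triple t ; within = ⊆-trans (Triple.within t) s }

    Decomposition : ℕ → Word L → Set
    Decomposition k w = ∃[ ts ] ∃[ rest ] (length {A = Triple w} ts ≡ k × concat (map members ts) ++ rest ↭ map label w)

    extend : ∀ {k v w} (t : Triple w) → v ⊆ w → members t ++ map label v ↭ map label w → Decomposition k v → Decomposition (suc k) w
    extend {w = w} t s σ (ts , rest , ≡.refl , ρ) = t ∷ map (weaken s) ts , rest , ≡.cong suc (length-map (weaken s) ts) ,
      ↭-trans (↭.++⁺ˡ (members t) (↭-trans (↭-reflexive (≡.cong (λ ms → concat ms ++ rest) (≡.sym (map-∘ ts)))) ρ)) σ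

    mutual
      triples-sound : ∀ k w → triples k (mapʷ g w) ≡ true → Decomposition k w
      triples-sound zero    w         e = [] , map label w , ≡.refl , ↭-refl
      triples-sound (suc k) (u a ∷ w) e = secondU-sound k a [] w e ⊆-refl (u a ∷ʳ ⊆-refl) ↭-refl
      triples-sound (suc k) (l a ∷ w) e = secondL-sound k a [] w e ⊆-refl (l a ∷ʳ ⊆-refl) ↭-refl

      -- Three facts are carried along: `u a ∷ w ⊆ v` preserves the order needed for the triple
      -- being built, `sk ʳ++ w ⊆ v` that of the letters left for later triples, and the permutation
      -- ensures that no letter is lost.
      secondU-sound : ∀ k a sk w {v} → secondU k (g a) (mapʷ g sk) (mapʷ g w) ≡ true →
        u a ∷ w ⊆ v → sk ʳ++ w ⊆ v → u a ∷ (sk ʳ++ w) ↭ v → Decomposition (suc k) v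
      secondU-sound k a sk (u b ∷ w) e s s′ σ = secondU-sound k a (u b ∷ sk) w e (⊆-trans (≡.refl ∷ u b ∷ʳ ⊆-refl) s) s′ σ
      secondU-sound k a sk (l b ∷ w) e s s′ σ with ∨-split {if g a ≡ᵇ g b then false else thirdU k (g a) (g b) (mapʷ g sk) (mapʷ g w)} e
      ... | inj₂ e₂ = secondU-sound k a (l b ∷ sk) w e₂ (⊆-trans (≡.refl ∷ l b ∷ʳ ⊆-refl) s) s′ σ
      ... | inj₁ e₁ with if-false {g a ≡ᵇ g b} e₁
      ...   | ne , e₃ = thirdU-sound k a b sk w e₃ (≡ᵇ-≢ _ _ ne) s (⊆-trans (ʳ++-⊆ sk (l b ∷ʳ ⊆-refl)) s′) (↭-trans (prep (u a) (↭-sym (ʳ++-shift sk))) σ)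

      secondL-sound : ∀ k a sk w {v} → secondL k (g a) (mapʷ g sk) (mapʷ g w) ≡ true →
        l a ∷ w ⊆ v → sk ʳ++ w ⊆ v → l a ∷ (sk ʳ++ w) ↭ v → Decomposition (suc k) v
      secondL-sound k a sk (l b ∷ w) e s s′ σ = secondL-sound k a (l b ∷ sk) w e (⊆-trans (≡.refl ∷ l b ∷ʳ ⊆-refl) s) s′ σ
      secondL-sound k a sk (u b ∷ w) e s s′ σ with ∨-split {if g a ≡ᵇ g b then false else thirdL k (g a) (g b) (mapʷ g sk) (mapʷ g w)} e
      ... | inj₂ e₂ = secondL-sound k a (u b ∷ sk) w e₂ (⊆-trans (≡.refl ∷ u b ∷ʳ ⊆-refl) s) s′ σ
      ... | inj₁ e₁ with if-false {g a ≡ᵇ g b} e₁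
      ...   | ne , e₃ = thirdL-sound k a b sk w e₃ (≡ᵇ-≢ _ _ ne) s (⊆-trans (ʳ++-⊆ sk (u b ∷ʳ ⊆-refl)) s′) (↭-trans (prep (l a) (↭-sym (ʳ++-shift sk))) σ)

      thirdU-sound : ∀ k a b sk w {v} → thirdU k (g a) (g b) (mapʷ g sk) (mapʷ g w) ≡ true → g a ≢ g b →
        u a ∷ l b ∷ w ⊆ v → sk ʳ++ w ⊆ v → u a ∷ l b ∷ (sk ʳ++ w) ↭ v → Decomposition (suc k) v
      thirdU-sound k a b sk (l c ∷ w) e ne s s′ σ = thirdU-sound k a b (l c ∷ sk) w e ne (⊆-trans (≡.refl ∷ ≡.refl ∷ l c ∷ʳ ⊆-refl) s) s′ σ
      thirdU-sound k a b sk (u c ∷ w) e ne s s′ σ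
        with ∨-split {if (g a ≡ᵇ g c) ∨ (g b ≡ᵇ g c) then false else triples k (mapʷ g sk ʳ++ mapʷ g w)} e
      ... | inj₂ e₂ = thirdU-sound k a b (u c ∷ sk) w e₂ ne (⊆-trans (≡.refl ∷ ≡.refl ∷ u c ∷ʳ ⊆-refl) s) s′ σ
      ... | inj₁ e₁ with if-false {(g a ≡ᵇ g c) ∨ (g b ≡ᵇ g c)} e₁
      ...   | ne′ , e₃ = extend
                (record { alternates = ulu ; within = ⊆-trans (≡.refl ∷ ≡.refl ∷ ≡.refl ∷ minimum w) s ; ab = ne
                        ; ac = ≡ᵇ-≢ _ _ (proj₁ (∨-false ne′)) ; bc = ≡ᵇ-≢ _ _ (proj₂ (∨-false {g a ≡ᵇ g c} ne′)) })
                (⊆-trans (ʳ++-⊆ sk (u c ∷ʳ ⊆-refl)) s′)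
                (↭.map⁺ label (↭-trans (prep (u a) (prep (l b) (↭-sym (ʳ++-shift sk)))) σ))
                (triples-sound k (sk ʳ++ w) (≡.subst (λ w → triples k w ≡ true) (map-ʳ++ (mapᵢ g) sk w) e₃))

      thirdL-sound : ∀ k a b sk w {v} → thirdL k (g a) (g b) (mapʷ g sk) (mapʷ g w) ≡ true → g a ≢ g b →
        l a ∷ u b ∷ w ⊆ v → sk ʳ++ w ⊆ v → l a ∷ u b ∷ (sk ʳ++ w) ↭ v → Decomposition (suc k) v
      thirdL-sound k a b sk (u c ∷ w) e ne s s′ σ = thirdL-sound k a b (u c ∷ sk) w e ne (⊆-trans (≡.refl ∷ ≡.refl ∷ u c ∷ʳ ⊆-refl) s) s′ σ
      thirdL-sound k a b sk (l c ∷ w) e ne s s′ σ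
        with ∨-split {if (g a ≡ᵇ g c) ∨ (g b ≡ᵇ g c) then false else triples k (mapʷ g sk ʳ++ mapʷ g w)} e
      ... | inj₂ e₂ = thirdL-sound k a b (l c ∷ sk) w e₂ ne (⊆-trans (≡.refl ∷ ≡.refl ∷ l c ∷ʳ ⊆-refl) s) s′ σ
      ... | inj₁ e₁ with if-false {(g a ≡ᵇ g c) ∨ (g b ≡ᵇ g c)} e₁
      ...   | ne′ , e₃ = extend
                (record { alternates = lul ; within = ⊆-trans (≡.refl ∷ ≡.refl ∷ ≡.refl ∷ minimum w) s ; ab = ne
                        ; ac = ≡ᵇ-≢ _ _ (proj₁ (∨-false ne′)) ; bc = ≡ᵇ-≢ _ _ (proj₂ (∨-false {g a ≡ᵇ g c} ne′)) })
                (⊆-trans (ʳ++-⊆ sk (l c ∷ʳ ⊆-refl)) s′)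
                (↭.map⁺ label (↭-trans (prep (l a) (prep (u b) (↭-sym (ʳ++-shift sk)))) σ))
                (triples-sound k (sk ʳ++ w) (≡.subst (λ w → triples k w ≡ true) (map-ʳ++ (mapᵢ g) sk w) e₃))

  All-members : ∀ {a r} {A : Set a} {R : A → A → Set r} → (∀ {x y} → R x y → R y x) → ∀ {xs} → AllPairs R xs →
                ∀ {x y} → x ∈ xs → y ∈ xs → x ≡ y ⊎ R x y
  All-members s (p ∷ ps) (here ≡.refl) (here ≡.refl) = inj₁ ≡.refl
  All-members s (p ∷ ps) (here ≡.refl) (there j)     = inj₂ (All.lookup p j)
  All-members s (p ∷ ps) (there i)     (here ≡.refl) = inj₂ (s (All.lookup p i))
  All-members s (p ∷ ps) (there i)     (there j)     = All-members s ps i j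

  lookup-∈-concat : ∀ {A : Set} {x : A} xss t → x ∈ lookup xss t → x ∈ concat xss
  lookup-∈-concat (xs ∷ xss) zero    p = ∈.∈-++⁺ˡ p
  lookup-∈-concat (xs ∷ xss) (suc t) p = ∈.∈-++⁺ʳ xs (lookup-∈-concat xss t p)

  concat-unique : ∀ {A : Set} {x : A} xss → Unique (concat xss) → ∀ s t → x ∈ lookup xss s → x ∈ lookup xss t → s ≡ t
  concat-unique (xs ∷ xss) un zero    zero    p q = ≡.refl
  concat-unique (xs ∷ xss) un zero    (suc t) p q = contradiction ≡.refl (All.lookup (All.lookup (proj₂ (proj₂ (AllPairs-++⁻ xs un))) p) (lookup-∈-concat xss t q))
  concat-unique (xs ∷ xss) un (suc s) zero    p q = contradiction ≡.refl (All.lookup (All.lookup (proj₂ (proj₂ (AllPairs-++⁻ xs un))) q) (lookup-∈-concat xss s p))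
  concat-unique (xs ∷ xss) un (suc s) (suc t) p q = ≡.cong suc (concat-unique xss (proj₁ (proj₂ (AllPairs-++⁻ xs un))) s t p q)

  module Rainbow {r ℓ ℓ₂} (ℝ : RealField r ℓ ℓ₂) (X : Fin 10 → Geometry.Point ℝ) (general : Sums.General ℝ X) (g : Fin 10 → ℕ) where
    open Vectors ℝ
    open States.States ℝ X general
    open Triples g

    pick : ∀ {n} → Fin n → Fin n → Carrier → Carrier
    pick zero    zero    a = a
    pick zero    (suc j) a = 0#
    pick (suc i) zero    a = 0#
    pick (suc i) (suc j) a = pick i j a

    Σ-pick : ∀ {n} (j : Fin n) a (h : Fin n → Carrier) → Σᶠ (λ i → pick i j a * h i) ≈ a * h j
    Σ-pick {suc n} zero    a h = trans (+-congˡ (trans (Σ-cong {n} λ i → zeroˡ (h (suc i))) (Σ-0 n))) (+-identityʳ _)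
    Σ-pick {suc n} (suc j) a h = trans (+-cong (zeroˡ _) (Σ-pick j a (h ∘ suc))) (+-identityˡ _)

    pick-NN : ∀ {n} (i j : Fin n) {a} → NN a → NN (pick i j a)
    pick-NN zero    zero    p = p
    pick-NN zero    (suc j) p = NN-0
    pick-NN (suc i) zero    p = NN-0
    pick-NN (suc i) (suc j) p = pick-NN i j p

    pick-≢ : ∀ {n} (i j : Fin n) {a} → i ≢ j → pick i j a ≈ 0#
    pick-≢ zero    zero    p = contradiction ≡.refl p
    pick-≢ zero    (suc j) p = refl
    pick-≢ (suc i) zero    p = refl
    pick-≢ (suc i) (suc j) p = pick-≢ i j (p ∘ ≡.cong suc)

    Weights : Set _
    Weights = List (Label × Carrier)

    weigh : Weights → (Label → Carrier) → Carrier
    weigh []             h = 0#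
    weigh ((j , a) ∷ ws) h = a * h j + weigh ws h

    coefficient : Weights → Label → Carrier
    coefficient []             i = 0#
    coefficient ((j , a) ∷ ws) i = pick i j a + coefficient ws i

    Σ-coefficient : ∀ ws h → Σᶠ (λ i → coefficient ws i * h i) ≈ weigh ws h
    Σ-coefficient []             h = trans (Σ-cong {10} λ i → zeroˡ (h i)) (Σ-0 10)
    Σ-coefficient ((j , a) ∷ ws) h = trans (Σ-cong {10} λ i → distribʳ (h i) (pick i j a) (coefficient ws i))
      (trans (Σ-+ {10} (λ i → pick i j a * h i) (λ i → coefficient ws i * h i)) (+-cong (Σ-pick j a h) (Σ-coefficient ws h)))

    coefficient-NN : ∀ ws → All (NN ∘ proj₂) ws → ∀ i → NN (coefficient ws i)
    coefficient-NN []             []       i = NN-0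
    coefficient-NN ((j , a) ∷ ws) (p ∷ ps) i = NN-+ (pick-NN i j p) (coefficient-NN ws ps i)

    coefficient-∉ : ∀ ws i → ¬ (i ∈ map proj₁ ws) → coefficient ws i ≈ 0#
    coefficient-∉ []             i p = refl
    coefficient-∉ ((j , a) ∷ ws) i p = trans (+-cong (pick-≢ i j (p ∘ here)) (coefficient-∉ ws i (p ∘ there))) (+-identityˡ _)

    weigh-shift : ∀ ws h k → weigh ws (λ i → h i + - k) ≈ weigh ws h + - (weigh ws (λ _ → 1#) * k)
    weigh-shift []             h k = solve 1 (λ k → con (+ 0) := con (+ 0) :+ :- (con (+ 0) :* k)) refl k
    weigh-shift ((j , a) ∷ ws) h k = trans (+-congˡ (weigh-shift ws h k))
      (trans (solve 5 (λ a x k v o → a :* (x :+ :- k) :+ (v :+ :- (o :* k)) := (a :* x :+ v) :+ :- ((a :+ o) :* k)) refl a (h j) k (weigh ws h) (weigh ws (λ _ → 1#)))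
        (+-congˡ (-‿cong (*-congʳ (+-congʳ (sym (*-identityʳ a)))))))

    -- A barycentric representation without normalisation, so that cross products can serve directly
    -- as weights.
    record Encloses (p : Point) (is : List Label) : Set (r ⊔ ℓ ⊔ ℓ₂) where
      field
        weights     : Weights
        support     : map proj₁ weights ≡ is
        nonnegative : All (NN ∘ proj₂) weights
        nontrivial  : Pos (weigh weights (λ _ → 1#))
        centred₁    : weigh weights (λ i → proj₁ (vec p i)) ≈ 0#
        centred₂    : weigh weights (λ i → proj₂ (vec p i)) ≈ 0#

    inConv : ∀ {p is s} {S : Label → Set s} → Encloses p is → (∀ {i} → i ∈ is → S i) → InConv X S p
    inConv {p} {S = S} e inS = (λ i → z * coefficient weights i) ,
        (λ i → NN-* (proj₁ z>0) (coefficient-NN weights nonnegative i)) ,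
        (λ i ¬s → trans (*-congˡ (coefficient-∉ weights i (λ m → ¬s (inS (≡.subst (i ∈_) support m))))) (zeroʳ z)) ,
        trans (Σ-cong {10} λ i → *-congˡ {z} (sym (*-identityʳ (coefficient weights i))))
          (trans (Σ-* {10} z (λ i → coefficient weights i * 1#)) (trans (*-congˡ (Σ-coefficient weights (λ _ → 1#))) (trans (*-comm _ _) Wz))) ,
        average (λ i → proj₁ (X i)) (proj₁ p) centred₁ ,
        average (λ i → proj₂ (X i)) (proj₂ p) centred₂
      where
      open Encloses e
      z = proj₁ (Pos-inverse nontrivial)
      z>0 = proj₁ (proj₂ (Pos-inverse nontrivial))
      Wz = proj₂ (proj₂ (Pos-inverse nontrivial))
      average : ∀ h k → weigh weights (λ i → h i + - k) ≈ 0# → Σᶠ (λ i → (z * coefficient weights i) * h i) ≈ k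
      average h k centred = trans (Σ-cong {10} λ i → *-assoc z (coefficient weights i) (h i)) (trans (Σ-* {10} z (λ i → coefficient weights i * h i))
        (trans (*-congˡ (trans (Σ-coefficient weights h) balance)) (trans (solve 3 (λ z o k → z :* (o :* k) := (o :* z) :* k) refl z _ k)
          (trans (*-congʳ Wz) (*-identityˡ k)))))
        where
        balance : weigh weights h ≈ weigh weights (λ _ → 1#) * k
        balance = trans (solve 2 (λ a b → a := (a :+ :- b) :+ b) refl (weigh weights h) (weigh weights (λ _ → 1#) * k))
          (trans (+-congʳ (trans (sym (weigh-shift weights h k)) centred)) (+-identityˡ _))

    Solution : Set _
    Solution = ∃[ π ] ((∀ i k → π i ≡ π k → g i ≡ g k → i ≡ k) × Works X π)

    -- The part of a label is the index of a group containing it; as the groups together list every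
    -- label once, that group is the only one.
    solution : ∀ {p} G₀ G₁ G₂ G₃ → concat (G₀ ∷ G₁ ∷ G₂ ∷ G₃ ∷ []) ↭ allFin 10 →
               All (λ G → Encloses p G × AllPairs (λ i k → g i ≢ g k) G) (G₀ ∷ G₁ ∷ G₂ ∷ G₃ ∷ []) → Solution
    solution {p} G₀ G₁ G₂ G₃ σ good = π , rainbow , p , λ t → inConv (proj₁ (goodAt t)) (λ {i} m → concat-unique Gs (unique σ) (π i) t (member-π i) m)
      where
      Gs = G₀ ∷ G₁ ∷ G₂ ∷ G₃ ∷ []
      place : ∀ i → Any (i ∈_) Gs
      place i = ∈.∈-concat⁻ Gs (↭.∈-resp-↭ (↭-sym σ) (∈.∈-allFin i))
      π : Label → Fin 4
      π i = Any.index (place i)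
      member-π : ∀ i → i ∈ lookup Gs (π i)
      member-π i = lookup-index (place i)
        where open import Data.List.Relation.Unary.Any.Properties using (lookup-index)
      goodAt : ∀ t → Encloses p (lookup Gs t) × AllPairs (λ i k → g i ≢ g k) (lookup Gs t)
      goodAt t = All.lookup good (∈.∈-lookup t)
      rainbow : ∀ i k → π i ≡ π k → g i ≡ g k → i ≡ k
      rainbow i k e f with All-members (λ ne e → ne (≡.sym e)) (proj₂ (goodAt (π k))) (≡.subst (λ t → i ∈ lookup Gs t) e (member-π i)) (member-π k)
      ... | inj₁ i≡k = i≡k
      ... | inj₂ ne  = contradiction f ne

    segment : ∀ {p f b s t} → NN s → Pos t → Balanced s t (vec p f) (vec p b) → Encloses p (f ∷ b ∷ [])
    segment {f = f} {b} {s} {t} s≥0 t>0 (e₁ , e₂) = record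
      { weights = (f , s) ∷ (b , t) ∷ [] ; support = ≡.refl ; nonnegative = s≥0 ∷ proj₁ t>0 ∷ []
      ; nontrivial = NN-+-Pos (NN-* s≥0 NN-1) (Pos-+ (Pos-* t>0 Pos-1) NN-0)
      ; centred₁ = trans (+-congˡ (+-identityʳ _)) e₁ ; centred₂ = trans (+-congˡ (+-identityʳ _)) e₂ }

    point : ∀ q → Encloses (X q) (q ∷ [])
    point q = record
      { weights = (q , 1#) ∷ [] ; support = ≡.refl ; nonnegative = NN-1 ∷ []
      ; nontrivial = Pos-+ (Pos-* Pos-1 Pos-1) NN-0
      ; centred₁ = trans (+-identityʳ _) (trans (*-identityˡ _) (-‿inverseʳ _)) ; centred₂ = trans (+-identityʳ _) (trans (*-identityˡ _) (-‿inverseʳ _)) }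

    opaque
      unfolding cross

      -- Cramer's rule: the linear dependence of three plane vectors, with its minus sign attached
      -- to `b`.
      relation₁ : ∀ a b c → cross b c * proj₁ a + (cross a c * - proj₁ b + (cross a b * proj₁ c + 0#)) ≈ 0#
      relation₁ (a₁ , a₂) (b₁ , b₂) (c₁ , c₂) = solve 6 (λ a₁ a₂ b₁ b₂ c₁ c₂ → (b₁ :* c₂ :+ :- (b₂ :* c₁)) :* a₁ :+ ((a₁ :* c₂ :+ :- (a₂ :* c₁)) :* :- b₁
        :+ ((a₁ :* b₂ :+ :- (a₂ :* b₁)) :* c₁ :+ con (+ 0))) := con (+ 0)) refl a₁ a₂ b₁ b₂ c₁ c₂

      relation₂ : ∀ a b c → cross b c * proj₂ a + (cross a c * - proj₂ b + (cross a b * proj₂ c + 0#)) ≈ 0#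
      relation₂ (a₁ , a₂) (b₁ , b₂) (c₁ , c₂) = solve 6 (λ a₁ a₂ b₁ b₂ c₁ c₂ → (b₁ :* c₂ :+ :- (b₂ :* c₁)) :* a₂ :+ ((a₁ :* c₂ :+ :- (a₂ :* c₁)) :* :- b₂
        :+ ((a₁ :* b₂ :+ :- (a₂ :* b₁)) :* c₂ :+ con (+ 0))) := con (+ 0)) refl a₁ a₂ b₁ b₂ c₁ c₂

    -‿-‿ : ∀ x → - - x ≈ x
    -‿-‿ x = solve 1 (λ x → :- :- x := x) refl x

    -- In an alternating triple the middle ray is reflected relative to the outer two. This cancels
    -- the minus sign in the linear dependence, so the three nonnegative cross products are weights;
    -- if all of them vanished, the three points would be collinear.
    triangle : ∀ {p a b c} → Alternating a b c → label a ≢ label b → label a ≢ label c → label b ≢ label c →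
               NN (cross (ray p a) (ray p b)) → NN (cross (ray p a) (ray p c)) → NN (cross (ray p b) (ray p c)) →
               Encloses p (label a ∷ label b ∷ label c ∷ [])
    triangle {p} {a} {b} {c} alt a≢b a≢c b≢c ab≥0 ac≥0 bc≥0 = record
      { weights = (label a , bc) ∷ (label b , ac) ∷ (label c , ab) ∷ [] ; support = ≡.refl ; nonnegative = bc≥0 ∷ ac≥0 ∷ ab≥0 ∷ []
      ; nontrivial = NN-+ (NN-* bc≥0 NN-1) (NN-+ (NN-* ac≥0 NN-1) (NN-+ (NN-* ab≥0 NN-1) NN-0)) , nonzero
      ; centred₁ = centre₁ alt ; centred₂ = centre₂ alt }
      where
      ab = cross (ray p a) (ray p b)
      ac = cross (ray p a) (ray p c)
      bc = cross (ray p b) (ray p c)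
      nonzero : ¬ (bc * 1# + (ac * 1# + (ab * 1# + 0#)) ≈ 0#)
      nonzero e = general (label a) (label b) (label c) a≢b a≢c b≢c (collinear p (label a) (label b) (label c)
          (ray-cross≈0 p a b (sum-zero ab≥0 (NN-+ ac≥0 bc≥0) (trans (solve 3 (λ x y z → z :+ (y :+ x) := x :+ (y :+ z)) refl bc ac ab) e′)))
          (ray-cross≈0 p b c (sum-zero bc≥0 (NN-+ ac≥0 ab≥0) e′))
          (trans (cross-anti _ _) (trans (-‿cong (ray-cross≈0 p a c (sum-zero ac≥0 (NN-+ bc≥0 ab≥0) (trans (solve 3 (λ x y z → y :+ (x :+ z) := x :+ (y :+ z)) refl bc ac ab) e′)))) -0#≈0#)))
        where
        e′ : bc + (ac + ab) ≈ 0#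
        e′ = trans (+-cong (sym (*-identityʳ bc)) (+-cong (sym (*-identityʳ ac)) (trans (sym (*-identityʳ ab)) (sym (+-identityʳ _))))) e
        sum-zero : ∀ {x y} → NN x → NN y → x + y ≈ 0# → x ≈ 0#
        sum-zero {x} {y} p q e = NN-antisym p (NN-resp (trans (solve 2 (λ x y → y := (x :+ y) :+ :- x) refl x y) (trans (+-congʳ e) (+-identityˡ _))) q)
      centre₁ : Alternating a b c → bc * proj₁ (vec p (label a)) + (ac * proj₁ (vec p (label b)) + (ab * proj₁ (vec p (label c)) + 0#)) ≈ 0#
      centre₁ ulu = trans (+-congˡ (+-congʳ (*-congˡ (sym (-‿-‿ _))))) (relation₁ (ray p a) (ray p b) (ray p c))
      centre₁ lul = trans (solve 6 (λ x y z r s t → x :* r :+ (y :* s :+ (z :* t :+ con (+ 0))) := :- (x :* :- r :+ (y :* :- s :+ (z :* :- t :+ con (+ 0))))) refl bc ac ab _ _ _)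
        (trans (-‿cong (relation₁ (ray p a) (ray p b) (ray p c))) -0#≈0#)
      centre₂ : Alternating a b c → bc * proj₂ (vec p (label a)) + (ac * proj₂ (vec p (label b)) + (ab * proj₂ (vec p (label c)) + 0#)) ≈ 0#
      centre₂ ulu = trans (+-congˡ (+-congʳ (*-congˡ (sym (-‿-‿ _))))) (relation₂ (ray p a) (ray p b) (ray p c))
      centre₂ lul = trans (solve 6 (λ x y z r s t → x :* r :+ (y :* s :+ (z :* t :+ con (+ 0))) := :- (x :* :- r :+ (y :* :- s :+ (z :* :- t :+ con (+ 0))))) refl bc ac ab _ _ _)
        (trans (-‿cong (relation₂ (ray p a) (ray p b) (ray p c))) -0#≈0#)

    opposite₁ : ∀ {a b c : Item Label} → Alternating a b c → Opposite a b
    opposite₁ ulu = tt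
    opposite₁ lul = tt

    opposite₂ : ∀ {a b c : Item Label} → Alternating a b c → Opposite b c
    opposite₂ ulu = tt
    opposite₂ lul = tt

    Good : Point → List Label → Set _
    Good p G = Encloses p G × AllPairs (λ i k → g i ≢ g k) G

    -- A weakly ordered word becomes transitive on alternating triples once all its directions lie on one side of r.
    triple-good : ∀ {p w} r → All (λ a → Pos (cross r (ray p a))) w → Ordered′ p w → AllPairs _≢_ (map label w) → (t : Triple w) → Good p (members t)
    triple-good {p} r side ordered distinct t with All-⊆ within side | AllPairs-⊆ within ordered | AllPairs-⊆ within (AllPairs.map⁻ distinct)
      where open Triple t
    ... | ra ∷ rb ∷ rc ∷ [] | (oab ∷ _ ∷ []) ∷ (obc ∷ []) ∷ _ | (a≢b ∷ a≢c ∷ []) ∷ (b≢c ∷ []) ∷ _ =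
        triangle alternates a≢b a≢c b≢c nab (cross-trans-NN r (ray p a) (ray p b) (ray p c) ra rb rc nab nbc) nbc , (ab ∷ ac ∷ []) ∷ (bc ∷ []) ∷ [] ∷ []
      where
      open Triple t
      nab = oab (opposite₁ alternates)
      nbc = obc (opposite₂ alternates)

    -- The leading ray is not strictly to the left of itself, so triples containing it are treated
    -- separately, with comparisons taken directly from `ahead`.
    triple-good-X : ∀ {q a w} → XState q a w → (t : Triple (a ∷ w)) → Good (X q) (members t)
    triple-good-X {q} {a} {w} s t = split (Triple.alternates t) (Triple.within t) (Triple.ab t) (Triple.ac t) (Triple.bc t)
      where
      open XState s
      distinct : AllPairs (λ a b → label a ≢ label b) (a ∷ w)
      distinct = AllPairs.map⁻ (AllPairs.tail (unique labels))
      split : ∀ {x y z} → Alternating x y z → x ∷ y ∷ z ∷ [] ⊆ a ∷ w → g (label x) ≢ g (label y) → g (label x) ≢ g (label z) → g (label y) ≢ g (label z) →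
              Good (X q) (label x ∷ label y ∷ label z ∷ [])
      split alt (_ ∷ʳ σ) xy xz yz = triple-good (ray (X q) a) ahead ordered (AllPairs.map⁺ (AllPairs.tail distinct))
        (record { alternates = alt ; within = σ ; ab = xy ; ac = xz ; bc = yz })
      split alt (≡.refl ∷ σ) xy xz yz with All-⊆ σ ahead | AllPairs-⊆ σ ordered | AllPairs-⊆ (≡.refl ∷ σ) distinct
      ... | ab ∷ ac ∷ [] | (obc ∷ []) ∷ _ | (a≢b ∷ a≢c ∷ []) ∷ (b≢c ∷ []) ∷ _ =
        triangle alt a≢b a≢c b≢c (proj₁ ab) (proj₁ ac) (obc (opposite₂ alt)) , (xy ∷ xz ∷ []) ∷ (yz ∷ []) ∷ [] ∷ []

    vertex-ordered : ∀ {p f b pre x y post} → Vertex p f b pre x y post → Ordered′ p (pre ++ post)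
    vertex-ordered v = AllPairs.++⁺ pre-ordered post-ordered (All.map (All.map (λ h _ → h)) (pre<post v))
      where open Vertex v

    colV-sound : ∀ {p f b pre x y post} → Vertex p f b pre x y post → colV (g f) (g b) (mapʷ g pre) (g x) (g y) (mapʷ g post) ≡ true → Solution
    colV-sound {p} {f} {b} {pre} {x} {y} {post} v e
      with ∧-split {not (g f ≡ᵇ g b)} e
    ... | e₁ , e₂ with ∧-split {not (g x ≡ᵇ g y)} e₂
    ...   | e₃ , e₄ = assemble (triples-sound 2 (pre ++ post) (≡.subst (λ w → triples 2 w ≡ true) (≡.sym (map-++ (mapᵢ g) pre post)) e₄))
      where
      open Vertex v
      good : (t : Triple (pre ++ post)) → Good p (members t)
      good = triple-good (vec p f) (All.++⁺ (All.map proj₁ before) (All.map proj₁ after)) (vertex-ordered v)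
        (AllPairs.tail (AllPairs.tail (AllPairs.tail (AllPairs.tail (unique labels)))))
      assemble : Decomposition 2 (pre ++ post) → Solution
      assemble (t ∷ t′ ∷ [] , rest , _ , σ) with rest | ↭-trans (prep f (prep b (prep x (prep y σ)))) labels
      ... | [] | τ = solution (f ∷ b ∷ []) (x ∷ y ∷ []) (members t) (members t′) τ
              ((segment (proj₁ s>0) t>0 between , (≡ᵇ-≢ _ _ (not-true e₁) ∷ []) ∷ [] ∷ [])
              ∷ (segment (proj₁ s′>0) t′>0 between′ , (≡ᵇ-≢ _ _ (not-true e₃) ∷ []) ∷ [] ∷ []) ∷ good t ∷ good t′ ∷ [])
      -- Two segments and two triangles already account for all ten labels.
      ... | _ ∷ _ | τ with ↭.↭-length τ
      ...   | ()

    colX-sound : ∀ {q a w} → XState q a w → colX (g q) (mapʷ g (a ∷ w)) ≡ true → Solution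
    colX-sound {q} {a} {w} s e = assemble (triples-sound 3 (a ∷ w) e)
      where
      assemble : Decomposition 3 (a ∷ w) → Solution
      assemble (t ∷ t′ ∷ t″ ∷ [] , rest , _ , σ) with rest | ↭-trans (prep q σ) (XState.labels s)
      ... | [] | τ = solution (q ∷ []) (members t) (members t′) (members t″) τ
              ((point q , [] ∷ []) ∷ triple-good-X s t ∷ triple-good-X s t′ ∷ triple-good-X s t″ ∷ [])
      ... | _ ∷ _ | τ with ↭.↭-length τ
      ...   | ()

-- Sign patterns and the search that ignores colours.

module Shapes where
  open OrderedField
  open Separation
  open Search
  open import Data.Nat.Base using (ℕ)
  open import Data.Fin.Base using (zero; suc)
  open import Data.List.Base using (List; []; _∷_; _++_; map)
  open import Data.List.Relation.Unary.All as All using (All; []; _∷_)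
  import Data.List.Relation.Unary.All.Properties as All
  open import Data.List.Relation.Unary.AllPairs using ([]; _∷_)
  open import Data.List.Relation.Binary.Permutation.Propositional using (prep)
  open import Data.Product.Base using (_×_; _,_)
  open import Relation.Binary.PropositionalEquality as ≡ using (_≡_)
  open Plane
  open States
  open Runs
  open Sweep
  open RainbowTriples
  open import Data.Bool.Base using (Bool; true; false; _∧_; _∨_; not)
  open import Data.Nat.Base using (zero; suc)

  sign′ : ∀ {A : Set} → Item A → Bool
  sign′ (u _) = true
  sign′ (l _) = false

  signs : ∀ {A : Set} → Word A → List Bool
  signs = map sign′

  same : List Bool → List Bool → Bool
  same []           []           = true
  same (true  ∷ xs) (true  ∷ ys) = same xs ys
  same (false ∷ xs) (false ∷ ys) = same xs ys
  same _            _            = false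

  same-sound : ∀ xs ys → same xs ys ≡ true → xs ≡ ys
  same-sound []           []           e = ≡.refl
  same-sound (true  ∷ xs) (true  ∷ ys) e = ≡.cong (true ∷_) (same-sound xs ys e)
  same-sound (false ∷ xs) (false ∷ ys) e = ≡.cong (false ∷_) (same-sound xs ys e)

  signs-map : ∀ {A B : Set} (g : A → B) w → signs (mapʷ g w) ≡ signs w
  signs-map g []        = ≡.refl
  signs-map g (u _ ∷ w) = ≡.cong (true ∷_) (signs-map g w)
  signs-map g (l _ ∷ w) = ≡.cong (false ∷_) (signs-map g w)

  signs-flip : ∀ {A : Set} (w : Word A) → signs (flip w) ≡ map not (signs w)
  signs-flip []        = ≡.refl
  signs-flip (u _ ∷ w) = ≡.cong (false ∷_) (signs-flip w)
  signs-flip (l _ ∷ w) = ≡.cong (true ∷_) (signs-flip w)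

  signs-~ : ∀ {A : Set} {v w : Word A} → v ~ w → signs v ≡ signs w
  signs-~ ~refl        = ≡.refl
  signs-~ (prep a e)   = ≡.cong (sign′ a ∷_) (signs-~ e)
  signs-~ (swapU x y)  = ≡.refl
  signs-~ (swapL x y)  = ≡.refl
  signs-~ (~trans e f) = ≡.trans (signs-~ e) (signs-~ f)

  ShapeV ShapeX : Set
  ShapeV = List Bool × List Bool
  ShapeX = List Bool

  pattern ▲ = true
  pattern ▼ = false

  -- A crossing reads differently from each of its four arms, so the pattern is compared after every
  -- quarter turn.
  isV : ℕ → List Bool → List Bool → ShapeV → Bool
  isV zero    pre post s = false
  isV (suc k) pre post s@(pre′ , post′) = (same pre pre′ ∧ same post post′) ∨ isV k post (map not pre) s

  cycle : List Bool → List Bool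
  cycle []       = []
  cycle (b ∷ bs) = bs ++ not b ∷ []

  -- At a point the direction in which the reading starts is arbitrary; eighteen single turns, as
  -- used in `anyX`, cover a full revolution past nine points.
  isX : ℕ → List Bool → ShapeX → Bool
  isX zero    w s = false
  isX (suc k) w s = same w s ∨ isX k (cycle w) s

  anyV : List ShapeV → ℕ → ℕ → Word ℕ → ℕ → ℕ → Word ℕ → Bool
  anyV []       f b pre x y post = false
  anyV (s ∷ ss) f b pre x y post = isV 4 (signs pre) (signs post) s ∨ anyV ss f b pre x y post

  anyX : List ShapeX → ℕ → Word ℕ → Bool
  anyX []       q w = false
  anyX (s ∷ ss) q w = isX 18 (signs w) s ∨ anyX ss q w

  -- Up to rotation, every play from the leftmost point reaches one of the roots or extras, and the extras
  -- lead on to the roots; the lists were found by experiment.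
  rootsV extraV : List ShapeV
  rootsV = (▲ ∷ ▼ ∷ ▼ ∷ ▲ ∷ ▲ ∷ ▼ ∷ [] , []) ∷ (▲ ∷ ▼ ∷ ▼ ∷ ▲ ∷ [] , ▲ ∷ ▼ ∷ []) ∷ (▲ ∷ ▼ ∷ ▼ ∷ ▲ ∷ [] , ▼ ∷ ▲ ∷ []) ∷ []
  extraV = (▲ ∷ ▲ ∷ ▼ ∷ [] , ▼ ∷ ▲ ∷ ▲ ∷ []) ∷ (▲ ∷ ▲ ∷ ▼ ∷ ▼ ∷ [] , ▲ ∷ ▲ ∷ []) ∷ (▲ ∷ ▲ ∷ ▼ ∷ ▼ ∷ ▲ ∷ [] , ▲ ∷ []) ∷ (▲ ∷ ▼ ∷ ▲ ∷ ▼ ∷ ▼ ∷ ▲ ∷ [] , []) ∷ []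

  rootsX extraX : List ShapeX
  rootsX = (▲ ∷ ▲ ∷ ▲ ∷ ▼ ∷ ▼ ∷ ▲ ∷ ▼ ∷ ▲ ∷ ▲ ∷ []) ∷ (▲ ∷ ▼ ∷ ▲ ∷ ▼ ∷ ▲ ∷ ▼ ∷ ▲ ∷ ▼ ∷ ▲ ∷ []) ∷ (▲ ∷ ▲ ∷ ▼ ∷ ▲ ∷ ▲ ∷ ▼ ∷ ▼ ∷ ▲ ∷ ▲ ∷ [])
         ∷ (▲ ∷ ▲ ∷ ▲ ∷ ▼ ∷ ▼ ∷ ▼ ∷ ▲ ∷ ▲ ∷ ▲ ∷ []) ∷ (▲ ∷ ▲ ∷ ▼ ∷ ▲ ∷ ▼ ∷ ▲ ∷ ▼ ∷ ▲ ∷ ▲ ∷ []) ∷ []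
  extraX = (▲ ∷ ▲ ∷ ▼ ∷ ▲ ∷ ▼ ∷ ▲ ∷ ▲ ∷ ▼ ∷ ▲ ∷ []) ∷ (▲ ∷ ▲ ∷ ▲ ∷ ▼ ∷ ▲ ∷ ▼ ∷ ▼ ∷ ▲ ∷ ▲ ∷ []) ∷ (▲ ∷ ▲ ∷ ▼ ∷ ▼ ∷ ▲ ∷ ▼ ∷ ▲ ∷ ▲ ∷ ▲ ∷ []) ∷ []

  word : List Bool → Word ℕ
  word []       = []
  word (▲ ∷ bs) = u 0 ∷ word bs
  word (▼ ∷ bs) = l 0 ∷ word bs

  free : ℕ → ℕ → ℕ → Word ℕ → Bool
  free _ _ _ _ = true

  -- All letters carry the same number in these games, so the search within runs collapses and only
  -- the signs are followed.
  module Near = Game free (anyV rootsV) (anyX rootsX)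
  module Far = Game free (anyV (rootsV ++ extraV)) (anyX (rootsX ++ extraX))

  nearV : ShapeV → Bool
  nearV (pre , post) = Near.fromVertex 2 0 0 (word pre) 0 0 (word post)

  nearX : ShapeX → Bool
  nearX s = Near.exploreX 2 10 0 (word s)

  -- The pattern is that of a segment with four points on each side, seen from the leftmost point.
  -- With the word a variable the search is stuck, so it is this `refl` that evaluates it.
  far-start : ∀ w → w ≡ word (▲ ∷ ▲ ∷ ▲ ∷ ▲ ∷ ▼ ∷ ▼ ∷ ▼ ∷ ▼ ∷ []) → Far.path 3 16 0 0 w ≡ true
  far-start _ ≡.refl = ≡.refl

  near-extraV : All (λ s → nearV s ≡ true) extraV
  near-extraV = ≡.refl ∷ ≡.refl ∷ ≡.refl ∷ ≡.refl ∷ []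

  near-extraX : All (λ s → nearX s ≡ true) extraX
  near-extraX = ≡.refl ∷ ≡.refl ∷ ≡.refl ∷ []

-- From the leftmost point to one of the root words.

module FirstStage where
  open OrderedField
  open Separation
  open Search
  open import Level using (_⊔_)
  open import Data.Nat.Base using (ℕ)
  open import Data.Fin.Base using (Fin; zero; suc)
  open import Data.Integer.Base using (+_)
  open import Data.List.Base using (List; []; _∷_; _++_; map; allFin)
  open import Data.List.Properties using (map-++; map-∘)
  open import Data.List.Relation.Unary.All as All using (All; []; _∷_)
  import Data.List.Relation.Unary.All.Properties as All
  open import Data.List.Relation.Unary.Any using (here; there)
  open import Data.List.Relation.Unary.AllPairs as AllPairs using (AllPairs; []; _∷_)
  import Data.List.Relation.Unary.AllPairs.Properties as AllPairs
  open import Data.List.Relation.Binary.Permutation.Propositional using (_↭_; prep; ↭-sym; ↭-trans; ↭-reflexive)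
  import Data.List.Relation.Binary.Permutation.Propositional.Properties as ↭
  open import Data.List.Membership.Propositional using (_∈_)
  import Data.List.Membership.Propositional.Properties as ∈
  open import Data.Product.Base using (_×_; _,_; proj₁; proj₂; ∃-syntax)
  open import Data.Sum.Base using (inj₁; inj₂)
  open import Function.Base using (_∘_)
  open import Relation.Nullary using (¬_)
  open import Relation.Binary.PropositionalEquality as ≡ using (_≡_; _≢_)
  open Plane
  open States
  open Runs
  open Sweep
  open RainbowTriples
  open Shapes
  open import Data.Bool.Base using (true; _∧_)
  open import Data.Nat.Base as ℕ using (zero; suc)
  open import Data.List.Base using (length)
  open import Data.List.Properties using (length-map; map-id)

  word-signs : ∀ {A : Set} (w : Word A) → word (signs w) ≡ mapʷ (λ _ → 0) w
  word-signs []        = ≡.refl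
  word-signs (u _ ∷ w) = ≡.cong (u 0 ∷_) (word-signs w)
  word-signs (l _ ∷ w) = ≡.cong (l 0 ∷_) (word-signs w)

  all-upper : ∀ {A : Set} (w : Word A) (zs : List A) → signs w ≡ map (λ _ → true) zs → ∃[ xs ] w ≡ map u xs
  all-upper []        []       e = [] , ≡.refl
  all-upper (u x ∷ w) (_ ∷ zs) e with all-upper w zs (≡.cong (λ { [] → [] ; (_ ∷ bs) → bs }) e)
  ... | xs , ≡.refl = x ∷ xs , ≡.refl

  signs-u : ∀ {A : Set} (xs : List A) → signs (map u xs) ≡ map (λ _ → true) xs
  signs-u []       = ≡.refl
  signs-u (x ∷ xs) = ≡.cong (true ∷_) (signs-u xs)

  module Roots {r ℓ ℓ₂} (ℝ : RealField r ℓ ℓ₂) (X : Fin 10 → Geometry.Point ℝ) (general : Sums.General ℝ X) where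
    open Vectors ℝ
    open States.States ℝ X general
    open Rotations ℝ X general

    record AtV (s : ShapeV) : Set (r ⊔ ℓ ⊔ ℓ₂) where
      constructor atV
      field
        {p}         : Point
        {f b x y}   : Label
        {pre post}  : Word Label
        vertex      : Vertex p f b pre x y post
        pre-signs   : signs pre ≡ proj₁ s
        post-signs  : signs post ≡ proj₂ s

    record AtX (s : ShapeX) : Set (r ⊔ ℓ ⊔ ℓ₂) where
      constructor atX
      field
        {q}     : Label
        {w}     : Word Label
        xfull   : XFull q w
        w-signs : signs w ≡ s

    isV-sound : ∀ k {p f b pre x y post} s → Vertex p f b pre x y post → isV k (signs pre) (signs post) s ≡ true → AtV s
    isV-sound (suc k) {pre = pre} {post = post} s v e with ∨-split {same (signs pre) (proj₁ s) ∧ same (signs post) (proj₂ s)} e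
    ... | inj₁ e₁ = atV v (same-sound _ _ (proj₁ (∧-split e₁))) (same-sound _ _ (proj₂ (∧-split {same (signs pre) (proj₁ s)} e₁)))
    ... | inj₂ e₂ = isV-sound k s (rotate v) (≡.subst (λ bs → isV k (signs post) bs s ≡ true) (≡.sym (signs-flip pre)) e₂)

    isX-sound : ∀ k {q} w s → XFull q w → isX k (signs w) s ≡ true → AtX s
    isX-sound (suc k) w s xf e with ∨-split {same (signs w) s} e
    ... | inj₁ e₁ = atX xf (same-sound _ _ e₁)
    isX-sound (suc k) []        s xf e | inj₂ e₂ = isX-sound k [] s xf e₂
    isX-sound (suc k) (u x ∷ w) s xf e | inj₂ e₂ = isX-sound k (w ++ l x ∷ []) s (turn xf) (≡.subst (λ bs → isX k bs s ≡ true) (≡.sym (map-++ sign′ w _)) e₂)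
    isX-sound (suc k) (l x ∷ w) s xf e | inj₂ e₂ = isX-sound k (w ++ u x ∷ []) s (turn xf) (≡.subst (λ bs → isX k bs s ≡ true) (≡.sym (map-++ sign′ w _)) e₂)

    anyV-sound : ∀ {ρ} {R : Set ρ} ss → (∀ {s} → s ∈ ss → AtV s → R) → ∀ {p f b pre x y post} → Vertex p f b pre x y post →
                 anyV ss 0 0 (mapʷ (λ _ → 0) pre) 0 0 (mapʷ (λ _ → 0) post) ≡ true → R
    anyV-sound (s ∷ ss) k {pre = pre} {post = post} v e with ∨-split {isV 4 (signs (mapʷ (λ _ → 0) pre)) (signs (mapʷ (λ _ → 0) post)) s} e
    ... | inj₁ e₁ = k (here ≡.refl) (isV-sound 4 s v (≡.subst₂ (λ a b → isV 4 a b s ≡ true) (signs-map (λ _ → 0) pre) (signs-map (λ _ → 0) post) e₁))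
    ... | inj₂ e₂ = anyV-sound ss (k ∘ there) v e₂

    anyX-sound : ∀ {ρ} {R : Set ρ} ss → (∀ {s} → s ∈ ss → AtX s → R) → ∀ {q a w} → XState q a w →
                 anyX ss 0 (mapʷ (λ _ → 0) (a ∷ w)) ≡ true → R
    anyX-sound (s ∷ ss) k {q} {a} {w} x e with ∨-split {isX 18 (signs (mapʷ (λ _ → 0) (a ∷ w))) s} e
    ... | inj₂ e₂ = anyX-sound ss (k ∘ there) x e₂
    ... | inj₁ e₁ with full x
    ...   | v , v~w , xf = k (here ≡.refl) (isX-sound 18 (a ∷ v) s xf (≡.subst (λ bs → isX 18 bs s ≡ true)
              (≡.trans (signs-map (λ _ → 0) (a ∷ w)) (≡.cong (sign′ a ∷_) (≡.sym (signs-~ v~w)))) e₁))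

    leftmost : ∀ {n} (h : Fin (suc n) → Carrier) → ∃[ q ] (∀ i → NN (h i + - h q))
    leftmost {zero} h = zero , λ { zero → NN-≈0 (-‿inverseʳ _) }
    leftmost {suc n} h with leftmost (h ∘ suc)
    ... | q , least with NN-total (h (suc q) + - h zero)
    ...   | inj₁ p = zero , λ { zero → NN-≈0 (-‿inverseʳ _) ; (suc i) → NN-resp (solve 3 (λ a b c → (a :+ :- b) :+ (b :+ :- c) := a :+ :- c) refl (h (suc i)) (h (suc q)) (h zero)) (NN-+ (least i) p) }
    ...   | inj₂ p = suc q , λ { zero → NN-resp (solve 2 (λ a b → :- (a :+ :- b) := b :+ :- a) refl (h (suc q)) (h zero)) p ; (suc i) → least i }

    opaque
      unfolding cross

      cross-down : ∀ a → cross (0# , - 1#) a ≈ proj₁ a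
      cross-down (a₁ , a₂) = trans (solve 3 (λ o a₁ a₂ → con (+ 0) :* a₂ :+ :- (:- o :* a₁) := o :* a₁) refl 1# a₁ a₂) (*-identityˡ a₁)

    module Initial (q : Label) (left : ∀ i → i ≢ q → Pos (proj₁ (X i) + - proj₁ (X q))) (as bs : List Label) (split : allFin 10 ≡ as ++ q ∷ bs) where
      σ : q ∷ as ++ bs ↭ allFin 10
      σ = ↭-trans (↭-sym (↭.shift q as bs)) (↭-reflexive (≡.sym split))

      q≢ : All (q ≢_) (as ++ bs)
      q≢ = AllPairs.head (unique σ)

      left-of : ∀ i → q ≢ i → Pos (cross (0# , - 1#) (vec (X q) i))
      left-of i q≢i = Pos-resp (sym (cross-down (vec (X q) i))) (left i (q≢i ∘ ≡.sym))

      unordered : ∀ xs → Ordered′ (X q) (map u xs)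
      unordered []       = []
      unordered (x ∷ xs) = All.map⁺ (All.tabulate λ _ ()) ∷ unordered xs

      read : ∀ v → v ~ map u (as ++ bs) → Sorted q v → ∃[ xs ] v ≡ map u xs → ∃[ xs ] (length xs ≡ 9 × XFull q (map u xs))
      read _ v~ sorted (xs , ≡.refl) = xs , ≡.cong ℕ.pred (≡.trans (≡.cong suc (≡.sym (≡.trans (length-map label (map u xs)) (length-map u xs)))) (↭.↭-length labels′)) ,
        record { sorted = sorted ; labels = labels′ }
        where
        labels′ : q ∷ map label (map u xs) ↭ allFin 10
        labels′ = ↭-trans (prep q (↭-trans (↭.map⁺ label (~⇒↭ v~)) (↭-reflexive (≡.trans (≡.sym (map-∘ (as ++ bs))) (map-id (as ++ bs)))))) σ

      -- Relative to the downward vector every other point lies to the left, because `q` is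
      -- leftmost; hence all nine letters are upper and a single sort puts them in order.
      sorted-start : ∃[ xs ] (length xs ≡ 9 × XFull q (map u xs))
      sorted-start = open-up (Sort.sort q (0# , - 1#) (map u (as ++ bs)) (All.map⁺ (All.map (λ {i} → left-of i) q≢)) (unordered (as ++ bs))
                       (AllPairs.map⁺ (AllPairs.tail (unique σ))) (All.map⁺ q≢))
        where
        open-up : ∃[ v ] (v ~ map u (as ++ bs) × Sorted q v) → ∃[ xs ] (length xs ≡ 9 × XFull q (map u xs))
        open-up (v , v~ , sorted) = read v v~ sorted (all-upper v (as ++ bs) (≡.trans (signs-~ v~) (signs-u (as ++ bs))))

    initial : (∀ i j → i ≢ j → ¬ (proj₁ (X i) + - proj₁ (X j) ≈ 0#)) → ∃[ q ] ∃[ xs ] (length xs ≡ 9 × XFull q (map u xs))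
    initial spread = found (leftmost (λ i → proj₁ (X i)))
      where
      found : ∃[ q ] (∀ i → NN (proj₁ (X i) + - proj₁ (X q))) → ∃[ q ] ∃[ xs ] (length xs ≡ 9 × XFull q (map u xs))
      found (q , least) = q , go (∈.∈-∃++ (∈.∈-allFin q))
        where
        go : ∃[ as ] ∃[ bs ] allFin 10 ≡ as ++ q ∷ bs → ∃[ xs ] (length xs ≡ 9 × XFull q (map u xs))
        go (as , bs , split) = Initial.sorted-start q (λ i i≢q → least i , spread i q i≢q) as bs split

    module Reaching {ρ} {R : Set ρ} (rootV : ∀ {s} → s ∈ rootsV → AtV s → R) (rootX : ∀ {s} → s ∈ rootsX → AtX s → R) where
      module NearSound = Soundness free (anyV rootsV) (anyX rootsX) (λ _ → 0) R (anyV-sound rootsV rootV) (anyX-sound rootsX rootX)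

      nearV-sound : ∀ {s} → nearV s ≡ true → AtV s → R
      nearV-sound e (atV {pre = pre} {post} v ≡.refl ≡.refl) =
        NearSound.fromVertex-sound 2 v (≡.subst₂ (λ a b → Near.fromVertex 2 0 0 a 0 0 b ≡ true) (word-signs pre) (word-signs post) e)

      nearX-sound : ∀ {s} → nearX s ≡ true → AtX s → R
      nearX-sound e (atX {w = w} xf ≡.refl) = NearSound.exploreX-sound 2 10 xf (~-reflexive (word-signs w)) e

      -- Reaching an extra shape is not the end: the `Near` game leads on from it to a root.
      everyV : ∀ {s} → s ∈ rootsV ++ extraV → AtV s → R
      everyV s∈ with ∈.∈-++⁻ rootsV s∈
      ... | inj₁ m = rootV m
      ... | inj₂ m = nearV-sound (All.lookup near-extraV m)

      everyX : ∀ {s} → s ∈ rootsX ++ extraX → AtX s → R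
      everyX s∈ with ∈.∈-++⁻ rootsX s∈
      ... | inj₁ m = rootX m
      ... | inj₂ m = nearX-sound (All.lookup near-extraX m)

      module FarSound = Soundness free (anyV (rootsV ++ extraV)) (anyX (rootsX ++ extraX)) (λ _ → 0) R
        (anyV-sound (rootsV ++ extraV) everyV) (anyX-sound (rootsX ++ extraX) everyX)

      begin : ∀ {p f b w} → Flat p f b w → mapʷ (λ _ → 0) w ≡ word (▲ ∷ ▲ ∷ ▲ ∷ ▲ ∷ ▼ ∷ ▼ ∷ ▼ ∷ ▼ ∷ []) → R
      begin flat e = FarSound.path-sound 3 16 flat (far-start _ e)

      finish : ∀ {q} xs → length xs ≡ 9 → XFull q (map u xs) → R
      -- Four turns bring the fifth of the nine directions to the front, so the first segment leads
      -- to the angular median, with four points on either side.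
      finish (_ ∷ _ ∷ _ ∷ _ ∷ _ ∷ _ ∷ _ ∷ _ ∷ _ ∷ []) ≡.refl xf = begin (leave (turn (turn (turn (turn xf))))) ≡.refl

-- From the root words to rainbow partitions.

module SecondStage where
  open OrderedField
  open Separation
  open Search
  open import Data.Nat.Base using (ℕ)
  open import Data.Fin using (Fin; suc)
  open import Data.Integer.Base using (+_)
  open import Data.List.Base using (List; []; _∷_; _++_; map; allFin)
  open import Data.List.Properties using (map-++)
  open import Data.List.Relation.Unary.All using ([]; _∷_)
  open import Data.List.Relation.Unary.Any using (here; there)
  open import Data.List.Relation.Unary.AllPairs as AllPairs using (AllPairs; []; _∷_)
  import Data.List.Relation.Unary.AllPairs.Properties as AllPairs
  open import Data.List.Relation.Binary.Permutation.Propositional using (_↭_)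
  import Data.List.Relation.Binary.Permutation.Propositional.Properties as ↭
  open import Data.List.Membership.Propositional using (_∈_)
  import Data.List.Membership.Propositional.Properties as ∈
  import Data.Product.Base as Σ
  open import Data.Product.Base using (_×_; _,_; proj₁; ∃-syntax)
  open import Data.Sum.Base using ([_,_]′)
  open import Relation.Nullary using (¬_)
  open import Relation.Binary.PropositionalEquality as ≡ using (_≡_; _≢_)
  open Plane
  open States
  open Runs
  open Sweep
  open RainbowTriples
  open Shapes
  open FirstStage
  open import Data.Bool.Base using (Bool; true; false; _∧_)
  open import Data.Nat.Base as ℕ using (suc)
  open import Data.List.Base using (length)
  open import Data.Vec.Base using (Vec; []; _∷_)

  record Eight (a b c d e f g h : Bool) : Set where
    constructor eight
    field
      conjunct₁ : a ≡ true
      conjunct₂ : b ≡ true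
      conjunct₃ : c ≡ true
      conjunct₄ : d ≡ true
      conjunct₅ : e ≡ true
      conjunct₆ : f ≡ true
      conjunct₇ : g ≡ true
      conjunct₈ : h ≡ true
  open Eight

  allWin-split : ∀ w → allWin w ≡ true → Eight (win₁ w) (win₂ w) (win₃ w) (win₄ w) (win₅ w) (win₆ w) (win₇ w) (win₈ w)
  allWin-split w = split (win₁ w) (win₂ w) (win₃ w) (win₄ w) (win₅ w) (win₆ w) (win₇ w) (win₈ w)
    where
    split : ∀ a b c d e f g h → (a ∧ (b ∧ (c ∧ (d ∧ (e ∧ (f ∧ (g ∧ h))))))) ≡ true → Eight a b c d e f g h
    split true true true true true true true true _ = eight ≡.refl ≡.refl ≡.refl ≡.refl ≡.refl ≡.refl ≡.refl ≡.refl

  allWin⇒₁ : ∀ a b c d e f g h i j → allWin (a ∷ b ∷ c ∷ d ∷ e ∷ f ∷ g ∷ h ∷ i ∷ j ∷ []) ≡ true → winV a b (u e ∷ l f ∷ l g ∷ u h ∷ u i ∷ l j ∷ []) c d [] ≡ true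
  allWin⇒₁ a b c d e f g h i j w = conjunct₁ (allWin-split (a ∷ b ∷ c ∷ d ∷ e ∷ f ∷ g ∷ h ∷ i ∷ j ∷ []) w)

  allWin⇒₂ : ∀ a b c d e f g h i j → allWin (a ∷ b ∷ c ∷ d ∷ e ∷ f ∷ g ∷ h ∷ i ∷ j ∷ []) ≡ true → winV a b (u e ∷ l f ∷ l g ∷ u h ∷ []) c d (u i ∷ l j ∷ []) ≡ true
  allWin⇒₂ a b c d e f g h i j w = conjunct₂ (allWin-split (a ∷ b ∷ c ∷ d ∷ e ∷ f ∷ g ∷ h ∷ i ∷ j ∷ []) w)

  allWin⇒₃ : ∀ a b c d e f g h i j → allWin (a ∷ b ∷ c ∷ d ∷ e ∷ f ∷ g ∷ h ∷ i ∷ j ∷ []) ≡ true → winV a b (u e ∷ l f ∷ l g ∷ u h ∷ []) c d (l i ∷ u j ∷ []) ≡ true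
  allWin⇒₃ a b c d e f g h i j w = conjunct₃ (allWin-split (a ∷ b ∷ c ∷ d ∷ e ∷ f ∷ g ∷ h ∷ i ∷ j ∷ []) w)

  allWin⇒₄ : ∀ a b c d e f g h i j → allWin (a ∷ b ∷ c ∷ d ∷ e ∷ f ∷ g ∷ h ∷ i ∷ j ∷ []) ≡ true → winX a (u b ∷ u c ∷ u d ∷ l e ∷ l f ∷ u g ∷ l h ∷ u i ∷ u j ∷ []) ≡ true
  allWin⇒₄ a b c d e f g h i j w = conjunct₄ (allWin-split (a ∷ b ∷ c ∷ d ∷ e ∷ f ∷ g ∷ h ∷ i ∷ j ∷ []) w)

  allWin⇒₅ : ∀ a b c d e f g h i j → allWin (a ∷ b ∷ c ∷ d ∷ e ∷ f ∷ g ∷ h ∷ i ∷ j ∷ []) ≡ true → winX a (u b ∷ l c ∷ u d ∷ l e ∷ u f ∷ l g ∷ u h ∷ l i ∷ u j ∷ []) ≡ true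
  allWin⇒₅ a b c d e f g h i j w = conjunct₅ (allWin-split (a ∷ b ∷ c ∷ d ∷ e ∷ f ∷ g ∷ h ∷ i ∷ j ∷ []) w)

  allWin⇒₆ : ∀ a b c d e f g h i j → allWin (a ∷ b ∷ c ∷ d ∷ e ∷ f ∷ g ∷ h ∷ i ∷ j ∷ []) ≡ true → winX a (u b ∷ u c ∷ l d ∷ u e ∷ u f ∷ l g ∷ l h ∷ u i ∷ u j ∷ []) ≡ true
  allWin⇒₆ a b c d e f g h i j w = conjunct₆ (allWin-split (a ∷ b ∷ c ∷ d ∷ e ∷ f ∷ g ∷ h ∷ i ∷ j ∷ []) w)

  allWin⇒₇ : ∀ a b c d e f g h i j → allWin (a ∷ b ∷ c ∷ d ∷ e ∷ f ∷ g ∷ h ∷ i ∷ j ∷ []) ≡ true → winX a (u b ∷ u c ∷ u d ∷ l e ∷ l f ∷ l g ∷ u h ∷ u i ∷ u j ∷ []) ≡ true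
  allWin⇒₇ a b c d e f g h i j w = conjunct₇ (allWin-split (a ∷ b ∷ c ∷ d ∷ e ∷ f ∷ g ∷ h ∷ i ∷ j ∷ []) w)

  allWin⇒₈ : ∀ a b c d e f g h i j → allWin (a ∷ b ∷ c ∷ d ∷ e ∷ f ∷ g ∷ h ∷ i ∷ j ∷ []) ≡ true → winX a (u b ∷ u c ∷ l d ∷ u e ∷ l f ∷ u g ∷ l h ∷ u i ∷ u j ∷ []) ≡ true
  allWin⇒₈ a b c d e f g h i j w = conjunct₈ (allWin-split (a ∷ b ∷ c ∷ d ∷ e ∷ f ∷ g ∷ h ∷ i ∷ j ∷ []) w)

  spell : ∀ {A : Set} (bs : List Bool) → Vec A (length bs) → Word A
  spell []           []       = []
  spell (true  ∷ bs) (x ∷ xs) = u x ∷ spell bs xs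
  spell (false ∷ bs) (x ∷ xs) = l x ∷ spell bs xs

  recover : ∀ {A : Set} {bs} {w : Word A} → signs w ≡ bs → ∃[ xs ] w ≡ spell bs xs
  recover {w = w} ≡.refl = go w
    where
    go : ∀ {A : Set} (w : Word A) → ∃[ xs ] w ≡ spell (signs w) xs
    go []        = [] , ≡.refl
    go (u x ∷ w) = Σ.map (x ∷_) (≡.cong (u x ∷_)) (go w)
    go (l x ∷ w) = Σ.map (x ∷_) (≡.cong (l x ∷_)) (go w)

  module Winning {r ℓ ℓ₂} (ℝ : RealField r ℓ ℓ₂) (X : Fin 10 → Geometry.Point ℝ) (general : Sums.General ℝ X) (g : Fin 10 → ℕ) where
    open Vectors ℝ
    open States.States ℝ X general
    open Rotations ℝ X general
    open Rainbow ℝ X general g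
    open Soundness colPrune colV colX g Solution colV-sound colX-sound

    deepenV-sound : ∀ k n {p f b pre x y post} → Vertex p f b pre x y post → deepenV k n (g f) (g b) (mapʷ g pre) (g x) (g y) (mapʷ g post) ≡ true → Solution
    deepenV-sound (suc k) n {f = f} {b} {pre} {x} {y} {post} v e =
      [ fromVertex-sound n v , deepenV-sound k (suc n) v ]′ (∨-split {Col.fromVertex n (g f) (g b) (mapʷ g pre) (g x) (g y) (mapʷ g post)} e)

    winV-sound : ∀ {p f b pre x y post} → Vertex p f b pre x y post → ∀ v w → mapʷ g pre ≡ v → mapʷ g post ≡ w → winV (g f) (g b) v (g x) (g y) w ≡ true → Solution
    winV-sound {f = f} {b} {pre} {x} {y} {post} v _ _ ≡.refl ≡.refl e =
      [ colV-sound v , deepenV-sound 6 0 v ]′ (∨-split {colV (g f) (g b) (mapʷ g pre) (g x) (g y) (mapʷ g post)} e)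

    rootX-sound : ∀ n k {q} w → XFull q w → rootX n k (g q) (mapʷ g w) ≡ true → Solution
    rootX-sound n (suc k) {q} (u x ∷ w) xf e =
      [ path-sound n 16 (leave xf) ,
        (λ e′ → rootX-sound n k (w ++ l x ∷ []) (turn xf) (≡.subst (λ v → rootX n k (g q) v ≡ true) (≡.sym (map-++ (mapᵢ g) w (l x ∷ []))) e′)) ]′
      (∨-split {Col.path n 16 (g x) (g q) (mapʷ g w)} e)
    rootX-sound n (suc k) {q} (l x ∷ w) xf e =
      rootX-sound n k (w ++ u x ∷ []) (turn xf) (≡.subst (λ v → rootX n k (g q) v ≡ true) (≡.sym (map-++ (mapᵢ g) w (u x ∷ []))) e)

    deepenX-sound : ∀ k n {q w} → XFull q w → deepenX k n (g q) (mapʷ g w) ≡ true → Solution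
    deepenX-sound (suc k) n {q} {w} xf e = [ rootX-sound n 18 w xf , deepenX-sound k (suc n) xf ]′ (∨-split {rootX n 18 (g q) (mapʷ g w)} e)

    winX-sound : ∀ {q a w} → XFull q (a ∷ w) → ∀ v → mapʷ g (a ∷ w) ≡ v → winX (g q) v ≡ true → Solution
    winX-sound {q} {a} {w} xf _ ≡.refl e = [ colX-sound state , deepenX-sound 6 0 xf ]′ (∨-split {colX (g q) (mapʷ g (a ∷ w))} e)
      where
      open XFull xf
      state : XState q a w
      state = record { ahead = AllPairs.head sorted ; ordered = AllPairs.map (λ h _ → proj₁ h) (AllPairs.tail sorted) ; labels = labels }

  module Plan {r ℓ ℓ₂} (ℝ : RealField r ℓ ℓ₂) (X : Fin 10 → Geometry.Point ℝ) (general : Sums.General ℝ X) where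
    open Vectors ℝ
    open States.States ℝ X general
    open Rotations ℝ X general
    open Roots ℝ X general

    -- The root word is found before any colouring is considered, so one ordering of the labels
    -- serves every `g`. Since that ordering is unknown in advance, the enumeration has to cover all
    -- colourings of its ten positions.
    Wins : List Label → Set _
    Wins is = ∀ g w → w ≡ map g is → allWin w ≡ true → Rainbow.Solution ℝ X general g

    Plan : Set _
    Plan = ∃[ is ] (is ↭ allFin 10 × Wins is)

    winsV₁ : ∀ {p a b c d e f g h i j} → Vertex p a b (u e ∷ l f ∷ l g ∷ u h ∷ u i ∷ l j ∷ []) c d [] → Wins (a ∷ b ∷ c ∷ d ∷ e ∷ f ∷ g ∷ h ∷ i ∷ j ∷ [])
    winsV₁ {p} {a} {b} {c} {d} {e} {f} {g} {h} {i} {j} v γ w eq win =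
      Winning.winV-sound ℝ X general γ v (u (γ e) ∷ l (γ f) ∷ l (γ g) ∷ u (γ h) ∷ u (γ i) ∷ l (γ j) ∷ []) [] ≡.refl ≡.refl (allWin⇒₁ (γ a) (γ b) (γ c) (γ d) (γ e) (γ f) (γ g) (γ h) (γ i) (γ j) (≡.subst (λ w → allWin w ≡ true) eq win))

    rootV₁ : AtV (▲ ∷ ▼ ∷ ▼ ∷ ▲ ∷ ▲ ∷ ▼ ∷ [] , []) → Plan
    rootV₁ (atV v r s) = build v (recover r) (recover s)
      where
      build : ∀ {p a b c d pre post} → Vertex p a b pre c d post → ∃[ xs ] pre ≡ spell (▲ ∷ ▼ ∷ ▼ ∷ ▲ ∷ ▲ ∷ ▼ ∷ []) xs → ∃[ ys ] post ≡ spell [] ys → Plan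
      build {a = a} {b} {c} {d} v (e ∷ f ∷ g ∷ h ∷ i ∷ j ∷ [] , ≡.refl) ([] , ≡.refl) = a ∷ b ∷ c ∷ d ∷ e ∷ f ∷ g ∷ h ∷ i ∷ j ∷ [] , Vertex.labels v , winsV₁ v

    winsV₂ : ∀ {p a b c d e f g h i j} → Vertex p a b (u e ∷ l f ∷ l g ∷ u h ∷ []) c d (u i ∷ l j ∷ []) → Wins (a ∷ b ∷ c ∷ d ∷ e ∷ f ∷ g ∷ h ∷ i ∷ j ∷ [])
    winsV₂ {p} {a} {b} {c} {d} {e} {f} {g} {h} {i} {j} v γ w eq win =
      Winning.winV-sound ℝ X general γ v (u (γ e) ∷ l (γ f) ∷ l (γ g) ∷ u (γ h) ∷ []) (u (γ i) ∷ l (γ j) ∷ []) ≡.refl ≡.refl (allWin⇒₂ (γ a) (γ b) (γ c) (γ d) (γ e) (γ f) (γ g) (γ h) (γ i) (γ j) (≡.subst (λ w → allWin w ≡ true) eq win))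

    rootV₂ : AtV (▲ ∷ ▼ ∷ ▼ ∷ ▲ ∷ [] , ▲ ∷ ▼ ∷ []) → Plan
    rootV₂ (atV v r s) = build v (recover r) (recover s)
      where
      build : ∀ {p a b c d pre post} → Vertex p a b pre c d post → ∃[ xs ] pre ≡ spell (▲ ∷ ▼ ∷ ▼ ∷ ▲ ∷ []) xs → ∃[ ys ] post ≡ spell (▲ ∷ ▼ ∷ []) ys → Plan
      build {a = a} {b} {c} {d} v (e ∷ f ∷ g ∷ h ∷ [] , ≡.refl) (i ∷ j ∷ [] , ≡.refl) = a ∷ b ∷ c ∷ d ∷ e ∷ f ∷ g ∷ h ∷ i ∷ j ∷ [] , Vertex.labels v , winsV₂ v

    winsV₃ : ∀ {p a b c d e f g h i j} → Vertex p a b (u e ∷ l f ∷ l g ∷ u h ∷ []) c d (l i ∷ u j ∷ []) → Wins (a ∷ b ∷ c ∷ d ∷ e ∷ f ∷ g ∷ h ∷ i ∷ j ∷ [])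
    winsV₃ {p} {a} {b} {c} {d} {e} {f} {g} {h} {i} {j} v γ w eq win =
      Winning.winV-sound ℝ X general γ v (u (γ e) ∷ l (γ f) ∷ l (γ g) ∷ u (γ h) ∷ []) (l (γ i) ∷ u (γ j) ∷ []) ≡.refl ≡.refl (allWin⇒₃ (γ a) (γ b) (γ c) (γ d) (γ e) (γ f) (γ g) (γ h) (γ i) (γ j) (≡.subst (λ w → allWin w ≡ true) eq win))

    rootV₃ : AtV (▲ ∷ ▼ ∷ ▼ ∷ ▲ ∷ [] , ▼ ∷ ▲ ∷ []) → Plan
    rootV₃ (atV v r s) = build v (recover r) (recover s)
      where
      build : ∀ {p a b c d pre post} → Vertex p a b pre c d post → ∃[ xs ] pre ≡ spell (▲ ∷ ▼ ∷ ▼ ∷ ▲ ∷ []) xs → ∃[ ys ] post ≡ spell (▼ ∷ ▲ ∷ []) ys → Plan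
      build {a = a} {b} {c} {d} v (e ∷ f ∷ g ∷ h ∷ [] , ≡.refl) (i ∷ j ∷ [] , ≡.refl) = a ∷ b ∷ c ∷ d ∷ e ∷ f ∷ g ∷ h ∷ i ∷ j ∷ [] , Vertex.labels v , winsV₃ v

    winsX₁ : ∀ {a b c d e f g h i j} → XFull a (u b ∷ u c ∷ u d ∷ l e ∷ l f ∷ u g ∷ l h ∷ u i ∷ u j ∷ []) → Wins (a ∷ b ∷ c ∷ d ∷ e ∷ f ∷ g ∷ h ∷ i ∷ j ∷ [])
    winsX₁ {a} {b} {c} {d} {e} {f} {g} {h} {i} {j} v γ w eq win =
      Winning.winX-sound ℝ X general γ v (u (γ b) ∷ u (γ c) ∷ u (γ d) ∷ l (γ e) ∷ l (γ f) ∷ u (γ g) ∷ l (γ h) ∷ u (γ i) ∷ u (γ j) ∷ []) ≡.refl (allWin⇒₄ (γ a) (γ b) (γ c) (γ d) (γ e) (γ f) (γ g) (γ h) (γ i) (γ j) (≡.subst (λ w → allWin w ≡ true) eq win))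

    rootX₁ : AtX (▲ ∷ ▲ ∷ ▲ ∷ ▼ ∷ ▼ ∷ ▲ ∷ ▼ ∷ ▲ ∷ ▲ ∷ []) → Plan
    rootX₁ (atX v r) = build v (recover r)
      where
      build : ∀ {a w} → XFull a w → ∃[ xs ] w ≡ spell (▲ ∷ ▲ ∷ ▲ ∷ ▼ ∷ ▼ ∷ ▲ ∷ ▼ ∷ ▲ ∷ ▲ ∷ []) xs → Plan
      build {a} v (b ∷ c ∷ d ∷ e ∷ f ∷ g ∷ h ∷ i ∷ j ∷ [] , ≡.refl) = a ∷ b ∷ c ∷ d ∷ e ∷ f ∷ g ∷ h ∷ i ∷ j ∷ [] , XFull.labels v , winsX₁ v

    winsX₂ : ∀ {a b c d e f g h i j} → XFull a (u b ∷ l c ∷ u d ∷ l e ∷ u f ∷ l g ∷ u h ∷ l i ∷ u j ∷ []) → Wins (a ∷ b ∷ c ∷ d ∷ e ∷ f ∷ g ∷ h ∷ i ∷ j ∷ [])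
    winsX₂ {a} {b} {c} {d} {e} {f} {g} {h} {i} {j} v γ w eq win =
      Winning.winX-sound ℝ X general γ v (u (γ b) ∷ l (γ c) ∷ u (γ d) ∷ l (γ e) ∷ u (γ f) ∷ l (γ g) ∷ u (γ h) ∷ l (γ i) ∷ u (γ j) ∷ []) ≡.refl (allWin⇒₅ (γ a) (γ b) (γ c) (γ d) (γ e) (γ f) (γ g) (γ h) (γ i) (γ j) (≡.subst (λ w → allWin w ≡ true) eq win))

    rootX₂ : AtX (▲ ∷ ▼ ∷ ▲ ∷ ▼ ∷ ▲ ∷ ▼ ∷ ▲ ∷ ▼ ∷ ▲ ∷ []) → Plan
    rootX₂ (atX v r) = build v (recover r)
      where
      build : ∀ {a w} → XFull a w → ∃[ xs ] w ≡ spell (▲ ∷ ▼ ∷ ▲ ∷ ▼ ∷ ▲ ∷ ▼ ∷ ▲ ∷ ▼ ∷ ▲ ∷ []) xs → Plan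
      build {a} v (b ∷ c ∷ d ∷ e ∷ f ∷ g ∷ h ∷ i ∷ j ∷ [] , ≡.refl) = a ∷ b ∷ c ∷ d ∷ e ∷ f ∷ g ∷ h ∷ i ∷ j ∷ [] , XFull.labels v , winsX₂ v

    winsX₃ : ∀ {a b c d e f g h i j} → XFull a (u b ∷ u c ∷ l d ∷ u e ∷ u f ∷ l g ∷ l h ∷ u i ∷ u j ∷ []) → Wins (a ∷ b ∷ c ∷ d ∷ e ∷ f ∷ g ∷ h ∷ i ∷ j ∷ [])
    winsX₃ {a} {b} {c} {d} {e} {f} {g} {h} {i} {j} v γ w eq win =
      Winning.winX-sound ℝ X general γ v (u (γ b) ∷ u (γ c) ∷ l (γ d) ∷ u (γ e) ∷ u (γ f) ∷ l (γ g) ∷ l (γ h) ∷ u (γ i) ∷ u (γ j) ∷ []) ≡.refl (allWin⇒₆ (γ a) (γ b) (γ c) (γ d) (γ e) (γ f) (γ g) (γ h) (γ i) (γ j) (≡.subst (λ w → allWin w ≡ true) eq win))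

    rootX₃ : AtX (▲ ∷ ▲ ∷ ▼ ∷ ▲ ∷ ▲ ∷ ▼ ∷ ▼ ∷ ▲ ∷ ▲ ∷ []) → Plan
    rootX₃ (atX v r) = build v (recover r)
      where
      build : ∀ {a w} → XFull a w → ∃[ xs ] w ≡ spell (▲ ∷ ▲ ∷ ▼ ∷ ▲ ∷ ▲ ∷ ▼ ∷ ▼ ∷ ▲ ∷ ▲ ∷ []) xs → Plan
      build {a} v (b ∷ c ∷ d ∷ e ∷ f ∷ g ∷ h ∷ i ∷ j ∷ [] , ≡.refl) = a ∷ b ∷ c ∷ d ∷ e ∷ f ∷ g ∷ h ∷ i ∷ j ∷ [] , XFull.labels v , winsX₃ v

    winsX₄ : ∀ {a b c d e f g h i j} → XFull a (u b ∷ u c ∷ u d ∷ l e ∷ l f ∷ l g ∷ u h ∷ u i ∷ u j ∷ []) → Wins (a ∷ b ∷ c ∷ d ∷ e ∷ f ∷ g ∷ h ∷ i ∷ j ∷ [])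
    winsX₄ {a} {b} {c} {d} {e} {f} {g} {h} {i} {j} v γ w eq win =
      Winning.winX-sound ℝ X general γ v (u (γ b) ∷ u (γ c) ∷ u (γ d) ∷ l (γ e) ∷ l (γ f) ∷ l (γ g) ∷ u (γ h) ∷ u (γ i) ∷ u (γ j) ∷ []) ≡.refl (allWin⇒₇ (γ a) (γ b) (γ c) (γ d) (γ e) (γ f) (γ g) (γ h) (γ i) (γ j) (≡.subst (λ w → allWin w ≡ true) eq win))

    rootX₄ : AtX (▲ ∷ ▲ ∷ ▲ ∷ ▼ ∷ ▼ ∷ ▼ ∷ ▲ ∷ ▲ ∷ ▲ ∷ []) → Plan
    rootX₄ (atX v r) = build v (recover r)
      where
      build : ∀ {a w} → XFull a w → ∃[ xs ] w ≡ spell (▲ ∷ ▲ ∷ ▲ ∷ ▼ ∷ ▼ ∷ ▼ ∷ ▲ ∷ ▲ ∷ ▲ ∷ []) xs → Plan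
      build {a} v (b ∷ c ∷ d ∷ e ∷ f ∷ g ∷ h ∷ i ∷ j ∷ [] , ≡.refl) = a ∷ b ∷ c ∷ d ∷ e ∷ f ∷ g ∷ h ∷ i ∷ j ∷ [] , XFull.labels v , winsX₄ v

    winsX₅ : ∀ {a b c d e f g h i j} → XFull a (u b ∷ u c ∷ l d ∷ u e ∷ l f ∷ u g ∷ l h ∷ u i ∷ u j ∷ []) → Wins (a ∷ b ∷ c ∷ d ∷ e ∷ f ∷ g ∷ h ∷ i ∷ j ∷ [])
    winsX₅ {a} {b} {c} {d} {e} {f} {g} {h} {i} {j} v γ w eq win =
      Winning.winX-sound ℝ X general γ v (u (γ b) ∷ u (γ c) ∷ l (γ d) ∷ u (γ e) ∷ l (γ f) ∷ u (γ g) ∷ l (γ h) ∷ u (γ i) ∷ u (γ j) ∷ []) ≡.refl (allWin⇒₈ (γ a) (γ b) (γ c) (γ d) (γ e) (γ f) (γ g) (γ h) (γ i) (γ j) (≡.subst (λ w → allWin w ≡ true) eq win))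

    rootX₅ : AtX (▲ ∷ ▲ ∷ ▼ ∷ ▲ ∷ ▼ ∷ ▲ ∷ ▼ ∷ ▲ ∷ ▲ ∷ []) → Plan
    rootX₅ (atX v r) = build v (recover r)
      where
      build : ∀ {a w} → XFull a w → ∃[ xs ] w ≡ spell (▲ ∷ ▲ ∷ ▼ ∷ ▲ ∷ ▼ ∷ ▲ ∷ ▼ ∷ ▲ ∷ ▲ ∷ []) xs → Plan
      build {a} v (b ∷ c ∷ d ∷ e ∷ f ∷ g ∷ h ∷ i ∷ j ∷ [] , ≡.refl) = a ∷ b ∷ c ∷ d ∷ e ∷ f ∷ g ∷ h ∷ i ∷ j ∷ [] , XFull.labels v , winsX₅ v

    rootV : ∀ {s} → s ∈ rootsV → AtV s → Plan
    rootV (here ≡.refl) = rootV₁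
    rootV (there (here ≡.refl)) = rootV₂
    rootV (there (there (here ≡.refl))) = rootV₃

    rootX′ : ∀ {s} → s ∈ rootsX → AtX s → Plan
    rootX′ (here ≡.refl) = rootX₁
    rootX′ (there (here ≡.refl)) = rootX₂
    rootX′ (there (there (here ≡.refl))) = rootX₃
    rootX′ (there (there (there (here ≡.refl)))) = rootX₄
    rootX′ (there (there (there (there (here ≡.refl))))) = rootX₅

    plan : (∀ i j → i ≢ j → ¬ (proj₁ (X i) + - proj₁ (X j) ≈ 0#)) → Plan
    plan spread = run (initial spread)
      where
      run : ∃[ q ] ∃[ xs ] (length xs ≡ 9 × XFull q (map u xs)) → Plan
      run (q , xs , nine , xf) = Reaching.finish rootV rootX′ xs nine xf

-- Reduction of arbitrary colourings to the enumerated ones.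

module Colourings where
  open Search
  open Runs
  open RainbowTriples using (≡ᵇ-≢; not-true; if-false)
  open import Data.Bool.Base using (Bool; true; false; _∧_; not; if_then_else_)
  open import Data.Nat.Base as ℕ using (ℕ; zero; suc; _+_; _≤_; _<_; _≡ᵇ_; _<ᵇ_; z≤n; s≤s)
  import Data.Nat.Properties as ℕ
  open import Data.Nat.ListAction using (sum)
  open import Data.Nat.Induction using (<-wellFounded)
  open import Induction.WellFounded using (Acc; acc)
  open import Data.Fin.Base as Fin using (Fin; toℕ; fromℕ<)
  import Data.Fin.Properties as Fin
  open import Data.List.Base using (List; []; _∷_; map; length; filter; _ʳ++_; allFin)
  open import Data.List.Properties using (map-∘; map-id; length-map; reverse-map)
  open import Data.List.Relation.Unary.Any using (here; there; any?)
  open import Data.List.Membership.Propositional using (_∈_; find; lose)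
  import Data.List.Membership.Propositional.Properties as ∈
  open import Data.List.Relation.Binary.Permutation.Propositional using (_↭_; ↭-sym; refl; prep; swap; trans)
  import Data.List.Relation.Binary.Permutation.Propositional.Properties as ↭
  open import Data.Product.Base using (_×_; _,_; proj₁; proj₂; ∃-syntax)
  open import Data.Sum.Base using (inj₁; inj₂)
  open import Function.Base using (_∘_; id)
  open import Relation.Nullary using (¬_; yes; no; contradiction)
  open import Relation.Nullary.Decidable using (_×-dec_)
  open import Relation.Binary.Definitions using (tri<; tri≈; tri>)
  open import Relation.Binary.PropositionalEquality as ≡ using (_≡_; _≢_)

  count-here : ∀ x ys → count x (x ∷ ys) ≡ suc (count x ys)
  count-here x ys rewrite ≡ᵇ-refl x = ≡.refl

  count-there : ∀ {x y} ys → x ≢ y → count x (y ∷ ys) ≡ count x ys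
  count-there ys x≢y rewrite ≡ᵇ-false x≢y = ≡.refl

  count-map : ∀ (ψ : ℕ → ℕ) x ys → (∀ {y} → y ∈ ys → ψ x ≡ ψ y → x ≡ y) → count (ψ x) (map ψ ys) ≡ count x ys
  count-map ψ x []       inj = ≡.refl
  count-map ψ x (y ∷ ys) inj with x ℕ.≟ y
  ... | yes ≡.refl = ≡.trans (count-here (ψ x) (map ψ ys)) (≡.trans (≡.cong suc (count-map ψ x ys (inj ∘ there))) (≡.sym (count-here x ys)))
  ... | no x≢y = ≡.trans (count-there (map ψ ys) (x≢y ∘ inj (here ≡.refl))) (≡.trans (count-map ψ x ys (inj ∘ there)) (≡.sym (count-there ys x≢y)))

  count-ʳ++ : ∀ x ys zs → count x (ys ʳ++ zs) ≡ count x ys + count x zs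
  count-ʳ++ x []       zs = ≡.refl
  count-ʳ++ x (y ∷ ys) zs with x ℕ.≟ y
  ... | yes ≡.refl = ≡.trans (count-ʳ++ x ys (x ∷ zs)) (≡.trans (≡.cong (count x ys +_) (count-here x zs))
                       (≡.trans (ℕ.+-suc (count x ys) (count x zs)) (≡.cong (_+ count x zs) (≡.sym (count-here x ys)))))
  ... | no x≢y = ≡.trans (count-ʳ++ x ys (y ∷ zs)) (≡.trans (≡.cong (count x ys +_) (count-there zs x≢y)) (≡.cong (_+ count x zs) (≡.sym (count-there ys x≢y))))

  count-↭ : ∀ x {ys zs} → ys ↭ zs → count x ys ≡ count x zs
  count-↭ x refl = ≡.refl
  count-↭ x (prep y σ) = ≡.cong (λ n → if x ≡ᵇ y then suc n else n) (count-↭ x σ)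
  count-↭ x (trans σ τ) = ≡.trans (count-↭ x σ) (count-↭ x τ)
  count-↭ x (swap y z σ) with x ≡ᵇ y | x ≡ᵇ z
  ... | true  | true  = ≡.cong (suc ∘ suc) (count-↭ x σ)
  ... | true  | false = ≡.cong suc (count-↭ x σ)
  ... | false | true  = ≡.cong suc (count-↭ x σ)
  ... | false | false = count-↭ x σ

  -- `Tight` expresses that no two classes could be merged without exceeding three points; it
  -- excludes exactly what `loose` skips.
  Small Tight : List ℕ → Set
  Small cs = ∀ x → count x cs ≤ 3
  Tight cs = ∀ {x y} → x ∈ cs → y ∈ cs → x ≢ y → 3 < count x cs + count y cs

  module Merge (x y : ℕ) (x≢y : x ≢ y) where
    merge : ℕ → ℕ
    merge z = if z ≡ᵇ x then y else z

    merge-x : merge x ≡ y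
    merge-x rewrite ≡ᵇ-refl x = ≡.refl

    merge-≢ : ∀ {z} → z ≢ x → merge z ≡ z
    merge-≢ z≢x rewrite ≡ᵇ-false z≢x = ≡.refl

    count-merged : ∀ cs → count y (map merge cs) ≡ count x cs + count y cs
    count-merged [] = ≡.refl
    count-merged (z ∷ cs) with z ℕ.≟ x | z ℕ.≟ y
    ... | yes ≡.refl | yes ≡.refl = contradiction ≡.refl x≢y
    ... | yes ≡.refl | no z≢y = ≡.trans (≡.cong (λ v → count y (v ∷ map merge cs)) merge-x) (≡.trans (count-here y (map merge cs)) (≡.trans (≡.cong suc (count-merged cs))
            (≡.cong₂ _+_ (≡.sym (count-here x cs)) (≡.sym (count-there cs (z≢y ∘ ≡.sym))))))
    ... | no z≢x | yes ≡.refl = ≡.trans (≡.cong (λ v → count y (v ∷ map merge cs)) (merge-≢ z≢x)) (≡.trans (count-here y (map merge cs)) (≡.trans (≡.cong suc (count-merged cs))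
            (≡.trans (≡.sym (ℕ.+-suc (count x cs) (count y cs))) (≡.cong₂ _+_ (≡.sym (count-there cs (z≢x ∘ ≡.sym))) (≡.sym (count-here y cs))))))
    ... | no z≢x | no z≢y = ≡.trans (≡.cong (λ v → count y (v ∷ map merge cs)) (merge-≢ z≢x)) (≡.trans (count-there (map merge cs) (z≢y ∘ ≡.sym)) (≡.trans (count-merged cs)
            (≡.cong₂ _+_ (≡.sym (count-there cs (z≢x ∘ ≡.sym))) (≡.sym (count-there cs (z≢y ∘ ≡.sym))))))

    count-other : ∀ w cs → w ≢ y → count w (map merge cs) ≤ count w cs
    count-other w [] w≢y = z≤n
    count-other w (z ∷ cs) w≢y with z ℕ.≟ x | w ℕ.≟ z
    ... | yes ≡.refl | yes ≡.refl = ℕ.≤-trans (ℕ.≤-reflexive (≡.trans (≡.cong (λ v → count w (v ∷ map merge cs)) merge-x) (count-there (map merge cs) w≢y)))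
            (ℕ.≤-trans (count-other w cs w≢y) (ℕ.≤-trans (ℕ.n≤1+n _) (ℕ.≤-reflexive (≡.sym (count-here w cs)))))
    ... | yes ≡.refl | no w≢z = ℕ.≤-trans (ℕ.≤-reflexive (≡.trans (≡.cong (λ v → count w (v ∷ map merge cs)) merge-x) (count-there (map merge cs) w≢y)))
            (ℕ.≤-trans (count-other w cs w≢y) (ℕ.≤-reflexive (≡.sym (count-there cs w≢z))))
    ... | no z≢x | yes ≡.refl = ℕ.≤-trans (ℕ.≤-reflexive (≡.trans (≡.cong (λ v → count w (v ∷ map merge cs)) (merge-≢ z≢x)) (count-here w (map merge cs))))
            (ℕ.≤-trans (s≤s (count-other w cs w≢y)) (ℕ.≤-reflexive (≡.sym (count-here w cs))))
    ... | no z≢x | no w≢z = ℕ.≤-trans (ℕ.≤-reflexive (≡.trans (≡.cong (λ v → count w (v ∷ map merge cs)) (merge-≢ z≢x)) (count-there (map merge cs) w≢z)))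
            (ℕ.≤-trans (count-other w cs w≢y) (ℕ.≤-reflexive (≡.sym (count-there cs w≢z))))

    module _ (y<x : y < x) where
      merge-≤ : ∀ z → merge z ≤ z
      merge-≤ z with z ℕ.≟ x
      ... | yes ≡.refl = ℕ.≤-trans (ℕ.≤-reflexive merge-x) (ℕ.<⇒≤ y<x)
      ... | no z≢x = ℕ.≤-reflexive (merge-≢ z≢x)

      sum-≤ : ∀ cs → sum (map merge cs) ≤ sum cs
      sum-≤ []       = z≤n
      sum-≤ (z ∷ cs) = ℕ.+-mono-≤ (merge-≤ z) (sum-≤ cs)

      sum-< : ∀ {cs} → x ∈ cs → sum (map merge cs) < sum cs
      sum-< {cs = _ ∷ cs} (here ≡.refl) = ℕ.+-mono-<-≤ (ℕ.≤-<-trans (ℕ.≤-reflexive merge-x) y<x) (sum-≤ cs)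
      sum-< {cs = z ∷ cs} (there p) = ℕ.+-mono-≤-< (merge-≤ z) (sum-< p)

  -- As long as two classes have total size at most three, the larger of the two colours is renamed
  -- to the smaller. The sum of all colours then decreases, which drives the induction.
  coarsen : ∀ cs → Acc _<_ (sum cs) → Small cs → ∃[ φ ] (Small (map φ cs) × Tight (map φ cs))
  coarsen cs (acc rs) small with any? (λ x → any? (λ y → (y ℕ.<? x) ×-dec (count x cs + count y cs ℕ.≤? 3)) cs) cs
  ... | no none = id , ≡.subst Small (≡.sym (map-id cs)) small , ≡.subst Tight (≡.sym (map-id cs)) tight
    where
    apart : ∀ {x y} → x ∈ cs → y ∈ cs → y < x → 3 < count x cs + count y cs
    apart {x} {y} x∈ y∈ y<x with count x cs + count y cs ℕ.≤? 3
    ... | yes p = contradiction (lose x∈ (lose y∈ (y<x , p))) none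
    ... | no ¬p = ℕ.≰⇒> ¬p
    tight : Tight cs
    tight {x} {y} x∈ y∈ x≢y with ℕ.<-cmp x y
    ... | tri< x<y _ _ = ≡.subst (3 <_) (ℕ.+-comm (count y cs) (count x cs)) (apart y∈ x∈ x<y)
    ... | tri≈ _ x≡y _ = contradiction x≡y x≢y
    ... | tri> _ _ y<x = apart x∈ y∈ y<x
  ... | yes found with find found
  ...   | x , x∈ , found′ with find found′
  ...     | y , y∈ , y<x , sum≤3 with coarsen (map merge cs) (rs (sum-< y<x x∈)) smaller
      where
      open Merge x y (ℕ.>⇒≢ y<x)
      smaller : Small (map merge cs)
      smaller z with z ℕ.≟ y
      ... | yes ≡.refl = ℕ.≤-trans (ℕ.≤-reflexive (count-merged cs)) sum≤3
      ... | no z≢y = ℕ.≤-trans (count-other z cs z≢y) (small z)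
  ...       | φ , s , t = φ ∘ Merge.merge x y (ℕ.>⇒≢ y<x) , ≡.subst Small (≡.sym (map-∘ cs)) s , ≡.subst Tight (≡.sym (map-∘ cs)) t

  <ᵇ-true : ∀ m n → (m <ᵇ n) ≡ true → m < n
  <ᵇ-true m n e = ℕ.<ᵇ⇒< m n (≡.subst T (≡.sym e) tt)
    where
    open import Data.Bool.Base using (T)
    open import Data.Unit.Base using (tt)

  true-<ᵇ : ∀ {m n} → m < n → (m <ᵇ n) ≡ true
  true-<ᵇ {zero}  (s≤s _) = ≡.refl
  true-<ᵇ {suc m} (s≤s p) = true-<ᵇ p

  exceptional-sound : ∀ w a n bs → exceptional w a n bs ≡ true → ∃[ b ] (b ∈ bs × a ≢ b × n + count b w < 4)
  exceptional-sound w a n (b ∷ bs) e with ∨-split {not (a ≡ᵇ b) ∧ (n + count b w <ᵇ 4)} e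
  ... | inj₁ e₁ = b , here ≡.refl , ≡ᵇ-≢ a b (not-true (proj₁ (∧-split e₁))) , <ᵇ-true _ _ (proj₂ (∧-split {not (a ≡ᵇ b)} e₁))
  ... | inj₂ e₂ with exceptional-sound w a n bs e₂
  ...   | c , c∈ , rest = c , there c∈ , rest

  loose-sound : ∀ w as → loose w as ≡ true → ∃[ a ] ∃[ b ] (a ∈ as × b ∈ w × a ≢ b × count a w + count b w < 4)
  loose-sound w (a ∷ as) e with ∨-split {if 2 <ᵇ count a w then false else exceptional w a (count a w) w} e
  ... | inj₂ e₂ with loose-sound w as e₂
  ...   | c , b , c∈ , rest = c , b , there c∈ , rest
  loose-sound w (a ∷ as) e | inj₁ e₁ with exceptional-sound w a (count a w) w (proj₂ (if-false {2 <ᵇ count a w} e₁))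
  ... | b , b∈ , a≢b , lt = a , b , here ≡.refl , b∈ , a≢b , lt

  reuse-sound : ∀ k i m as {j} → reuse k i m as ≡ true → j < i → count j as < 3 → enumerate k m (j ∷ as) ≡ true
  reuse-sound k (suc i) m as {j} e j<i few with j ℕ.≟ i
  ... | yes ≡.refl = ≡.trans (≡.sym (≡.cong (λ b → if b then enumerate k m (j ∷ as) else true) (true-<ᵇ few))) (proj₁ (∧-split e))
  ... | no j≢i = reuse-sound k i m as (proj₂ (∧-split {if count i as <ᵇ 3 then enumerate k m (i ∷ as) else true} e)) (ℕ.≤∧≢⇒< (ℕ.≤-pred j<i) j≢i) few

  Winnable : List ℕ → Set
  Winnable cs = ∃[ φ ] allWin (map φ cs) ≡ true

  module Fresh (ψ : ℕ → ℕ) (y m : ℕ) where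
    fresh : ℕ → ℕ
    fresh z = if z ≡ᵇ y then m else ψ z

    fresh-y : fresh y ≡ m
    fresh-y rewrite ≡ᵇ-refl y = ≡.refl

    fresh-≢ : ∀ {z} → z ≢ y → fresh z ≡ ψ z
    fresh-≢ z≢y rewrite ≡ᵇ-false z≢y = ≡.refl

    map-fresh : ∀ xs → ¬ (y ∈ xs) → map fresh xs ≡ map ψ xs
    map-fresh []       y∉ = ≡.refl
    map-fresh (x ∷ xs) y∉ = ≡.cong₂ _∷_ (fresh-≢ (λ x≡y → y∉ (here (≡.sym x≡y)))) (map-fresh xs (y∉ ∘ there))

  -- xs holds the part already read, latest first, and ψ names its values 0, 1, … in order of appearance.
  enumerate-sound : ∀ ys xs ψ m → enumerate (length ys) m (map ψ xs) ≡ true →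
    (∀ {x} → x ∈ xs → ψ x < m) → (∀ {x y} → x ∈ xs → y ∈ xs → ψ x ≡ ψ y → x ≡ y) →
    Small (xs ʳ++ ys) → Tight (xs ʳ++ ys) → Winnable (xs ʳ++ ys)
  enumerate-sound [] xs ψ m e below inj small tight with ∨-split {loose (map ψ xs) (map ψ xs)} e
  ... | inj₂ win = ψ , ≡.trans (≡.cong allWin (reverse-map ψ xs)) win
  -- A loose string would exhibit two classes that can be merged, against `tight`.
  ... | inj₁ e₁ with loose-sound (map ψ xs) (map ψ xs) e₁
  ...   | a , b , a∈ , b∈ , a≢b , lt with ∈.∈-map⁻ ψ a∈ | ∈.∈-map⁻ ψ b∈
  ...     | x , x∈ , ≡.refl | y , y∈ , ≡.refl = contradiction (tight (rev x∈) (rev y∈) (a≢b ∘ ≡.cong ψ))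
              (ℕ.≤⇒≯ (ℕ.≤-trans (ℕ.≤-reflexive (≡.cong₂ _+_ (counted x∈) (counted y∈))) (ℕ.≤-pred lt)))
    where
    rev : ∀ {x} → x ∈ xs → x ∈ xs ʳ++ []
    rev = ↭.∈-resp-↭ (↭-sym (↭.↭-reverse xs))
    counted : ∀ {x} → x ∈ xs → count x (xs ʳ++ []) ≡ count (ψ x) (map ψ xs)
    counted {x} x∈ = ≡.trans (count-ʳ++ x xs []) (≡.trans (ℕ.+-identityʳ _) (≡.sym (count-map ψ x xs (inj x∈))))
  enumerate-sound (y ∷ ys) xs ψ m e below inj small tight with any? (y ℕ.≟_) xs
  ... | yes y∈ = enumerate-sound ys (y ∷ xs) ψ m
          (reuse-sound (length ys) m m (map ψ xs) (proj₂ (∧-split {enumerate (length ys) (suc m) (m ∷ map ψ xs)} e)) (below y∈) few)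
          (λ { (here ≡.refl) → below y∈ ; (there p) → below p })
          (λ { (here ≡.refl) (here ≡.refl) _ → ≡.refl ; (here ≡.refl) (there q) → inj y∈ q ; (there p) (here ≡.refl) → inj p y∈ ; (there p) (there q) → inj p q })
          small tight
    where
    few : count (ψ y) (map ψ xs) < 3
    -- The occurrence of `y` about to be read counts towards its three, so at most two have been
    -- read so far.
    few = ℕ.≤-trans (ℕ.≤-reflexive (≡.cong suc (count-map ψ y xs (inj y∈)))) (ℕ.≤-pred (ℕ.≤-trans (ℕ.≤-trans (s≤s (s≤s (ℕ.m≤m+n _ (count y ys))))
      (ℕ.≤-reflexive (≡.cong suc (≡.trans (≡.sym (ℕ.+-suc (count y xs) (count y ys))) (≡.trans (≡.cong (count y xs +_) (≡.sym (count-here y ys))) (≡.sym (count-ʳ++ y xs (y ∷ ys)))))))) (s≤s (small y))))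
  ... | no y∉ = enumerate-sound ys (y ∷ xs) fresh (suc m)
          (≡.subst₂ (λ a as → enumerate (length ys) (suc m) (a ∷ as) ≡ true) (≡.sym fresh-y) (≡.sym (map-fresh xs y∉)) (proj₁ (∧-split e)))
          (λ { (here ≡.refl) → ℕ.≤-reflexive (≡.cong suc fresh-y) ; (there p) → ℕ.≤-trans (ℕ.≤-reflexive (≡.cong suc (old p))) (ℕ.m≤n⇒m≤1+n (below p)) })
          injective small tight
    where
    open Fresh ψ y m
    old : ∀ {x} → x ∈ xs → fresh x ≡ ψ x
    old x∈ = fresh-≢ λ { ≡.refl → y∉ x∈ }
    injective : ∀ {a b} → a ∈ y ∷ xs → b ∈ y ∷ xs → fresh a ≡ fresh b → a ≡ b
    injective (here ≡.refl) (here ≡.refl) _  = ≡.refl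
    injective (here ≡.refl) (there q)     eq = contradiction (≡.trans (≡.sym (old q)) (≡.trans (≡.sym eq) fresh-y)) (ℕ.<⇒≢ (below q))
    injective (there p)     (here ≡.refl) eq = contradiction (≡.trans (≡.sym (old p)) (≡.trans eq fresh-y)) (ℕ.<⇒≢ (below p))
    injective (there p)     (there q)     eq = inj p q (≡.trans (≡.sym (old p)) (≡.trans eq (old q)))

  winnable : (∀ n → n ≡ 10 → enumerate n 0 [] ≡ true) → ∀ cs → length cs ≡ 10 → Small cs → Winnable cs
  winnable covered cs len small with coarsen cs (<-wellFounded (sum cs)) small
  ... | φ , s , t with enumerate-sound (map φ cs) [] id 0 (covered _ (≡.trans (length-map φ cs) len)) (λ ()) (λ ()) s t
  ...   | φ′ , win = φ′ ∘ φ , ≡.trans (≡.cong allWin (map-∘ cs)) win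

  module _ {m} (col : Fin 10 → Fin m) where
    colours : List (Fin 10) → List ℕ
    colours = map (toℕ ∘ col)

    count-colours : ∀ j is → count (toℕ j) (colours is) ≡ length (filter (λ i → col i Fin.≟ j) is)
    count-colours j []       = ≡.refl
    count-colours j (i ∷ is) with col i Fin.≟ j
    ... | yes ≡.refl = ≡.trans (count-here (toℕ j) (colours is)) (≡.cong suc (count-colours j is))
    ... | no ≢j = ≡.trans (count-there (colours is) (λ e → ≢j (≡.sym (Fin.toℕ-injective e)))) (count-colours j is)

    count-absent : ∀ {x} is → m ≤ x → count x (colours is) ≡ 0
    count-absent []       m≤x = ≡.refl
    count-absent (i ∷ is) m≤x = ≡.trans (count-there (colours is) (ℕ.>⇒≢ (ℕ.<-≤-trans (Fin.toℕ<n (col i)) m≤x))) (count-absent is m≤x)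

    small-colours : (∀ j → classSize col j ≤ 3) → ∀ {is} → is ↭ allFin 10 → Small (colours is)
    small-colours size σ x with x ℕ.<? m
    ... | yes x<m = ℕ.≤-trans (ℕ.≤-reflexive (≡.trans (count-↭ x (↭.map⁺ (toℕ ∘ col) σ)) (≡.trans (≡.cong (λ y → count y (colours (allFin 10))) (≡.sym (Fin.toℕ-fromℕ< x<m)))
                      (count-colours (fromℕ< x<m) (allFin 10))))) (size (fromℕ< x<m))
    ... | no x≮m = ℕ.≤-trans (ℕ.≤-reflexive (≡.trans (count-↭ x (↭.map⁺ (toℕ ∘ col) σ)) (count-absent (allFin 10) (ℕ.≮⇒≥ x≮m)))) z≤n

-- Evaluation of the colour search and conclusion.

open import Data.Fin using (toℕ)
open import Data.Fin.Properties using (_≟_; all?)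
open import Data.List.Base using ([])
open import Data.List.Properties using (length-map; map-∘)
open import Data.List.Relation.Binary.Permutation.Propositional.Properties using (↭-length)
open import Data.Bool.Base using (true)
open import Data.Product using (_,_; ∃-syntax)
open import Function.Base using (_∘_)
open import Relation.Nullary using (Dec; _→-dec_)
open import Relation.Binary.PropositionalEquality using (refl; sym; trans; cong)

-- The search over all colourings is evaluated by this `refl`; for a variable `n` it is stuck, so
-- that uses of the result do not unfold it.
covered : ∀ n → n ≡ 10 → Search.enumerate n 0 [] ≡ true
covered _ refl = refl

module Theorem {c ℓ ℓ₂} (ℝ : RealField c ℓ ℓ₂) {m : ℕ} (col : Fin 10 → Fin m) (size : ∀ j → classSize col j ≤ 3) where
  open Separation.Sums ℝ using (Point; General; Works)
  open GeneralPosition.Approximation ℝ using (Spread)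

  Rainbow : (Fin 10 → Fin 4) → Set
  Rainbow π = ∀ i k → π i ≡ π k → col i ≡ col k → i ≡ k

  rainbow? : ∀ π → Dec (Rainbow π)
  rainbow? π = all? λ i → all? λ k → (π i ≟ π k) →-dec ((col i ≟ col k) →-dec (i ≟ k))

  rainbow-ext : ∀ {π ρ} → (∀ i → ρ i ≡ π i) → Rainbow π → Rainbow ρ
  rainbow-ext e r i k ρ≡ = r i k (trans (sym (e i)) (trans ρ≡ (e k)))

  general-case : ∀ y → General y → Spread y → ∃[ π ] (Rainbow π × Works y π)
  general-case y general spread = run (SecondStage.Plan.plan ℝ y general spread)
    where
    run : SecondStage.Plan.Plan ℝ y general → ∃[ π ] (Rainbow π × Works y π)
    run (is , σ , wins) = finish (Colourings.winnable covered (Colourings.colours col is) (trans (length-map _ is) (↭-length σ)) (Colourings.small-colours col size σ))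
      where
      finish : Colourings.Winnable (Colourings.colours col is) → ∃[ π ] (Rainbow π × Works y π)
      finish (φ , win) = solve (wins (φ ∘ toℕ ∘ col) _ (sym (map-∘ is)) win)
        where
        solve : RainbowTriples.Rainbow.Solution ℝ y general (φ ∘ toℕ ∘ col) → ∃[ π ] (Rainbow π × Works y π)
        -- `φ` only identifies colours, so a partition that is rainbow after the identification is
        -- rainbow for `col`.
        solve (π , rainbow , works) = π , (λ i k π≡ col≡ → rainbow i k π≡ (cong (φ ∘ toℕ) col≡)) , works

theorem1p2 : ∀ {c ℓ ℓ₂} (ℝ : RealField c ℓ ℓ₂) →
    (x : Fin 10 → Geometry.Point ℝ) →
    (∀ i j → Geometry._≈ₚ_ ℝ (x i) (x j) → i ≡ j) →
    (m : ℕ) (col : Fin 10 → Fin m) →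
    (∀ j → classSize col j ≤ 3) →
    Σ[ part ∈ (Fin 10 → Fin 4) ] (
      (∀ i k → part i ≡ part k → col i ≡ col k → i ≡ k)
      × Σ[ p ∈ Geometry.Point ℝ ] (∀ (t : Fin 4) → Geometry.InConv ℝ x (λ i → part i ≡ t) p))
theorem1p2 ℝ x _ m col size = GeneralPosition.Approximation.from-general ℝ Rainbow rainbow? rainbow-ext general-case x
  where open Theorem ℝ col size
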